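{- Let $r,n$ be positive integers and $h\in\{0,1,\dots,r-1\}$. Let $k,b$ be integers with $1\le k\le n-1$, $k+1\le b\le n$ and $b\equiv n\pmod 2$, and let $U,V$ be the words (all entries of color $0$) $$U=(b-k,b-k+1,\dots,b-1),\qquad V=(b-k+1,b-k+2,\dots,b).$$ Then the following identities of polynomials in $q$ hold. (i) If $k$ is odd, then $$\sum_{\pi\in G_{r,n}(U)}\chi_{ -1,h}(\pi)q^{\mathrm{fmaj}(\pi)}+\sum_{\pi\in G_{r,n}(V)}\chi_{ -1,h}(\pi)q^{\mathrm{fmaj}(\pi)}$$ is equal to $$2\,[k+1]_{ -q^r}\prod_{i=k+2}^{n}[ir]_{(-1)^{i-1}\zeta^h q}\quad\text{if } n \text{ is even},$$ and to $$2\,[k+1]_{ -q^r}[k+2]_{q^r}[r]_{\zeta^h q}\prod_{i=k+3}^{n}[ir]_{(-1)^{i-1}\zeta^h q}\quad\text{if } n \text{ is odd}.$$ (ii) If $k$ is even, then $$\sum_{\pi\in G_{r,n}(U)\setminus G_{r,n}(V)}\chi_{ -1,h}(\pi)q^{\mathrm{fmaj}(\pi)}+\sum_{\pi\in G_{r,n}(V)\setminus G_{r,n}(U)}\chi_{ -1,h}(\pi)q^{\mathrm{fmaj}(\pi)}$$ is equal to $$2\,[k+1]_{ -q^r}\big([r]_{\zeta^h q}-1\big)\prod_{i=k+2}^{n}[ir]_{(-1)^{i-1}\zeta^h q}\quad\text{if } n \text{ is odd},$$ and to $$2 f(r;q)\,[k+1]_{q^r}[k+2]_{ -q^r}\prod_{i=k+3}^{n}[ir]_{(-1)^{i-1}\zeta^h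 q}\quad\text{if } n \text{ is even},$$ where $f(r;q)=-(\zeta^h q)\,[r-1]_{(-1)^r\zeta^h q}\,[r]_{(-1)^{r-1}\zeta^h q}$.
   Context: Here $q$ is an indeterminate, $\zeta\in\mathbb{C}$ is a fixed primitive $r$th root of unity, and $[m]_x:=1+x+\cdots+x^{m-1}$ for an integer $m\ge 0$ (so $[0]_x=0$). Empty products equal $1$. $G_{r,n}=\mathbb{Z}_r\wr S_n$ is the group of colored permutations: its elements are $\pi=(\pi_1,\dots,\pi_n)=(\sigma_1^{z_1},\dots,\sigma_n^{z_n})$ with $\sigma=(\sigma_1,\dots,\sigma_n)\in S_n$ (one-line notation) and colors $z_i\in\{0,\dots,r-1\}$. Write $|\pi|=\sigma$ and $\mathrm{col}(\pi)=z_1+\cdots+z_n$ (sum of integers). A colored integer of color $0$ is written without exponent. For $\sigma\in S_n$, $\mathrm{inv}(\sigma)=\#\{i<j:\sigma_i>\sigma_j\}$. The one-dimensional character $\chi_{\epsilon,h}$ ($\epsilon\in\{1,-1\}$) is $\chi_{\epsilon,h}(\pi)=\epsilon^{\mathrm{inv}(|\pi|)}\zeta^{h\cdot\mathrm{col}(\pi)}$. Colored integers are compared in the linear order $$1^{r-1}<\cdots<n^{r-1}<\cdots<1^1<\cdots<n^1<1<\cdots<n.$$ With this order, $\mathrm{maj}_F(\pi)=\sum_{1\le i\le n-1,\ \pi_i>\pi_{i+1}}i$ and $\mathrm{fmaj}(\pi)=r\cdot\mathrm{maj}_F(\pi)+\mathrm{col}(\pi)$. For a word $W$ of colored integers with distinct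 absolute values in $\{1,\dots,n\}$, $G_{r,n}(W)$ is the set of $\pi\in G_{r,n}$ whose word $(\pi_1,\dots,\pi_n)$ contains $W$ (with its colors) as a (not necessarily contiguous) subsequence. -}

module Defs where

open import Algebra.Bundles using (CommutativeRing; RawRing)
import Algebra.Definitions.RawSemiring as RawSemiringDefinitions
open import Data.Bool.Base using (if_then_else_)
open import Data.List.Base
  using (List; []; _∷_; map; filter; foldr; length; applyUpTo; upTo; cartesianProduct; cartesianProductWith)
open import Data.List.Relation.Binary.Sublist.DecPropositional using (_⊆?_)
open import Data.List.Relation.Unary.Unique.DecPropositional using (unique?)
open import Data.Nat.Base as ℕ using (ℕ; zero; suc; _∸_; _<_)
open import Data.Nat.ListAction using (sum)
open import Data.Nat.Properties using (_≟_; _<?_)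
open import Data.Product.Base using (_×_; _,_; proj₁; proj₂)
open import Data.Product.Properties using (≡-dec)
open import Data.Sum.Base using (_⊎_)
open import Level using (_⊔_)
open import Relation.Binary.Definitions using (Decidable; DecidableEquality)
open import Relation.Binary.PropositionalEquality.Core using (_≡_)
open import Relation.Nullary.Decidable using (does; _×-dec_; _⊎-dec_; ¬?)
open import Relation.Nullary.Negation using (¬_)

-- range a b = a ∷ a + 1 ∷ … ∷ b ∷ [], which is empty when b < a.
range : ℕ → ℕ → List ℕ
range a b = applyUpTo (a ℕ.+_) (suc b ∸ a)

-- The pair (i , z) is the colored integer i^z.
ColoredInt : Set
ColoredInt = ℕ × ℕ

∣_∣ : ColoredInt → ℕ
∣_∣ = proj₁

color : ColoredInt → ℕ
color = proj₂

_≟ᶜ_ : DecidableEquality ColoredInt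
_≟ᶜ_ = ≡-dec _≟_ _≟_

-- 1^(r-1) < ⋯ < n^(r-1) < ⋯ < 1^1 < ⋯ < n^1 < 1 < ⋯ < n
infix 4 _<ᶜ_ _<ᶜ?_

_<ᶜ_ : ColoredInt → ColoredInt → Set
c <ᶜ d = color d < color c ⊎ (color c ≡ color d × ∣ c ∣ < ∣ d ∣)

_<ᶜ?_ : Decidable _<ᶜ_
c <ᶜ? d = (color d <? color c) ⊎-dec ((color c ≟ color d) ×-dec (∣ c ∣ <? ∣ d ∣))

Word : Set
Word = List ColoredInt

uncolored : List ℕ → Word
uncolored = map (_, 0)

wordsOver : List ColoredInt → ℕ → List Word
wordsOver alphabet zero    = [] ∷ []
wordsOver alphabet (suc n) = cartesianProductWith _∷_ alphabet (wordsOver alphabet n)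

-- The elements of ℤ_r ≀ S_n, each listed once: a word of length n over
-- {1,…,n} × {0,…,r-1} with distinct absolute values has a permutation of
-- {1,…,n} as its word of absolute values.
G : (r n : ℕ) → List Word
G r n = filter (λ π → unique? _≟_ (map ∣_∣ π))
               (wordsOver (cartesianProduct (range 1 n) (upTo r)) n)

-- Here _⊆?_ decides the (not necessarily contiguous) subsequence relation.
G⟨_,_⟩[_] : (r n : ℕ) → Word → List Word
G⟨ r , n ⟩[ W ] = filter (λ π → _⊆?_ _≟ᶜ_ W π) (G r n)

G⟨_,_⟩[_∖_] : (r n : ℕ) → Word → Word → List Word
G⟨ r , n ⟩[ W ∖ W′ ] = filter (λ π → ¬? (_⊆?_ _≟ᶜ_ W′ π)) G⟨ r , n ⟩[ W ]

inv : List ℕ → ℕ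
inv []      = 0
inv (x ∷ σ) = length (filter (_<? x) σ) ℕ.+ inv σ

col : Word → ℕ
col π = sum (map color π)

-- The first argument is the position of the first letter of the word.
majFrom : ℕ → Word → ℕ
majFrom i []          = 0
majFrom i (c ∷ [])    = 0
majFrom i (c ∷ d ∷ π) = (if does (d <ᶜ? c) then i else 0) ℕ.+ majFrom (suc i) (d ∷ π)

majF : Word → ℕ
majF = majFrom 1

fmaj : ℕ → Word → ℕ
fmaj r π = r ℕ.* majF π ℕ.+ col π

module GeneratingFunctions {c ℓ} (R : CommutativeRing c ℓ) where
  open CommutativeRing R
  open import Algebra.Properties.Semiring.Exp semiring public using (_^_)

  record IsPrimitiveRoot (r : ℕ) (ζ : Carrier) : Set ℓ where
    field
      ζ^r≈1 : ζ ^ r ≈ 1#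
      ζ^m≉1 : ∀ {m} → 0 < m → m < r → ¬ (ζ ^ m ≈ 1#)

  -- χ ε ζ h is the one-dimensional character χ_{ε,h} for the root of unity ζ.
  χ : (ε ζ : Carrier) (h : ℕ) → Word → Carrier
  χ ε ζ h π = ε ^ inv (map ∣_∣ π) * ζ ^ (h ℕ.* col π)

  -- The polynomials in q over R, as lists of coefficients in increasing degree.
  -- Trailing zeros are allowed, so that equality of polynomials is _≈ₚ_.
  Poly : Set c
  Poly = List Carrier

  coeff : Poly → ℕ → Carrier
  coeff []      _       = 0#
  coeff (a ∷ p) zero    = a
  coeff (a ∷ p) (suc i) = coeff p i

  infix  4 _≈ₚ_
  infixl 6 _+ₚ_
  infixl 7 _*ₚ_
  infix  8 -ₚ_

  _≈ₚ_ : Poly → Poly → Set ℓ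
  p ≈ₚ s = ∀ i → coeff p i ≈ coeff s i

  _+ₚ_ : Poly → Poly → Poly
  []      +ₚ s       = s
  (a ∷ p) +ₚ []      = a ∷ p
  (a ∷ p) +ₚ (b ∷ s) = (a + b) ∷ (p +ₚ s)

  _*ₚ_ : Poly → Poly → Poly
  []      *ₚ s = []
  (a ∷ p) *ₚ s = map (a *_) s +ₚ (0# ∷ (p *ₚ s))

  -ₚ_ : Poly → Poly
  -ₚ_ = map (-_)

  const : Carrier → Poly
  const a = a ∷ []

  0ₚ 1ₚ 2ₚ q : Poly
  0ₚ = []
  1ₚ = const 1#
  2ₚ = 1ₚ +ₚ 1ₚ
  q  = 0# ∷ 1# ∷ []

  polynomialRawRing : RawRing c ℓ
  polynomialRawRing = record
    { Carrier = Poly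
    ; _≈_     = _≈ₚ_
    ; _+_     = _+ₚ_
    ; _*_     = _*ₚ_
    ; -_      = -ₚ_
    ; 0#      = 0ₚ
    ; 1#      = 1ₚ
    }

  open RawSemiringDefinitions (RawRing.rawSemiring polynomialRawRing) public
    using () renaming (_^_ to _^ₚ_)

  ∑ ∏ : ∀ {a} {A : Set a} → List A → (A → Poly) → Poly
  ∑ xs f = foldr _+ₚ_ 0ₚ (map f xs)
  ∏ xs f = foldr _*ₚ_ 1ₚ (map f xs)

  syntax ∑ xs (λ x → p) = ∑[ x ∈ xs ] p
  syntax ∏ xs (λ x → p) = ∏[ x ∈ xs ] p

  infix 9 [_]⟨_⟩

  -- [ m ]⟨ x ⟩ = 1 + x + ⋯ + x^(m-1)
  [_]⟨_⟩ : ℕ → Poly → Poly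
  [ m ]⟨ x ⟩ = ∑ (upTo m) (x ^ₚ_)

{-# OPTIONS --safe #-}

-- Put x = ζ^h q, so that X = x^r = q^r and a colored permutation π contributes T π = ± x^(fmaj π),
-- and let S w be the sum of T π over all π containing the word w.  Then S w is the sum of S over
-- all insertions of a missing letter into w.  Interchanging the absolute values c and c + 1 changes
-- the sign of T unless they belong to adjacent letters of the same color.  Hence the sum of T over
-- all insertions of such a pair into w is T w times a factor that depends only on the length m of
-- w, namely [(m+1)r] [(m+2)r] at ± x and ∓ x, and S w is an explicit multiple of T w if the
-- absolute values missing from w form consecutive pairs.
-- Let a = b - k.  Expand S U by inserting b and S V by inserting a.  Moving the inserted letter
-- through the interval {a,…,b} by interchanges turns the first sum into the second one up to sign,
-- apart from the increasing word of length k + 1.  What remains is a sum over insertions of a into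
-- V; it is evaluated directly if a - 1 is even, and after inserting a - 1 as well if a - 1 is odd.

module Submission where

open import Defs
open import Algebra.Bundles using (CommutativeRing)
import Algebra.Properties.AbelianGroup as AbelianGroupProperties
import Algebra.Properties.CommutativeSemigroup as CommutativeSemigroupProperties
import Algebra.Properties.CommutativeSemiring.Exp as Exp
import Algebra.Properties.Ring as RingProperties
import Algebra.Properties.Semiring.Mult.TCOptimised as Mult
import Algebra.Solver.Ring as RingSolver
open import Algebra.Solver.Ring.AlmostCommutativeRing using (fromCommutativeRing; _-Raw-AlmostCommutative⟶_)
open import Data.Bool.Base using (Bool; true; false; not; if_then_else_)
open import Data.Integer.Base as ℤ using (ℤ; +_; -[1+_])
import Data.Integer.Properties as ℤ
open import Data.List.Base
  using (List; []; _∷_; _++_; _∷ʳ_; map; filter; foldr; length; applyUpTo; upTo; cartesianProduct)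
open import Data.List.Membership.DecPropositional using (_∈?_)
open import Data.List.Membership.Propositional using (_∈_; _∉_)
open import Data.List.Membership.Propositional.Properties
  using (∈-map⁺; ∈-map⁻; ∈-++⁺ˡ; ∈-++⁺ʳ; ∈-++⁻; ∈-∃++; ∈-filter⁺; ∈-filter⁻; ∈-upTo⁺; ∈-upTo⁻; ∈-applyUpTo⁺;
         ∈-cartesianProduct⁺; ∈-cartesianProduct⁻; ∈-cartesianProductWith⁺; ∈-cartesianProductWith⁻)
open import Data.List.Membership.Propositional.Properties.WithK using (unique∧set⇒bag)
import Data.List.Properties as List
open import Data.List.Relation.Binary.BagAndSetEquality using (∼bag⇒↭)
open import Data.List.Relation.Binary.Permutation.Propositional as ↭ using (_↭_; ↭-trans; ↭-sym; prep)
import Data.List.Relation.Binary.Permutation.Propositional.Properties as ↭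
import Data.List.Relation.Binary.Permutation.Setoid.Properties as ↭ˢ
open import Data.List.Relation.Binary.Pointwise using (Pointwise-≡⇒≡)
open import Data.List.Relation.Binary.Sublist.DecPropositional using (_⊆?_)
open import Data.List.Relation.Binary.Sublist.Heterogeneous.Properties using (toPointwise)
open import Data.List.Relation.Binary.Sublist.Propositional
  using (_⊆_; []; _∷_; from∈; ⊆-refl; ⊆-trans; minimum) renaming (_∷ʳ_ to _∷⊆_; lookup to ⊆-lookup)
import Data.List.Relation.Binary.Sublist.Propositional.Properties as ⊆
open import Data.List.Relation.Unary.All as All using (All; []; _∷_)
import Data.List.Relation.Unary.All.Properties as All
open import Data.List.Relation.Unary.AllPairs as AllPairs using (AllPairs; []; _∷_)
import Data.List.Relation.Unary.AllPairs.Properties as AllPairs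
open import Data.List.Relation.Unary.Any using (here; there)
open import Data.List.Relation.Unary.Linked using (Linked; []; [-]; _∷_)
open import Data.List.Relation.Unary.Unique.DecPropositional using (unique?)
open import Data.List.Relation.Unary.Unique.Propositional using (Unique)
import Data.List.Relation.Unary.Unique.Propositional.Properties as Unique
open import Data.List.Reverse using (Reverse; []; _∶_∶ʳ_; reverseView)
import Data.Maybe.Base as Maybe
open import Data.Nat.Base as ℕ using (ℕ; zero; suc; NonZero; _∸_; _≤_; _<_; parity; z≤n; s≤s; z<s; s<s; s<s⁻¹)
open import Data.Nat.ListAction using (sum)
open import Data.Nat.ListAction.Properties using (sum-↭)
open import Data.Nat.Properties as ℕ using (_≟_; _<?_)
open import Data.Parity.Base as ℙ using (0ℙ; 1ℙ)
import Data.Parity.Properties as ℙ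
open import Data.Product.Base using (_×_; _,_; proj₁; proj₂; ∃)
import Data.Sign.Base as Sign
open import Data.Sum.Base as Sum using (_⊎_; inj₁; inj₂)
open import Function.Base using (_∘_; id; case_of_)
open import Function.Bundles using (_⇔_; mk⇔; Equivalence)
open import Relation.Binary.Definitions using (WeaklyDecidable; tri<; tri≈; tri>)
open import Relation.Binary.PropositionalEquality as ≡ using (_≡_; _≢_; cong; cong₂; subst; subst₂)
import Relation.Binary.Reasoning.Setoid as SetoidReasoning
open import Relation.Nullary.Decidable using (Dec; does; yes; no; ¬?; dec-true; dec-false; does-⇔)
open import Relation.Nullary.Decidable.Core using (dec⇒maybe)
open import Relation.Nullary.Negation using (¬_; contradiction)

-- Integer coefficients for the ring solver

module IntegerCoefficients {c ℓ} (A : CommutativeRing c ℓ) where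
  open CommutativeRing A
  open AbelianGroupProperties +-abelianGroup using (⁻¹-∙-comm; ⁻¹-involutive; ε⁻¹≈ε)
  open RingProperties ring using (-‿distribˡ-*; -‿distribʳ-*)
  open Mult semiring renaming (_×_ to _·_)
  open SetoidReasoning setoid

  -- Integer coefficients have decidable equality, which lets the solver cancel terms. With this
  -- form of multiples, `⟦ + 1 ⟧ℤ` reduces to `1#`, so that `1ᵖ` denotes `1#` itself.
  ⟦_⟧ℤ : ℤ → Carrier
  ⟦ + n ⟧ℤ      = n · 1#
  ⟦ -[1+ n ] ⟧ℤ = - (suc n · 1#)

  ⟦⟧-⊖ : ∀ m n → ⟦ m ℤ.⊖ n ⟧ℤ ≈ m · 1# - n · 1#
  ⟦⟧-⊖ m zero = sym (trans (+-congˡ ε⁻¹≈ε) (+-identityʳ _))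
  ⟦⟧-⊖ zero (suc n) = sym (+-identityˡ _)
  ⟦⟧-⊖ (suc m) (suc n) rewrite ℤ.[1+m]⊖[1+n]≡m⊖n m n = begin
    ⟦ m ℤ.⊖ n ⟧ℤ  ≈⟨ ⟦⟧-⊖ m n ⟩
    m · 1# - n · 1#  ≈⟨ +-congˡ (+-identityˡ _) ⟨
    m · 1# + (0# - n · 1#)  ≈⟨ +-congˡ (+-congʳ (-‿inverseʳ 1#)) ⟨
    m · 1# + (1# - 1# - n · 1#)  ≈⟨ +-congˡ (+-assoc _ _ _) ⟩
    m · 1# + (1# + (- 1# - n · 1#))  ≈⟨ +-assoc _ _ _ ⟨
    (m · 1# + 1#) + (- 1# - n · 1#)  ≈⟨ +-cong (+-comm _ _) (⁻¹-∙-comm 1# _) ⟩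
    (1# + m · 1#) - (1# + n · 1#)  ≈⟨ +-cong (1+× m 1#) (-‿cong (1+× n 1#)) ⟨
    suc m · 1# - suc n · 1# ∎

  ⟦⟧-neg : ∀ i → ⟦ ℤ.- i ⟧ℤ ≈ - ⟦ i ⟧ℤ
  ⟦⟧-neg (+ zero)  = sym ε⁻¹≈ε
  ⟦⟧-neg (+ suc n) = refl
  ⟦⟧-neg -[1+ n ]  = sym (⁻¹-involutive _)

  ⟦⟧-+ : ∀ i j → ⟦ i ℤ.+ j ⟧ℤ ≈ ⟦ i ⟧ℤ + ⟦ j ⟧ℤ
  ⟦⟧-+ (+ m)    (+ n)    = ×-homo-+ 1# m n
  ⟦⟧-+ (+ m)    -[1+ n ] = ⟦⟧-⊖ m (suc n)
  ⟦⟧-+ -[1+ m ] (+ n)    = trans (⟦⟧-⊖ n (suc m)) (+-comm _ _)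
  ⟦⟧-+ -[1+ m ] -[1+ n ] = begin
    - (suc (suc (m ℕ.+ n)) · 1#)  ≈⟨ -‿cong (reflexive (cong (_· 1#) (ℕ.+-suc (suc m) n))) ⟨
    - ((suc m ℕ.+ suc n) · 1#)  ≈⟨ -‿cong (×-homo-+ 1# (suc m) (suc n)) ⟩
    - (suc m · 1# + suc n · 1#)  ≈⟨ ⁻¹-∙-comm _ _ ⟨
    - (suc m · 1#) - suc n · 1# ∎

  ⟦⟧-* : ∀ i j → ⟦ i ℤ.* j ⟧ℤ ≈ ⟦ i ⟧ℤ * ⟦ j ⟧ℤ
  ⟦⟧-* (+ m)    (+ n)    = trans (reflexive (cong ⟦_⟧ℤ (ℤ.+◃n≡+n (m ℕ.* n)))) (×1-homo-* m n)
  ⟦⟧-* (+ m)    -[1+ n ] = begin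
    ⟦ Sign.- ℤ.◃ m ℕ.* suc n ⟧ℤ  ≡⟨ cong ⟦_⟧ℤ (ℤ.-◃n≡-n (m ℕ.* suc n)) ⟩
    ⟦ ℤ.- + (m ℕ.* suc n) ⟧ℤ  ≈⟨ ⟦⟧-neg (+ (m ℕ.* suc n)) ⟩
    - ((m ℕ.* suc n) · 1#)  ≈⟨ -‿cong (×1-homo-* m (suc n)) ⟩
    - ((m · 1#) * (suc n · 1#))  ≈⟨ -‿distribʳ-* _ _ ⟩
    (m · 1#) * - (suc n · 1#) ∎
  ⟦⟧-* -[1+ m ] (+ n)    = begin
    ⟦ Sign.- ℤ.◃ suc m ℕ.* n ⟧ℤ  ≡⟨ cong ⟦_⟧ℤ (ℤ.-◃n≡-n (suc m ℕ.* n)) ⟩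
    ⟦ ℤ.- + (suc m ℕ.* n) ⟧ℤ  ≈⟨ ⟦⟧-neg (+ (suc m ℕ.* n)) ⟩
    - ((suc m ℕ.* n) · 1#)  ≈⟨ -‿cong (×1-homo-* (suc m) n) ⟩
    - ((suc m · 1#) * (n · 1#))  ≈⟨ -‿distribˡ-* _ _ ⟩
    - (suc m · 1#) * (n · 1#) ∎
  ⟦⟧-* -[1+ m ] -[1+ n ] = begin
    (suc m ℕ.* suc n) · 1#  ≈⟨ ×1-homo-* (suc m) (suc n) ⟩
    (suc m · 1#) * (suc n · 1#)  ≈⟨ ⁻¹-involutive _ ⟨
    - - ((suc m · 1#) * (suc n · 1#))  ≈⟨ -‿cong (-‿distribˡ-* _ _) ⟩
    - (- (suc m · 1#) * (suc n · 1#))  ≈⟨ -‿distribʳ-* _ _ ⟩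
    - (suc m · 1#) * - (suc n · 1#) ∎

  integerMorphism : ℤ.+-*-rawRing -Raw-AlmostCommutative⟶ fromCommutativeRing A
  integerMorphism = record
    { ⟦_⟧    = ⟦_⟧ℤ
    ; +-homo = ⟦⟧-+
    ; *-homo = ⟦⟧-*
    ; -‿homo = ⟦⟧-neg
    ; 0-homo = refl
    ; 1-homo = refl
    }

  _≟ℤ_ : WeaklyDecidable (λ i j → ⟦ i ⟧ℤ ≈ ⟦ j ⟧ℤ)
  i ≟ℤ j = Maybe.map (λ i≡j → reflexive (cong ⟦_⟧ℤ i≡j)) (dec⇒maybe (i ℤ.≟ j))

  open RingSolver ℤ.+-*-rawRing (fromCommutativeRing A) integerMorphism _≟ℤ_ public
    using (Polynomial; solve; _:=_; _:+_; _:*_; _:-_; :-_; con)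

  1ᵖ : ∀ {n} → Polynomial n
  1ᵖ = con ℤ.1ℤ

-- Sums over lists, initial segments and insertion positions

module Sums {c ℓ} (A : CommutativeRing c ℓ) where
  open CommutativeRing A
  open Exp commutativeSemiring
  open AbelianGroupProperties +-abelianGroup using (ε⁻¹≈ε; ⁻¹-∙-comm)
  open CommutativeSemigroupProperties +-commutativeSemigroup using (interchange)
  open RingProperties ring using (-‿distribˡ-*)
  open IntegerCoefficients A
  open SetoidReasoning setoid

  -- Over the polynomial ring `∑`, and with it `[_]⟪_⟫`, unfolds to the sum of the statement. `∑<`
  -- is the form that recurses directly, for use in proofs.
  ∑ : ∀ {a} {X : Set a} → List X → (X → Carrier) → Carrier
  ∑ xs f = foldr _+_ 0# (map f xs)

  ∑< : ℕ → (ℕ → Carrier) → Carrier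
  ∑< zero    f = 0#
  ∑< (suc n) f = f 0 + ∑< n (f ∘ suc)

  -- The factorizations w ≡ u ++ v stand for the positions at which a letter can be inserted into w.
  ∑ˢ : ∀ {a} {X : Set a} → (List X → List X → Carrier) → List X → Carrier
  ∑ˢ f []      = f [] []
  ∑ˢ f (x ∷ w) = f [] (x ∷ w) + ∑ˢ (λ u → f (x ∷ u)) w

  ∑-cong : ∀ {a} {X : Set a} (xs : List X) {f g : X → Carrier} →
           (∀ {x} → x ∈ xs → f x ≈ g x) → ∑ xs f ≈ ∑ xs g
  ∑-cong []       f≈g = refl
  ∑-cong (x ∷ xs) f≈g = +-cong (f≈g (here ≡.refl)) (∑-cong xs (f≈g ∘ there))

  ∑-0 : ∀ {a} {X : Set a} (xs : List X) → ∑ xs (λ _ → 0#) ≈ 0#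
  ∑-0 []       = refl
  ∑-0 (x ∷ xs) = trans (+-identityˡ _) (∑-0 xs)

  ∑-+ : ∀ {a} {X : Set a} (xs : List X) (f g : X → Carrier) →
        ∑ xs (λ x → f x + g x) ≈ ∑ xs f + ∑ xs g
  ∑-+ []       f g = sym (+-identityˡ 0#)
  ∑-+ (x ∷ xs) f g = trans (+-congˡ (∑-+ xs f g)) (interchange _ _ _ _)

  ∑-neg : ∀ {a} {X : Set a} (xs : List X) (f : X → Carrier) → ∑ xs (λ x → - f x) ≈ - ∑ xs f
  ∑-neg []       f = sym ε⁻¹≈ε
  ∑-neg (x ∷ xs) f = trans (+-congˡ (∑-neg xs f)) (⁻¹-∙-comm _ _)

  ∑-map : ∀ {a b} {X : Set a} {Y : Set b} (g : X → Y) (xs : List X) (f : Y → Carrier) →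
          ∑ (map g xs) f ≡ ∑ xs (f ∘ g)
  ∑-map g xs f = cong (foldr _+_ 0#) (≡.sym (List.map-∘ xs))

  ∑-applyUpTo : ∀ {a} {X : Set a} (g : ℕ → X) n (f : X → Carrier) → ∑ (applyUpTo g n) f ≡ ∑< n (f ∘ g)
  ∑-applyUpTo g zero    f = ≡.refl
  ∑-applyUpTo g (suc n) f = cong (λ s → f (g 0) + s) (∑-applyUpTo (g ∘ suc) n f)

  ∑<-cong : ∀ n {f g : ℕ → Carrier} → (∀ {i} → i ℕ.< n → f i ≈ g i) → ∑< n f ≈ ∑< n g
  ∑<-cong zero    f≈g = refl
  ∑<-cong (suc n) f≈g = +-cong (f≈g ℕ.z<s) (∑<-cong n (f≈g ∘ ℕ.s<s))

  ∑<-0 : ∀ n → ∑< n (λ _ → 0#) ≈ 0#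
  ∑<-0 zero    = refl
  ∑<-0 (suc n) = trans (+-identityˡ _) (∑<-0 n)

  ∑<-+ : ∀ n (f g : ℕ → Carrier) → ∑< n (λ i → f i + g i) ≈ ∑< n f + ∑< n g
  ∑<-+ zero    f g = sym (+-identityˡ 0#)
  ∑<-+ (suc n) f g = trans (+-congˡ (∑<-+ n (f ∘ suc) (g ∘ suc))) (interchange _ _ _ _)

  ∑<-*ˡ : ∀ n (a : Carrier) (f : ℕ → Carrier) → ∑< n (λ i → a * f i) ≈ a * ∑< n f
  ∑<-*ˡ zero    a f = sym (zeroʳ a)
  ∑<-*ˡ (suc n) a f = trans (+-congˡ (∑<-*ˡ n a (f ∘ suc))) (sym (distribˡ _ _ _))

  ∑<-*ʳ : ∀ n (a : Carrier) (f : ℕ → Carrier) → ∑< n (λ i → f i * a) ≈ ∑< n f * a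
  ∑<-*ʳ zero    a f = sym (zeroˡ a)
  ∑<-*ʳ (suc n) a f = trans (+-congˡ (∑<-*ʳ n a (f ∘ suc))) (sym (distribʳ _ _ _))

  ∑<-last : ∀ n (f : ℕ → Carrier) → ∑< (suc n) f ≈ ∑< n f + f n
  ∑<-last zero    f = +-comm _ _
  ∑<-last (suc n) f = trans (+-congˡ (∑<-last n (f ∘ suc))) (sym (+-assoc _ _ _))

  ∑<-single : ∀ n (f : ℕ → Carrier) j → j ℕ.< n → (∀ {i} → i ≡.≢ j → f i ≈ 0#) → ∑< n f ≈ f j
  ∑<-single (suc n) f zero    _   f≈0 =
    trans (+-congˡ (trans (∑<-cong n (λ _ → f≈0 λ ())) (∑<-0 n))) (+-identityʳ _)
  ∑<-single (suc n) f (suc j) j<n f≈0 =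
    trans (+-cong (f≈0 λ ()) (∑<-single n (f ∘ suc) j (ℕ.s<s⁻¹ j<n) (λ i≢j → f≈0 (i≢j ∘ ℕ.suc-injective))))
          (+-identityˡ _)

  -- Row 0 and column 0 cancel against each other outside the diagonal, and induction handles the
  -- rest. This serves for double sums over colors, where exchanging two distinct colors changes the
  -- sign.
  ∑<-antisym : ∀ n (f : ℕ → ℕ → Carrier) → (∀ {i j} → i ≡.≢ j → f i j + f j i ≈ 0#) →
               ∑< n (λ i → ∑< n (f i)) ≈ ∑< n (λ i → f i i)
  ∑<-antisym zero    f anti = refl
  ∑<-antisym (suc n) f anti = begin
    (f 0 0 + row) + ∑< n (λ i → f (suc i) 0 + ∑< n (f (suc i) ∘ suc))  ≈⟨ +-congˡ (∑<-+ n _ _) ⟩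
    (f 0 0 + row) + (column + rest)  ≈⟨ regroup _ _ _ _ ⟩
    f 0 0 + ((row + column) + rest)  ≈⟨ +-congˡ (+-cong row+column≈0 (∑<-antisym n (λ i j → f (suc i) (suc j)) (anti ∘ (_∘ ℕ.suc-injective)))) ⟩
    f 0 0 + (0# + ∑< n (λ i → f (suc i) (suc i)))  ≈⟨ +-congˡ (+-identityˡ _) ⟩
    f 0 0 + ∑< n (λ i → f (suc i) (suc i)) ∎
    where
    row  = ∑< n (f 0 ∘ suc)
    column = ∑< n (λ i → f (suc i) 0)
    rest = ∑< n (λ i → ∑< n (f (suc i) ∘ suc))
    regroup : ∀ a b c d → (a + b) + (c + d) ≈ a + ((b + c) + d)
    regroup = solve 4 (λ a b c d → (a :+ b) :+ (c :+ d) := a :+ ((b :+ c) :+ d)) refl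
    row+column≈0 : row + column ≈ 0#
    row+column≈0 = trans (sym (∑<-+ n _ _)) (trans (∑<-cong n (λ _ → anti λ ())) (∑<-0 n))

  module _ {a} {X : Set a} where

    ∑ˢ-cong : ∀ {f g : List X → List X → Carrier} w → (∀ u v → u ++ v ≡ w → f u v ≈ g u v) → ∑ˢ f w ≈ ∑ˢ g w
    ∑ˢ-cong []      f≈g = f≈g [] [] ≡.refl
    ∑ˢ-cong (x ∷ w) f≈g = +-cong (f≈g [] (x ∷ w) ≡.refl) (∑ˢ-cong w (λ u v eq → f≈g (x ∷ u) v (cong (x ∷_) eq)))

    ∑ˢ-0 : ∀ (w : List X) → ∑ˢ (λ _ _ → 0#) w ≈ 0#
    ∑ˢ-0 []      = refl
    ∑ˢ-0 (x ∷ w) = trans (+-identityˡ _) (∑ˢ-0 w)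

    ∑ˢ-+ : ∀ (f g : List X → List X → Carrier) w → ∑ˢ (λ u v → f u v + g u v) w ≈ ∑ˢ f w + ∑ˢ g w
    ∑ˢ-+ f g []      = refl
    ∑ˢ-+ f g (x ∷ w) = trans (+-congˡ (∑ˢ-+ (λ u → f (x ∷ u)) (λ u → g (x ∷ u)) w)) (interchange _ _ _ _)

    ∑ˢ-*ˡ : ∀ a (f : List X → List X → Carrier) w → ∑ˢ (λ u v → a * f u v) w ≈ a * ∑ˢ f w
    ∑ˢ-*ˡ a f []      = refl
    ∑ˢ-*ˡ a f (x ∷ w) = trans (+-congˡ (∑ˢ-*ˡ a (λ u → f (x ∷ u)) w)) (sym (distribˡ _ _ _))

    ∑ˢ-*ʳ : ∀ a (f : List X → List X → Carrier) w → ∑ˢ (λ u v → f u v * a) w ≈ ∑ˢ f w * a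
    ∑ˢ-*ʳ a f []      = refl
    ∑ˢ-*ʳ a f (x ∷ w) = trans (+-congˡ (∑ˢ-*ʳ a (λ u → f (x ∷ u)) w)) (sym (distribʳ _ _ _))

    ∑ˢ-first : ∀ (f : List X → List X → Carrier) w →
               (∀ x u v → (x ∷ u) ++ v ≡ w → f (x ∷ u) v ≈ 0#) → ∑ˢ f w ≈ f [] w
    ∑ˢ-first f []      f≈0 = refl
    ∑ˢ-first f (x ∷ w) f≈0 =
      trans (+-congˡ (trans (∑ˢ-cong w (λ u v eq → f≈0 x u v (cong (x ∷_) eq))) (∑ˢ-0 w))) (+-identityʳ _)

    ∑ˢ-last : ∀ (f : List X → List X → Carrier) w →
              (∀ u x v → u ++ x ∷ v ≡ w → f u (x ∷ v) ≈ 0#) → ∑ˢ f w ≈ f w []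
    ∑ˢ-last f []      f≈0 = refl
    ∑ˢ-last f (x ∷ w) f≈0 =
      trans (+-cong (f≈0 [] x w ≡.refl) (∑ˢ-last (λ u → f (x ∷ u)) w (λ u y v eq → f≈0 (x ∷ u) y v (cong (x ∷_) eq))))
            (+-identityˡ _)

    ∑ˢ-∷ʳ : ∀ (f : List X → List X → Carrier) w x →
            ∑ˢ f (w ∷ʳ x) ≈ ∑ˢ (λ u v → f u (v ∷ʳ x)) w + f (w ∷ʳ x) []
    ∑ˢ-∷ʳ f []      x = refl
    ∑ˢ-∷ʳ f (y ∷ w) x = trans (+-congˡ (∑ˢ-∷ʳ (λ u → f (y ∷ u)) w x)) (sym (+-assoc _ _ _))

    ∑ˢ-insert : ∀ (f : List X → List X → Carrier) w x z →
                ∑ˢ f (w ++ x ∷ z) ≈ ∑ˢ (λ u v → f u (v ++ x ∷ z)) w + ∑ˢ (λ u v → f (w ++ x ∷ u) v) z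
    ∑ˢ-insert f []      x z = refl
    ∑ˢ-insert f (y ∷ w) x z = trans (+-congˡ (∑ˢ-insert (λ u → f (y ∷ u)) w x z)) (sym (+-assoc _ _ _))

    -- Both sides range over the factorizations of `w` into three factors; one splits off the last
    -- factor, the other the first.
    ∑ˢ-assoc : ∀ (f : List X → List X → List X → Carrier) w →
               ∑ˢ (λ t v → ∑ˢ (λ u₁ u₂ → f u₁ u₂ v) t) w ≈ ∑ˢ (λ u t → ∑ˢ (f u) t) w
    ∑ˢ-assoc f []      = refl
    ∑ˢ-assoc f (x ∷ w) = begin
      f [] [] (x ∷ w) + ∑ˢ (λ t v → f [] (x ∷ t) v + ∑ˢ (λ u₁ u₂ → f (x ∷ u₁) u₂ v) t) w
        ≈⟨ +-congˡ (∑ˢ-+ _ _ w) ⟩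
      f [] [] (x ∷ w) + (∑ˢ (λ t → f [] (x ∷ t)) w + ∑ˢ (λ t v → ∑ˢ (λ u₁ u₂ → f (x ∷ u₁) u₂ v) t) w)
        ≈⟨ +-assoc _ _ _ ⟨
      ∑ˢ (f []) (x ∷ w) + ∑ˢ (λ t v → ∑ˢ (λ u₁ u₂ → f (x ∷ u₁) u₂ v) t) w
        ≈⟨ +-congˡ (∑ˢ-assoc (λ u → f (x ∷ u)) w) ⟩
      ∑ˢ (f []) (x ∷ w) + ∑ˢ (λ u t → ∑ˢ (f (x ∷ u)) t) w ∎

  ∑-∑< : ∀ {a} {X : Set a} (xs : List X) n (f : X → ℕ → Carrier) →
         ∑ xs (λ x → ∑< n (f x)) ≈ ∑< n (λ i → ∑ xs (λ x → f x i))
  ∑-∑< xs zero    f = ∑-0 xs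
  ∑-∑< xs (suc n) f = trans (∑-+ xs _ _) (+-congˡ (∑-∑< xs n (λ x → f x ∘ suc)))

  ∑-∑ˢ : ∀ {a b} {X : Set a} {Y : Set b} (xs : List X) (f : X → List Y → List Y → Carrier) w →
         ∑ xs (λ x → ∑ˢ (f x) w) ≈ ∑ˢ (λ u v → ∑ xs (λ x → f x u v)) w
  ∑-∑ˢ xs f []      = refl
  ∑-∑ˢ xs f (y ∷ w) = trans (∑-+ xs _ _) (+-congˡ (∑-∑ˢ xs (λ x u → f x (y ∷ u)) w))

  ∑ˢ-∑< : ∀ {a} {X : Set a} n (f : List X → List X → ℕ → Carrier) w →
          ∑ˢ (λ u v → ∑< n (f u v)) w ≈ ∑< n (λ i → ∑ˢ (λ u v → f u v i) w)
  ∑ˢ-∑< zero    f w = ∑ˢ-0 w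
  ∑ˢ-∑< (suc n) f w = trans (∑ˢ-+ _ _ w) (+-congˡ (∑ˢ-∑< n (λ u v → f u v ∘ suc) w))

  -- q-integers

  [_]⟪_⟫ : ℕ → Carrier → Carrier
  [ m ]⟪ y ⟫ = ∑ (upTo m) (y ^_)

  qint : ∀ m y → [ m ]⟪ y ⟫ ≈ ∑< m (y ^_)
  qint m y = reflexive (∑-applyUpTo id m (y ^_))

  qint-cong : ∀ m {y z} → y ≈ z → [ m ]⟪ y ⟫ ≈ [ m ]⟪ z ⟫
  qint-cong m y≈z = ∑-cong (upTo m) (λ {i} _ → ^-congˡ i y≈z)

  qint-suc : ∀ m y → [ suc m ]⟪ y ⟫ ≈ 1# + y * [ m ]⟪ y ⟫
  qint-suc m y = begin
    [ suc m ]⟪ y ⟫  ≈⟨ qint (suc m) y ⟩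
    1# + ∑< m (λ i → y * y ^ i)  ≈⟨ +-congˡ (∑<-*ˡ m y (y ^_)) ⟩
    1# + y * ∑< m (y ^_)  ≈⟨ +-congˡ (*-congˡ (qint m y)) ⟨
    1# + y * [ m ]⟪ y ⟫ ∎

  qint-+ : ∀ m n y → [ m ℕ.+ n ]⟪ y ⟫ ≈ [ m ]⟪ y ⟫ + y ^ m * [ n ]⟪ y ⟫
  qint-+ zero    n y = sym (trans (+-identityˡ _) (*-identityˡ _))
  qint-+ (suc m) n y = begin
    [ suc m ℕ.+ n ]⟪ y ⟫  ≈⟨ qint-suc (m ℕ.+ n) y ⟩
    1# + y * [ m ℕ.+ n ]⟪ y ⟫  ≈⟨ +-congˡ (*-congˡ (qint-+ m n y)) ⟩
    1# + y * ([ m ]⟪ y ⟫ + y ^ m * [ n ]⟪ y ⟫)  ≈⟨ expand _ _ _ _ ⟩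
    (1# + y * [ m ]⟪ y ⟫) + y ^ suc m * [ n ]⟪ y ⟫  ≈⟨ +-congʳ (qint-suc m y) ⟨
    [ suc m ]⟪ y ⟫ + y ^ suc m * [ n ]⟪ y ⟫ ∎
    where
    expand : ∀ y m p n → 1# + y * (m + p * n) ≈ (1# + y * m) + (y * p) * n
    expand = solve 4 (λ y m p n → 1ᵖ :+ y :* (m :+ p :* n) := (1ᵖ :+ y :* m) :+ (y :* p) :* n) refl

  qint-geometric : ∀ m y → (1# - y) * [ m ]⟪ y ⟫ ≈ 1# - y ^ m
  qint-geometric zero    y = trans (zeroʳ _) (sym (-‿inverseʳ 1#))
  qint-geometric (suc m) y = begin
    (1# - y) * [ suc m ]⟪ y ⟫  ≈⟨ *-congˡ (qint-suc m y) ⟩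
    (1# - y) * (1# + y * [ m ]⟪ y ⟫)  ≈⟨ expand y _ ⟩
    (1# - y) + y * ((1# - y) * [ m ]⟪ y ⟫)  ≈⟨ +-congˡ (*-congˡ (qint-geometric m y)) ⟩
    (1# - y) + y * (1# - y ^ m)  ≈⟨ collapse y _ ⟩
    1# - y ^ suc m ∎
    where
    expand : ∀ y m → (1# - y) * (1# + y * m) ≈ (1# - y) + y * ((1# - y) * m)
    expand = solve 2 (λ y m → (1ᵖ :- y) :* (1ᵖ :+ y :* m) := (1ᵖ :- y) :+ y :* ((1ᵖ :- y) :* m)) refl
    collapse : ∀ y p → (1# - y) + y * (1# - p) ≈ 1# - y * p
    collapse = solve 2 (λ y p → (1ᵖ :- y) :+ y :* (1ᵖ :- p) := 1ᵖ :- y :* p) refl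

  -- Grouping the powers with exponents 2i and 2i + 1 extracts the factor 1 + y.
  qint-double : ∀ m y → [ m ℕ.+ m ]⟪ y ⟫ ≈ (1# + y) * [ m ]⟪ y * y ⟫
  qint-double zero    y = sym (zeroʳ _)
  qint-double (suc m) y = begin
    [ suc (m ℕ.+ suc m) ]⟪ y ⟫  ≡⟨ cong (λ k → [ suc k ]⟪ y ⟫) (ℕ.+-suc m m) ⟩
    [ suc (suc (m ℕ.+ m)) ]⟪ y ⟫  ≈⟨ trans (qint-suc (suc (m ℕ.+ m)) y) (+-congˡ (*-congˡ (qint-suc (m ℕ.+ m) y))) ⟩
    1# + y * (1# + y * [ m ℕ.+ m ]⟪ y ⟫)  ≈⟨ +-congˡ (*-congˡ (+-congˡ (*-congˡ (qint-double m y)))) ⟩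
    1# + y * (1# + y * ((1# + y) * [ m ]⟪ y * y ⟫))  ≈⟨ regroup y _ ⟩
    (1# + y) * (1# + (y * y) * [ m ]⟪ y * y ⟫)  ≈⟨ *-congˡ (qint-suc m (y * y)) ⟨
    (1# + y) * [ suc m ]⟪ y * y ⟫ ∎
    where
    regroup : ∀ y m → 1# + y * (1# + y * ((1# + y) * m)) ≈ (1# + y) * (1# + (y * y) * m)
    regroup = solve 2 (λ y m → 1ᵖ :+ y :* (1ᵖ :+ y :* ((1ᵖ :+ y) :* m)) :=
                               (1ᵖ :+ y) :* (1ᵖ :+ (y :* y) :* m)) refl

  sgn : ℕ → Carrier
  sgn m = (- 1#) ^ m

  sgn-suc : ∀ m → sgn (suc m) ≈ - sgn m
  sgn-suc m = trans (sym (-‿distribˡ-* 1# _)) (-‿cong (*-identityˡ _))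

  sgn² : ∀ m → sgn m * sgn m ≈ 1#
  sgn² zero    = *-identityˡ 1#
  sgn² (suc m) = trans (*-cong (sgn-suc m) (sgn-suc m))
    (trans (solve 1 (λ s → (:- s) :* (:- s) := s :* s) refl (sgn m)) (sgn² m))

  -- The exponent of - 1 is m (m + 1), a product of consecutive integers. This is why the signs in
  -- `qint-pair` leave no trace in the powers of X.
  sgn-^-suc : ∀ m → sgn m ^ suc m ≈ 1#
  sgn-^-suc zero    = *-identityˡ 1#
  sgn-^-suc (suc m) = begin
    sgn (suc m) ^ suc (suc m)  ≈⟨ ^-distrib-* (- 1#) (sgn m) (suc (suc m)) ⟩
    sgn (suc (suc m)) * (sgn m * sgn m ^ suc m) ≈⟨ *-cong (trans (sgn-suc (suc m)) (-‿cong (sgn-suc m))) (*-congˡ (sgn-^-suc m)) ⟩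
    - - sgn m * (sgn m * 1#)  ≈⟨ solve 1 (λ s → (:- (:- s)) :* (s :* 1ᵖ) := s :* s) refl (sgn m) ⟩
    sgn m * sgn m  ≈⟨ sgn² m ⟩
    1# ∎

  sgn-suc-^ : ∀ m → sgn (suc m) ^ m ≈ 1#
  sgn-suc-^ m = trans (^-distrib-* (- 1#) (sgn m) m) (sgn-^-suc m)

  -- The quotient (1 - y^m)(1 - y^(m+1)) / (1 - y^2) in a form without division. Its summands are
  -- the contributions of the insertion positions when a block is inserted into an increasing word
  -- whose letters all lie above it.
  P : ℕ → Carrier → Carrier
  P m y = ∑< m (λ i → y ^ i * (1# - y ^ suc i))

  P-suc : ∀ m y → P (suc m) y ≈ P m y + y ^ m * (1# - y ^ suc m)
  P-suc m y = ∑<-last m _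

  P-cong : ∀ m {y z} → y ≈ z → P m y ≈ P m z
  P-cong m y≈z = ∑<-cong m (λ {i} _ → *-cong (^-congˡ i y≈z) (+-congˡ (-‿cong (^-congˡ (suc i) y≈z))))

  P-closed : ∀ m y → (1# - y * y) * P m y ≈ (1# - y ^ m) * (1# - y ^ suc m)
  P-closed zero    y = solve 2 (λ y z → (1ᵖ :- y :* y) :* con ℤ.0ℤ := (1ᵖ :- 1ᵖ) :* z) refl y _
  P-closed (suc m) y = begin
    (1# - y * y) * P (suc m) y  ≈⟨ *-congˡ (P-suc m y) ⟩
    (1# - y * y) * (P m y + Y * (1# - y * Y))  ≈⟨ distribˡ _ _ _ ⟩
    (1# - y * y) * P m y + (1# - y * y) * (Y * (1# - y * Y)) ≈⟨ +-congʳ (P-closed m y) ⟩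
    (1# - Y) * (1# - y * Y) + (1# - y * y) * (Y * (1# - y * Y)) ≈⟨ factor y Y ⟩
    (1# - y * Y) * (1# - y * (y * Y)) ∎
    where
    Y = y ^ m
    factor : ∀ y Y → (1# - Y) * (1# - y * Y) + (1# - y * y) * (Y * (1# - y * Y)) ≈ (1# - y * Y) * (1# - y * (y * Y))
    factor = solve 2 (λ y Y → (1ᵖ :- Y) :* (1ᵖ :- y :* Y) :+ (1ᵖ :- y :* y) :* (Y :* (1ᵖ :- y :* Y))
                           := (1ᵖ :- y :* Y) :* (1ᵖ :- y :* (y :* Y))) refl

  qint-pair : ∀ r m x → [ r ]⟪ x * x ⟫ * P m (x ^ r) ≈
              [ m ℕ.* r ]⟪ sgn (suc m) * x ⟫ * [ suc m ℕ.* r ]⟪ sgn m * x ⟫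
  qint-pair r zero    x = trans (zeroʳ _) (sym (zeroˡ _))
  qint-pair r (suc m) x = begin
    [ r ]⟪ x * x ⟫ * P (suc m) X  ≈⟨ *-congˡ (P-suc m X) ⟩
    [ r ]⟪ x * x ⟫ * (P m X + Y * (1# - X ^ suc m))  ≈⟨ distribˡ _ _ _ ⟩
    [ r ]⟪ x * x ⟫ * P m X + [ r ]⟪ x * x ⟫ * (Y * (1# - X ^ suc m))
      ≈⟨ +-cong (qint-pair r m x) (*-congˡ (*-congˡ (sym geometric))) ⟩
    [ m ℕ.* r ]⟪ w ⟫ * E + [ r ]⟪ x * x ⟫ * (Y * ((1# + w) * E))
      ≈⟨ regroup _ _ _ _ _ ⟩
    E * ([ m ℕ.* r ]⟪ w ⟫ + Y * ((1# + w) * [ r ]⟪ x * x ⟫))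
      ≈⟨ *-congˡ (+-congˡ (*-congˡ (*-congˡ (qint-cong r w*w)))) ⟨
    E * ([ m ℕ.* r ]⟪ w ⟫ + Y * ((1# + w) * [ r ]⟪ w * w ⟫))
      ≈⟨ *-congˡ (+-congˡ (*-cong (sym w^mr) (sym (qint-double r w)))) ⟩
    E * ([ m ℕ.* r ]⟪ w ⟫ + w ^ (m ℕ.* r) * [ r ℕ.+ r ]⟪ w ⟫)
      ≈⟨ *-congˡ (qint-+ (m ℕ.* r) (r ℕ.+ r) w) ⟨
    E * [ m ℕ.* r ℕ.+ (r ℕ.+ r) ]⟪ w ⟫
      ≈⟨ *-cong (qint-cong (suc m ℕ.* r) (*-congʳ s≈s″)) (reflexive (cong [_]⟪ w ⟫ mr+2r)) ⟩
    [ suc m ℕ.* r ]⟪ sgn (suc (suc m)) * x ⟫ * [ suc (suc m) ℕ.* r ]⟪ w ⟫ ∎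
    where
    X = x ^ r
    Y = X ^ m
    w = sgn (suc m) * x
    E = [ suc m ℕ.* r ]⟪ sgn m * x ⟫
    w≈-sx : w ≈ - (sgn m * x)
    w≈-sx = trans (*-congʳ (sgn-suc m)) (sym (-‿distribˡ-* _ _))
    s≈s″ : sgn m ≈ sgn (suc (suc m))
    s≈s″ = sym (trans (sgn-suc (suc m)) (trans (-‿cong (sgn-suc m)) (solve 1 (λ s → :- (:- s) := s) refl (sgn m))))
    mr+2r : m ℕ.* r ℕ.+ (r ℕ.+ r) ≡ suc (suc m) ℕ.* r
    mr+2r = ≡.trans (ℕ.+-comm (m ℕ.* r) _) (ℕ.+-assoc r r _)
    w*w : w * w ≈ x * x
    w*w = trans (solve 2 (λ s x → (s :* x) :* (s :* x) := (s :* s) :* (x :* x)) refl _ x)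
                (trans (*-congʳ (sgn² (suc m))) (*-identityˡ _))
    swap^ : ∀ y k → y ^ (k ℕ.* r) ≈ (y ^ k) ^ r
    swap^ y k = sym (^-assocʳ y k r)
    w^mr : w ^ (m ℕ.* r) ≈ Y
    w^mr = begin
      w ^ (m ℕ.* r)  ≈⟨ swap^ w m ⟩
      (w ^ m) ^ r  ≈⟨ ^-congˡ r (trans (^-distrib-* _ x m) (trans (*-congʳ (sgn-suc-^ m)) (*-identityˡ _))) ⟩
      (x ^ m) ^ r  ≈⟨ ^-assocʳ x m r ⟩
      x ^ (m ℕ.* r)  ≡⟨ cong (x ^_) (ℕ.*-comm m r) ⟩
      x ^ (r ℕ.* m)  ≈⟨ ^-assocʳ x r m ⟨
      Y ∎
    geometric : (1# + w) * E ≈ 1# - X ^ suc m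
    geometric = begin
      (1# + w) * E  ≈⟨ *-congʳ (+-congˡ w≈-sx) ⟩
      (1# - sgn m * x) * E  ≈⟨ qint-geometric (suc m ℕ.* r) (sgn m * x) ⟩
      1# - (sgn m * x) ^ (suc m ℕ.* r)  ≈⟨ +-congˡ (-‿cong (swap^ _ (suc m))) ⟩
      1# - ((sgn m * x) ^ suc m) ^ r  ≈⟨ +-congˡ (-‿cong (^-congˡ r (trans (^-distrib-* _ x (suc m)) (trans (*-congʳ (sgn-^-suc m)) (*-identityˡ _))))) ⟩
      1# - (x ^ suc m) ^ r  ≈⟨ +-congˡ (-‿cong (^-assocʳ x (suc m) r)) ⟩
      1# - x ^ (suc m ℕ.* r)  ≡⟨ cong (λ k → 1# - x ^ k) (ℕ.*-comm (suc m) r) ⟩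
      1# - x ^ (r ℕ.* suc m)  ≈⟨ +-congˡ (-‿cong (^-assocʳ x r (suc m))) ⟨
      1# - X ^ suc m ∎
    regroup : ∀ a e q y g → a * e + q * (y * (g * e)) ≈ e * (a + y * (g * q))
    regroup = solve 5 (λ a e q y g → a :* e :+ q :* (y :* (g :* e)) := e :* (a :+ y :* (g :* q))) refl

-- Adjacent transpositions of natural numbers

τ : ℕ → ℕ → ℕ
τ zero    zero          = 1
τ zero    (suc zero)    = 0
τ zero    (suc (suc x)) = suc (suc x)
τ (suc c) zero          = 0
τ (suc c) (suc x)       = suc (τ c x)

Swapped : ℕ → ℕ → ℕ → Set
Swapped c x y = (x ≡ c × y ≡ suc c) ⊎ (x ≡ suc c × y ≡ c)

τ-left : ∀ c → τ c c ≡ suc c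
τ-left zero    = ≡.refl
τ-left (suc c) = cong suc (τ-left c)

τ-right : ∀ c → τ c (suc c) ≡ c
τ-right zero    = ≡.refl
τ-right (suc c) = cong suc (τ-right c)

τ-fix : ∀ c {x} → x ≢ c → x ≢ suc c → τ c x ≡ x
τ-fix zero    {zero}        x≢c _    = contradiction ≡.refl x≢c
τ-fix zero    {suc zero}    _   x≢c′ = contradiction ≡.refl x≢c′
τ-fix zero    {suc (suc x)} _   _    = ≡.refl
τ-fix (suc c) {zero}        _   _    = ≡.refl
τ-fix (suc c) {suc x}       x≢c x≢c′ = cong suc (τ-fix c (x≢c ∘ cong suc) (x≢c′ ∘ cong suc))

τ-involutive : ∀ c x → τ c (τ c x) ≡ x
τ-involutive zero    zero          = ≡.refl
τ-involutive zero    (suc zero)    = ≡.refl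
τ-involutive zero    (suc (suc x)) = ≡.refl
τ-involutive (suc c) zero          = ≡.refl
τ-involutive (suc c) (suc x)       = cong suc (τ-involutive c x)

τ-injective : ∀ c {x y} → τ c x ≡ τ c y → x ≡ y
τ-injective c {x} {y} eq = ≡.trans (≡.sym (τ-involutive c x)) (≡.trans (cong (τ c) eq) (τ-involutive c y))

-- No integer lies strictly between `c` and `suc c`, so every other integer compares alike with
-- both.
τ-mono : ∀ c {x y} → ¬ Swapped c x y → x < y → τ c x < τ c y
τ-mono zero    {zero}        {suc zero}    ¬s _   = contradiction (inj₁ (≡.refl , ≡.refl)) ¬s
τ-mono zero    {zero}        {suc (suc y)} _  _   = s<s z<s
τ-mono zero    {suc zero}    {suc zero}    _  1<1 = contradiction 1<1 (ℕ.<-irrefl ≡.refl)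
τ-mono zero    {suc zero}    {suc (suc y)} _  _   = z<s
τ-mono zero    {suc (suc x)} {suc zero}    _  (s≤s ())
τ-mono zero    {suc (suc x)} {suc (suc y)} _  x<y = x<y
τ-mono (suc c) {zero}        {suc y}       _  _   = z<s
τ-mono (suc c) {suc x}       {suc y}       ¬s x<y = s<s (τ-mono c (¬s ∘ lift) (s<s⁻¹ x<y))
  where
  lift : Swapped c x y → Swapped (suc c) (suc x) (suc y)
  lift (inj₁ (p , q)) = inj₁ (cong suc p , cong suc q)
  lift (inj₂ (p , q)) = inj₂ (cong suc p , cong suc q)

swapped-sym : ∀ {c x y} → Swapped c x y → Swapped c y x
swapped-sym (inj₁ (p , q)) = inj₂ (q , p)
swapped-sym (inj₂ (p , q)) = inj₁ (q , p)

τ-swapped : ∀ c {x y} → Swapped c (τ c x) (τ c y) → Swapped c x y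
τ-swapped c (inj₁ (p , q)) = inj₂ (τ-injective c (≡.trans p (≡.sym (τ-right c))) , τ-injective c (≡.trans q (≡.sym (τ-left c))))
τ-swapped c (inj₂ (p , q)) = inj₁ (τ-injective c (≡.trans p (≡.sym (τ-left c))) , τ-injective c (≡.trans q (≡.sym (τ-right c))))

τ-<⇔ : ∀ c {x y} → ¬ Swapped c x y → (τ c x < τ c y) ⇔ (x < y)
τ-<⇔ c {x} {y} ¬s = mk⇔
  (λ lt → subst₂ _<_ (τ-involutive c x) (τ-involutive c y) (τ-mono c (¬s ∘ τ-swapped c) lt))
  (τ-mono c ¬s)

-- Inversions

count< : ℕ → List ℕ → ℕ
count< x σ = length (filter (_<? x) σ)

count<-accept : ∀ {x z} σ → z < x → count< x (z ∷ σ) ≡ suc (count< x σ)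
count<-accept {x} σ z<x = cong length (List.filter-accept (_<? x) z<x)

count<-reject : ∀ {x z} σ → ¬ z < x → count< x (z ∷ σ) ≡ count< x σ
count<-reject {x} σ z≮x = cong length (List.filter-reject (_<? x) z≮x)

count<-map : ∀ (f : ℕ → ℕ) x y σ → (∀ {z} → z ∈ σ → (f z < y) ⇔ (z < x)) → count< y (map f σ) ≡ count< x σ
count<-map f x y []      _   = ≡.refl
count<-map f x y (z ∷ σ) iff with f z <? y | z <? x
... | yes p | yes q = ≡.trans (count<-accept (map f σ) p) (≡.trans (cong suc (count<-map f x y σ (iff ∘ there))) (≡.sym (count<-accept σ q)))
... | no ¬p | no ¬q = ≡.trans (count<-reject (map f σ) ¬p) (≡.trans (count<-map f x y σ (iff ∘ there)) (≡.sym (count<-reject σ ¬q)))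
... | yes p | no ¬q = contradiction (Equivalence.to (iff (here ≡.refl)) p) ¬q
... | no ¬p | yes q = contradiction (Equivalence.from (iff (here ≡.refl)) q) ¬p

∈∷⁻ : ∀ {a} {X : Set a} {x y : X} {xs} → x ∈ y ∷ xs → x ≢ y → x ∈ xs
∈∷⁻ (here x≡y)   x≢y = contradiction x≡y x≢y
∈∷⁻ (there x∈xs) _   = x∈xs

count<-suc : ∀ c σ → c ∉ σ → count< (suc c) σ ≡ count< c σ
count<-suc c []      _   = ≡.refl
count<-suc c (z ∷ σ) c∉ with z <? suc c | z <? c
... | yes p | yes q = ≡.trans (count<-accept σ p) (≡.trans (cong suc (count<-suc c σ (c∉ ∘ there))) (≡.sym (count<-accept σ q)))
... | no ¬p | no ¬q = ≡.trans (count<-reject σ ¬p) (≡.trans (count<-suc c σ (c∉ ∘ there)) (≡.sym (count<-reject σ ¬q)))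
... | yes z<1+c | no z≮c = contradiction (here (≡.sym (ℕ.≤∧≮⇒≡ (ℕ.s≤s⁻¹ z<1+c) z≮c))) c∉
... | no z≮1+c  | yes z<c = contradiction (ℕ.m<n⇒m<1+n z<c) z≮1+c

count<-suc-∈ : ∀ c {σ} → Unique σ → c ∈ σ → count< (suc c) σ ≡ suc (count< c σ)
count<-suc-∈ c {z ∷ σ} (z∉ ∷ _) (here ≡.refl)
  = ≡.trans (count<-accept σ ℕ.≤-refl) (cong suc (≡.trans (count<-suc c σ (λ c∈σ → All.lookup z∉ c∈σ ≡.refl))
                                                      (≡.sym (count<-reject σ (ℕ.<-irrefl ≡.refl)))))
count<-suc-∈ c {z ∷ σ} (z∉ ∷ uσ) (there c∈σ) with z <? suc c | z <? c
... | yes p | yes q = ≡.trans (count<-accept σ p) (cong suc (≡.trans (count<-suc-∈ c uσ c∈σ) (≡.sym (count<-accept σ q))))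
... | no ¬p | no ¬q = ≡.trans (count<-reject σ ¬p) (≡.trans (count<-suc-∈ c uσ c∈σ) (cong suc (≡.sym (count<-reject σ ¬q))))
... | yes z<1+c | no z≮c = contradiction (ℕ.≤∧≮⇒≡ (ℕ.s≤s⁻¹ z<1+c) z≮c) (All.lookup z∉ c∈σ)
... | no z≮1+c  | yes z<c = contradiction (ℕ.m<n⇒m<1+n z<c) z≮1+c

τ-∈ : ∀ c {x σ} → x ∈ map (τ c) σ → τ c x ∈ σ
τ-∈ c x∈ with y , y∈ , ≡.refl ← ∈-map⁻ (τ c) x∈ = subst (_∈ _) (≡.sym (τ-involutive c y)) y∈

map-τ-∉ˡ : ∀ c {σ} → suc c ∉ σ → c ∉ map (τ c) σ
map-τ-∉ˡ c ∉σ c∈ = ∉σ (subst (_∈ _) (τ-left c) (τ-∈ c c∈))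

map-τ-∈ˡ : ∀ c {σ} → suc c ∈ σ → c ∈ map (τ c) σ
map-τ-∈ˡ c {σ} ∈σ = subst (_∈ map (τ c) σ) (τ-right c) (∈-map⁺ (τ c) ∈σ)

map-τ-∈ʳ : ∀ c {σ} → c ∈ σ → suc c ∈ map (τ c) σ
map-τ-∈ʳ c {σ} ∈σ = subst (_∈ map (τ c) σ) (τ-left c) (∈-map⁺ (τ c) ∈σ)

map-τ-unique : ∀ c {σ} → Unique σ → Unique (map (τ c) σ)
map-τ-unique c = Unique.map⁺ (τ-injective c)

count<-τ : ∀ c x σ → x ≢ c → x ≢ suc c → count< x (map (τ c) σ) ≡ count< x σ
count<-τ c x σ x≢c x≢c′ = count<-map (τ c) x x σ λ {z} _ →
  subst (λ y → (τ c z < y) ⇔ (z < x)) (τ-fix c x≢c x≢c′) (τ-<⇔ c (λ { (inj₁ (_ , q)) → x≢c′ q ; (inj₂ (_ , q)) → x≢c q }))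

count<-τ-c : ∀ c σ → c ∉ σ → suc c ∉ σ → ∀ {x y} → x ≡ c ⊎ x ≡ suc c → y ≡ c ⊎ y ≡ suc c →
             count< y (map (τ c) σ) ≡ count< x σ
count<-τ-c c σ c∉ c′∉ x y = ≡.trans (lhs y) (≡.trans eq (≡.sym (rhs x)))
  where
  eq : count< c (map (τ c) σ) ≡ count< c σ
  eq = count<-map (τ c) c c σ λ z∈ → subst (λ w → (w < c) ⇔ (_ < c))
         (≡.sym (τ-fix c (λ { ≡.refl → c∉ z∈ }) (λ { ≡.refl → c′∉ z∈ }))) (mk⇔ id id)
  lhs : ∀ {y} → y ≡ c ⊎ y ≡ suc c → count< y (map (τ c) σ) ≡ count< c (map (τ c) σ)
  lhs (inj₁ ≡.refl) = ≡.refl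
  lhs (inj₂ ≡.refl) = count<-suc c _ (map-τ-∉ˡ c c′∉)
  rhs : ∀ {x} → x ≡ c ⊎ x ≡ suc c → count< x σ ≡ count< c σ
  rhs (inj₁ ≡.refl) = ≡.refl
  rhs (inj₂ ≡.refl) = count<-suc c _ c∉

count<-τ-∈ : ∀ c {σ} → Unique σ → c ∉ σ → suc c ∈ σ → count< (suc c) (map (τ c) σ) ≡ suc (count< c σ)
count<-τ-∈ c {σ} uσ c∉ c′∈ = ≡.trans (count<-suc-∈ c (map-τ-unique c uσ) (map-τ-∈ˡ c c′∈)) (cong suc eq)
  where
  eq : count< c (map (τ c) σ) ≡ count< c σ
  eq = count<-map (τ c) c c σ λ {z} z∈ → mk⇔
    (λ τz<c → case z ≟ suc c of λ where
       (yes ≡.refl) → contradiction (subst (_< c) (τ-right c) τz<c) (ℕ.<-irrefl ≡.refl)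
       (no z≢c′)  → subst (_< c) (τ-fix c (λ { ≡.refl → c∉ z∈ }) z≢c′) τz<c)
    (λ z<c → subst (_< c) (≡.sym (τ-fix c (ℕ.<⇒≢ z<c) (ℕ.<⇒≢ (ℕ.m<n⇒m<1+n z<c)))) z<c)

∉-head : ∀ {a} {X : Set a} {x : X} {xs} → Unique (x ∷ xs) → x ∉ xs
∉-head (x∉ ∷ _) x∈ = All.lookup x∉ x∈ ≡.refl

-- With `c` or `suc c` missing, no two letters of `σ` change their relative order.
inv-τ-∉ : ∀ c {σ} → Unique σ → c ∉ σ ⊎ suc c ∉ σ → inv (map (τ c) σ) ≡ inv σ
inv-τ-∉ c {[]}    _          _ = ≡.refl
inv-τ-∉ c {x ∷ σ} u@(_ ∷ uσ) h = cong₂ ℕ._+_ (heads h) (inv-τ-∉ c uσ (tails h))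
  where
  tails : c ∉ x ∷ σ ⊎ suc c ∉ x ∷ σ → c ∉ σ ⊎ suc c ∉ σ
  tails (inj₁ c∉) = inj₁ (c∉ ∘ there)
  tails (inj₂ c∉) = inj₂ (c∉ ∘ there)
  heads : c ∉ x ∷ σ ⊎ suc c ∉ x ∷ σ → count< (τ c x) (map (τ c) σ) ≡ count< x σ
  heads h with x ≟ c | x ≟ suc c
  heads (inj₁ c∉)  | yes ≡.refl | _       = contradiction (here ≡.refl) c∉
  heads (inj₂ c′∉) | yes ≡.refl | _       = count<-τ-c c σ (∉-head u) (c′∉ ∘ there) (inj₁ ≡.refl) (inj₂ (τ-left c))
  heads (inj₁ c∉)  | no _     | yes ≡.refl = count<-τ-c c σ (c∉ ∘ there) (∉-head u) (inj₂ ≡.refl) (inj₁ (τ-right c))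
  heads (inj₂ c′∉) | no _     | yes ≡.refl = contradiction (here ≡.refl) c′∉
  heads _          | no x≢c   | no x≢c′  rewrite τ-fix c x≢c x≢c′ = count<-τ c x σ x≢c x≢c′

-- Only the pair formed by `c` and `suc c` changes its order. The disjunction tells whether this
-- inversion is gained or lost, which avoids subtraction.
inv-τ : ∀ c {σ} → Unique σ → c ∈ σ → suc c ∈ σ →
        inv (map (τ c) σ) ≡ suc (inv σ) ⊎ inv σ ≡ suc (inv (map (τ c) σ))
inv-τ c {x ∷ σ} u@(_ ∷ uσ) c∈ c′∈ with x ≟ c | x ≟ suc c
... | yes ≡.refl | _ rewrite τ-left c =
      inj₁ (cong₂ ℕ._+_ (count<-τ-∈ c uσ (∉-head u) (∈∷⁻ c′∈ ℕ.1+n≢n)) (inv-τ-∉ c uσ (inj₁ (∉-head u))))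
... | no _ | yes ≡.refl rewrite τ-right c = inj₂ (cong₂ ℕ._+_ count≡ (≡.sym (inv-τ-∉ c uσ (inj₂ (∉-head u)))))
      where
      -- With `suc c` in front, the counting lemma for `c` in front is applied to the transposed
      -- tail; transposing twice restores `σ`.
      σ′≡σ : map (τ c) (map (τ c) σ) ≡ σ
      σ′≡σ = ≡.trans (≡.sym (List.map-∘ σ)) (≡.trans (List.map-cong (τ-involutive c) σ) (List.map-id σ))
      count≡ : count< (suc c) σ ≡ suc (count< c (map (τ c) σ))
      count≡ = subst (λ ρ → count< (suc c) ρ ≡ suc (count< c (map (τ c) σ))) σ′≡σ
        (count<-τ-∈ c (map-τ-unique c uσ) (map-τ-∉ˡ c (∉-head u)) (map-τ-∈ʳ c (∈∷⁻ c∈ (ℕ.1+n≢n ∘ ≡.sym))))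
... | no x≢c | no x≢c′ rewrite τ-fix c x≢c x≢c′ | count<-τ c x σ x≢c x≢c′ =
      case inv-τ c uσ (∈∷⁻ c∈ (x≢c ∘ ≡.sym)) (∈∷⁻ c′∈ (x≢c′ ∘ ≡.sym)) of λ where
        (inj₁ eq) → inj₁ (≡.trans (cong (count< x σ ℕ.+_) eq) (ℕ.+-suc (count< x σ) _))
        (inj₂ eq) → inj₂ (≡.trans (cong (count< x σ ℕ.+_) eq) (ℕ.+-suc (count< x σ) _))

count<-++ : ∀ x σ ρ → count< x (σ ++ ρ) ≡ count< x σ ℕ.+ count< x ρ
count<-++ x σ ρ = ≡.trans (cong length (List.filter-++ (_<? x) σ ρ)) (List.length-++ (filter (_<? x) σ))

-- Every other letter is larger than both `c` and `suc c` or smaller than both, so it forms two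
-- inversions with the block or none. The block itself is in increasing order.
inv-insert-pair : ∀ c σ ρ → c ∉ σ ++ ρ → suc c ∉ σ ++ ρ → ∃ λ k → inv (σ ++ c ∷ suc c ∷ ρ) ≡ inv (σ ++ ρ) ℕ.+ (k ℕ.+ k)
inv-insert-pair c [] ρ c∉ c′∉ = count< c ρ , ≡.trans
  (cong₂ ℕ._+_ (count<-reject ρ (ℕ.<-asym (ℕ.n<1+n c)))
             (cong (ℕ._+ inv ρ) (count<-suc c ρ c∉)))
  (≡.trans (≡.sym (ℕ.+-assoc (count< c ρ) _ _)) (ℕ.+-comm (count< c ρ ℕ.+ count< c ρ) _))
inv-insert-pair c (x ∷ σ) ρ c∉ c′∉ with k , eq ← inv-insert-pair c σ ρ (c∉ ∘ there) (c′∉ ∘ there)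
  with x <? c
... | yes x<c = k , (begin
  count< x (σ ++ c ∷ suc c ∷ ρ) ℕ.+ inv (σ ++ c ∷ suc c ∷ ρ)  ≡⟨ cong₂ ℕ._+_ count≡ eq ⟩
  count< x (σ ++ ρ) ℕ.+ (inv (σ ++ ρ) ℕ.+ (k ℕ.+ k))  ≡⟨ ℕ.+-assoc (count< x (σ ++ ρ)) _ _ ⟨
  count< x (σ ++ ρ) ℕ.+ inv (σ ++ ρ) ℕ.+ (k ℕ.+ k) ∎)
  where
  open ≡.≡-Reasoning
  count≡ : count< x (σ ++ c ∷ suc c ∷ ρ) ≡ count< x (σ ++ ρ)
  count≡ = ≡.trans (count<-++ x σ _) (≡.trans (cong (count< x σ ℕ.+_) 
    (≡.trans (count<-reject _ (ℕ.<-asym x<c)) (count<-reject ρ (ℕ.<-asym (ℕ.m<n⇒m<1+n x<c)))))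
    (≡.sym (count<-++ x σ ρ)))
... | no x≮c = suc k , (begin
  count< x (σ ++ c ∷ suc c ∷ ρ) ℕ.+ inv (σ ++ c ∷ suc c ∷ ρ)  ≡⟨ cong₂ ℕ._+_ count≡ eq ⟩
  suc (suc (count< x (σ ++ ρ))) ℕ.+ (inv (σ ++ ρ) ℕ.+ (k ℕ.+ k))  ≡⟨ shuffle (count< x (σ ++ ρ)) _ _ _ ⟩
  count< x (σ ++ ρ) ℕ.+ inv (σ ++ ρ) ℕ.+ (suc k ℕ.+ suc k) ∎)
  where
  open ≡.≡-Reasoning
  c<x : c < x
  c<x = ℕ.≤∧≢⇒< (ℕ.≮⇒≥ x≮c) (λ { ≡.refl → c∉ (here ≡.refl) })
  c′<x : suc c < x
  c′<x = ℕ.≤∧≢⇒< c<x (λ { ≡.refl → c′∉ (here ≡.refl) })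
  shuffle : ∀ a b k l → suc (suc a) ℕ.+ (b ℕ.+ (k ℕ.+ l)) ≡ a ℕ.+ b ℕ.+ (suc k ℕ.+ suc l)
  shuffle a b k l rewrite ℕ.+-suc k l | ℕ.+-suc (a ℕ.+ b) (suc (k ℕ.+ l)) | ℕ.+-suc (a ℕ.+ b) (k ℕ.+ l) | ℕ.+-assoc a b (k ℕ.+ l) = ≡.refl
  count≡ : count< x (σ ++ c ∷ suc c ∷ ρ) ≡ suc (suc (count< x (σ ++ ρ)))
  count≡ = ≡.trans (count<-++ x σ _) (≡.trans (cong (count< x σ ℕ.+_) 
    (≡.trans (count<-accept _ c<x) (cong suc (count<-accept ρ c′<x))))
    (≡.trans (ℕ.+-suc (count< x σ) _) (cong suc (≡.trans (ℕ.+-suc (count< x σ) _) (cong suc (≡.sym (count<-++ x σ ρ)))))))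

inv-insert-min : ∀ {c} σ ρ → All (c <_) (σ ++ ρ) → inv (σ ++ c ∷ ρ) ≡ length σ ℕ.+ inv (σ ++ ρ)
inv-insert-min {c} []      ρ c<ρ = cong (ℕ._+ inv ρ) (cong length (List.filter-none (_<? c) (All.map ℕ.<-asym c<ρ)))
inv-insert-min {c} (x ∷ σ) ρ (c<x ∷ c<) = begin
  count< x (σ ++ c ∷ ρ) ℕ.+ inv (σ ++ c ∷ ρ)  ≡⟨ cong₂ ℕ._+_ count≡ (inv-insert-min σ ρ c<) ⟩
  suc (count< x (σ ++ ρ)) ℕ.+ (length σ ℕ.+ inv (σ ++ ρ))  ≡⟨ ℕ.+-assoc (suc (count< x (σ ++ ρ))) (length σ) _ ⟨
  suc (count< x (σ ++ ρ)) ℕ.+ length σ ℕ.+ inv (σ ++ ρ)  ≡⟨ cong (ℕ._+ inv (σ ++ ρ)) (ℕ.+-comm (suc (count< x (σ ++ ρ))) (length σ)) ⟩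
  length σ ℕ.+ suc (count< x (σ ++ ρ)) ℕ.+ inv (σ ++ ρ)  ≡⟨ cong (ℕ._+ inv (σ ++ ρ)) (ℕ.+-suc (length σ) _) ⟩
  suc (length σ ℕ.+ count< x (σ ++ ρ)) ℕ.+ inv (σ ++ ρ)  ≡⟨ ℕ.+-assoc (suc (length σ)) (count< x (σ ++ ρ)) _ ⟩
  suc (length σ) ℕ.+ (count< x (σ ++ ρ) ℕ.+ inv (σ ++ ρ)) ∎
  where
  open ≡.≡-Reasoning
  count≡ : count< x (σ ++ c ∷ ρ) ≡ suc (count< x (σ ++ ρ))
  count≡ = ≡.trans (count<-++ x σ _) (≡.trans (cong (count< x σ ℕ.+_) (count<-accept ρ c<x))
    (≡.trans (ℕ.+-suc (count< x σ) _) (cong suc (≡.sym (count<-++ x σ ρ)))))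

inv-increasing : ∀ {σ} → AllPairs _<_ σ → inv σ ≡ 0
inv-increasing []              = ≡.refl
inv-increasing {x ∷ σ} (x< ∷ inc) = cong₂ ℕ._+_ (cong length (List.filter-none (_<? x) (All.map ℕ.<-asym x<))) (inv-increasing inc)

-- The order of the colored integers and the major index

<ᶜ-asym : ∀ {c d} → c <ᶜ d → ¬ d <ᶜ c
<ᶜ-asym (inj₁ p)       (inj₁ q)       = ℕ.<-asym p q
<ᶜ-asym (inj₁ p)       (inj₂ (e , _)) = ℕ.<-irrefl e p
<ᶜ-asym (inj₂ (e , _)) (inj₁ q)       = ℕ.<-irrefl e q
<ᶜ-asym (inj₂ (_ , p)) (inj₂ (_ , q)) = ℕ.<-asym p q

<ᶜ-trans : ∀ {c d e} → c <ᶜ d → d <ᶜ e → c <ᶜ e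
<ᶜ-trans (inj₁ p)          (inj₁ q)          = inj₁ (ℕ.<-trans q p)
<ᶜ-trans (inj₁ p)          (inj₂ (≡.refl , _)) = inj₁ p
<ᶜ-trans (inj₂ (≡.refl , _)) (inj₁ q)          = inj₁ q
<ᶜ-trans (inj₂ (≡.refl , p)) (inj₂ (≡.refl , q)) = inj₂ (≡.refl , ℕ.<-trans p q)

<ᶜ-total : ∀ {c d} → ∣ c ∣ ≢ ∣ d ∣ → c <ᶜ d ⊎ d <ᶜ c
<ᶜ-total {c} {d} c≢d with ℕ.<-cmp (color c) (color d)
... | tri< p _ _ = inj₂ (inj₁ p)
... | tri> _ _ p = inj₁ (inj₁ p)
... | tri≈ _ e _ with ℕ.<-cmp ∣ c ∣ ∣ d ∣
...   | tri< p _ _ = inj₁ (inj₂ (e , p))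
...   | tri≈ _ p _ = contradiction p c≢d
...   | tri> _ _ p = inj₂ (inj₂ (≡.sym e , p))

descent : ColoredInt → ColoredInt → ℕ → ℕ
descent s t i = if does (t <ᶜ? s) then i else 0

descent-yes : ∀ {s t} i → t <ᶜ s → descent s t i ≡ i
descent-yes {s} {t} i t<s = cong (λ b → if b then i else 0) (dec-true (t <ᶜ? s) t<s)

descent-no : ∀ {s t} i → ¬ t <ᶜ s → descent s t i ≡ 0
descent-no {s} {t} i t≮s = cong (λ b → if b then i else 0) (dec-false (t <ᶜ? s) t≮s)

majFrom-∷ʳ : ∀ i π s t → majFrom i (π ++ s ∷ t ∷ []) ≡ majFrom i (π ∷ʳ s) ℕ.+ descent s t (i ℕ.+ length π)
majFrom-∷ʳ i [] s t = ≡.trans (ℕ.+-identityʳ _) (cong (descent s t) (≡.sym (ℕ.+-identityʳ i)))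
majFrom-∷ʳ i (a ∷ []) s t = ≡.trans (cong (descent a s i ℕ.+_) (majFrom-∷ʳ (suc i) [] s t))
  (≡.trans (cong (λ j → descent a s i ℕ.+ descent s t j) (≡.sym (ℕ.+-suc i 0)))
         (cong (ℕ._+ descent s t (i ℕ.+ 1)) (≡.sym (ℕ.+-identityʳ _))))
majFrom-∷ʳ i (a ∷ b ∷ π) s t = ≡.trans (cong (descent a b i ℕ.+_) (majFrom-∷ʳ (suc i) (b ∷ π) s t))
  (≡.trans (≡.sym (ℕ.+-assoc (descent a b i) _ _))
         (cong (λ j → majFrom i (a ∷ b ∷ (π ∷ʳ s)) ℕ.+ descent s t j) (≡.sym (ℕ.+-suc i (suc (length π))))))

majFrom-map : ∀ (f : ColoredInt → ColoredInt) i {π} → Linked (λ s t → (f t <ᶜ f s) ⇔ (t <ᶜ s)) π →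
              majFrom i (map f π) ≡ majFrom i π
majFrom-map f i []          = ≡.refl
majFrom-map f i [-]         = ≡.refl
majFrom-map f i {s ∷ t ∷ π} (iff ∷ l) = cong₂ ℕ._+_
  (cong (λ b → if b then i else 0) (does-⇔ iff (f t <ᶜ? f s) (t <ᶜ? s))) (majFrom-map f (suc i) l)

majFrom-increasing : ∀ i {π} → AllPairs _<ᶜ_ π → majFrom i π ≡ 0
majFrom-increasing i {[]}        _ = ≡.refl
majFrom-increasing i {s ∷ []}    _ = ≡.refl
majFrom-increasing i {s ∷ t ∷ π} ((s<t ∷ _) ∷ inc) =
  cong₂ ℕ._+_ (descent-no i (<ᶜ-asym s<t)) (majFrom-increasing (suc i) inc)

-- The word is increasing apart from the inserted minimum, so its only descent is the one into that
-- letter. The leading `a` guarantees that a letter precedes it.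
majFrom-insert-min : ∀ i a u {s v} → All (s <ᶜ_) (a ∷ u ++ v) → AllPairs _<ᶜ_ (a ∷ u ++ v) →
                     majFrom i (a ∷ u ++ s ∷ v) ≡ i ℕ.+ length u
majFrom-insert-min i a [] {s} {v} (s<a ∷ s<v) (_ ∷ inc) =
  cong₂ ℕ._+_ (descent-yes i s<a) (majFrom-increasing (suc i) (s<v ∷ inc))
majFrom-insert-min i a (b ∷ u) (_ ∷ s<) ((a<b ∷ _) ∷ inc) = ≡.trans
  (cong₂ ℕ._+_ (descent-no i (<ᶜ-asym a<b)) (majFrom-insert-min (suc i) b u s< inc)) (≡.sym (ℕ.+-suc i (length u)))

majF-insert-min : ∀ u {s v} → All (s <ᶜ_) (u ++ v) → AllPairs _<ᶜ_ (u ++ v) → majF (u ++ s ∷ v) ≡ length u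
majF-insert-min []      s< inc = majFrom-increasing 1 (s< ∷ inc)
majF-insert-min (a ∷ u) s< inc = majFrom-insert-min 1 a u s< inc

linked : ∀ {a ℓ} {X : Set a} {R : X → X → Set ℓ} w → (∀ {u s t v} → u ++ s ∷ t ∷ v ≡ w → R s t) → Linked R w
linked []          _ = []
linked (s ∷ [])    _ = [-]
linked (s ∷ t ∷ w) h = h {[]} ≡.refl ∷ linked (t ∷ w) (λ {u} eq → h {s ∷ u} (cong (s ∷_) eq))

-- Adjacent transpositions of colored words

τᶜ : ℕ → ColoredInt → ColoredInt
τᶜ c (a , z) = τ c a , z

∣map-τᶜ∣ : ∀ c π → map ∣_∣ (map (τᶜ c) π) ≡ map (τ c) (map ∣_∣ π)
∣map-τᶜ∣ c []      = ≡.refl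
∣map-τᶜ∣ c (s ∷ π) = cong (τ c ∣ s ∣ ∷_) (∣map-τᶜ∣ c π)

col-τᶜ : ∀ c π → col (map (τᶜ c) π) ≡ col π
col-τᶜ c π = cong sum (≡.sym (List.map-∘ π))

-- Colors stay fixed and decide first; absolute values matter only for equal colors, and there only
-- the pair `c`, `suc c` is reordered.
τᶜ-<⇔ : ∀ c s t → ¬ (color s ≡ color t × Swapped c ∣ s ∣ ∣ t ∣) → (τᶜ c t <ᶜ τᶜ c s) ⇔ (t <ᶜ s)
τᶜ-<⇔ c s t ¬clash = mk⇔
  (Sum.map₂ λ (e , lt) → e , Equivalence.to   (τ-<⇔ c (λ sw → ¬clash (≡.sym e , swapped-sym sw))) lt)
  (Sum.map₂ λ (e , lt) → e , Equivalence.from (τ-<⇔ c (λ sw → ¬clash (≡.sym e , swapped-sym sw))) lt)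

-- A word containing the letters of absolute values c and c + 1 is separated
-- if no word with distinct absolute values that contains it has these two
-- letters adjacent and of the same color.
data Separated (c : ℕ) (π : Word) : Set where
  colors  : ∀ {y z} → (c , y) ∈ π → (suc c , z) ∈ π → y ≢ z → Separated c π
  between : ∀ {s t w} → Swapped c ∣ s ∣ ∣ t ∣ → s ∷ w ∷ t ∷ [] ⊆ π → Separated c π

separated-⊆ : ∀ {c π ρ} → π ⊆ ρ → Separated c π → Separated c ρ
separated-⊆ π⊆ρ (colors c∈ c′∈ y≢z) = colors (⊆-lookup π⊆ρ c∈) (⊆-lookup π⊆ρ c′∈) y≢z
separated-⊆ π⊆ρ (between sw swt⊆π)  = between sw (⊆-trans swt⊆π π⊆ρ)

separated-∈ : ∀ {c π} → Separated c π → c ∈ map ∣_∣ π × suc c ∈ map ∣_∣ π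
separated-∈ (colors c∈ c′∈ _) = ∈-map⁺ ∣_∣ c∈ , ∈-map⁺ ∣_∣ c′∈
separated-∈ (between sw swt⊆π)
  with s∈ ← ∈-map⁺ ∣_∣ (⊆-lookup swt⊆π (here ≡.refl)) | t∈ ← ∈-map⁺ ∣_∣ (⊆-lookup swt⊆π (there (there (here ≡.refl))))
  with sw
... | inj₁ (≡.refl , ≡.refl) = s∈ , t∈
... | inj₂ (≡.refl , ≡.refl) = t∈ , s∈

unique-∣∣ : ∀ {π s t} → Unique (map ∣_∣ π) → s ∈ π → t ∈ π → ∣ s ∣ ≡ ∣ t ∣ → s ≡ t
unique-∣∣ (_ ∷ _)   (here ≡.refl) (here ≡.refl) _  = ≡.refl
unique-∣∣ (s∉ ∷ _)  (here ≡.refl) (there t∈)  eq = contradiction eq (All.lookup s∉ (∈-map⁺ ∣_∣ t∈))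
unique-∣∣ (t∉ ∷ _)  (there s∈)  (here ≡.refl) eq = contradiction (≡.sym eq) (All.lookup t∉ (∈-map⁺ ∣_∣ s∈))
unique-∣∣ (_ ∷ uπ)  (there s∈)  (there t∈)  eq = unique-∣∣ uπ s∈ t∈ eq

adjacent-⊈ : ∀ {a} {X : Set a} {s w t : X} u {v} → Unique (u ++ s ∷ t ∷ v) → ¬ s ∷ w ∷ t ∷ [] ⊆ u ++ s ∷ t ∷ v
adjacent-⊈ (x ∷ u) (x∉ ∷ uq) (x ∷⊆ sub)    = adjacent-⊈ u uq sub
adjacent-⊈ (x ∷ u) (x∉ ∷ uq) (≡.refl ∷ sub)   = All.lookup x∉ (∈-++⁺ʳ u (here ≡.refl)) ≡.refl
adjacent-⊈ []      uq        (s ∷⊆ sub)     = ∉-head uq (⊆-lookup sub (here ≡.refl))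
adjacent-⊈ []      (_ ∷ uq)  (≡.refl ∷ t ∷⊆ sub) = ∉-head uq (⊆-lookup sub (there (here ≡.refl)))
adjacent-⊈ []      (_ ∷ uq)  (≡.refl ∷ ≡.refl ∷ sub) = ∉-head uq (⊆-lookup sub (here ≡.refl))

reversed-⊈ : ∀ {a} {X : Set a} {s w t : X} u {v} → Unique (u ++ t ∷ s ∷ v) → ¬ s ∷ w ∷ t ∷ [] ⊆ u ++ t ∷ s ∷ v
reversed-⊈ (x ∷ u) (x∉ ∷ uq) (x ∷⊆ sub)    = reversed-⊈ u uq sub
reversed-⊈ (x ∷ u) (x∉ ∷ uq) (≡.refl ∷ sub)   = All.lookup x∉ (∈-++⁺ʳ u (there (here ≡.refl))) ≡.refl
reversed-⊈ []      uq        (t ∷⊆ sub)     = ∉-head uq (⊆-lookup sub (there (there (here ≡.refl))))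
reversed-⊈ []      uq        (≡.refl ∷ sub)   = ∉-head uq (⊆-lookup sub (there (here ≡.refl)))

-- A letter of `π` is determined by its absolute value. Hence the adjacent letters are those in the
-- witness of separation, and distinct colors or a letter in between contradict the assumption; the
-- letter in between must be ruled out for both orders of the pair.
separated-adjacent : ∀ {c π} → Unique (map ∣_∣ π) → Separated c π → ∀ {u s t v} → u ++ s ∷ t ∷ v ≡ π →
                     ¬ (color s ≡ color t × Swapped c ∣ s ∣ ∣ t ∣)
separated-adjacent {c} uq sep {u} {s} {t} {v} ≡.refl (s~t , sw) with sep
... | colors c∈ c′∈ y≢z = case sw of λ where
        (inj₁ (p , q)) → y≢z (≡.trans (cong color (unique-∣∣ uq c∈ s∈ (≡.sym p))) (≡.trans s~t (cong color (unique-∣∣ uq t∈ c′∈ q))))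
        (inj₂ (p , q)) → y≢z (≡.trans (cong color (unique-∣∣ uq c∈ t∈ (≡.sym q))) (≡.trans (≡.sym s~t) (cong color (unique-∣∣ uq s∈ c′∈ p))))
  where
  s∈ = ∈-++⁺ʳ u (here ≡.refl)
  t∈ = ∈-++⁺ʳ u (there (here ≡.refl))
... | between {s′} {t′} sw′ sub = case aligned sw sw′ of λ where
        (inj₁ (p , q)) → case unique-∣∣ uq s∈ s′∈ p , unique-∣∣ uq t∈ t′∈ q of λ where
          (≡.refl , ≡.refl) → adjacent-⊈ u (Unique.map⁻ uq) sub
        (inj₂ (p , q)) → case unique-∣∣ uq s∈ t′∈ p , unique-∣∣ uq t∈ s′∈ q of λ where
          (≡.refl , ≡.refl) → reversed-⊈ u (Unique.map⁻ uq) sub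
  where
  s∈  = ∈-++⁺ʳ u (here ≡.refl)
  t∈  = ∈-++⁺ʳ u (there (here ≡.refl))
  s′∈ = ⊆-lookup sub (here ≡.refl)
  t′∈ = ⊆-lookup sub (there (there (here ≡.refl)))
  aligned : ∀ {a b a′ b′} → Swapped c a b → Swapped c a′ b′ → (a ≡ a′ × b ≡ b′) ⊎ (a ≡ b′ × b ≡ a′)
  aligned (inj₁ (p , q)) (inj₁ (p′ , q′)) = inj₁ (≡.trans p (≡.sym p′) , ≡.trans q (≡.sym q′))
  aligned (inj₁ (p , q)) (inj₂ (p′ , q′)) = inj₂ (≡.trans p (≡.sym q′) , ≡.trans q (≡.sym p′))
  aligned (inj₂ (p , q)) (inj₁ (p′ , q′)) = inj₂ (≡.trans p (≡.sym q′) , ≡.trans q (≡.sym p′))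
  aligned (inj₂ (p , q)) (inj₂ (p′ , q′)) = inj₁ (≡.trans p (≡.sym p′) , ≡.trans q (≡.sym q′))

-- By separation no adjacent comparison changes, so the descents stay in place; neither do the
-- colors change.
fmaj-τᶜ : ∀ r c {π} → Unique (map ∣_∣ π) → Separated c π → fmaj r (map (τᶜ c) π) ≡ fmaj r π
fmaj-τᶜ r c {π} uq sep = cong₂ (λ m k → r ℕ.* m ℕ.+ k)
  (majFrom-map (τᶜ c) 1 (linked π (λ {_} {s} {t} eq → τᶜ-<⇔ c s t (separated-adjacent uq sep eq)))) (col-τᶜ c π)

-- Blocks of two letters consecutive in the order

-- Replacing `s` by `t` next to a letter of `π` leaves descents unchanged.
Neighbours : ColoredInt → ColoredInt → Word → Set
Neighbours s t π = s <ᶜ t × All (λ a → a <ᶜ s ⊎ t <ᶜ a) π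

descent-neighbourʳ : ∀ {s t a} i → s <ᶜ t → a <ᶜ s ⊎ t <ᶜ a → descent a t i ≡ descent a s i
descent-neighbourʳ i s<t (inj₁ a<s) =
  ≡.trans (descent-no i (<ᶜ-asym (<ᶜ-trans a<s s<t))) (≡.sym (descent-no i (<ᶜ-asym a<s)))
descent-neighbourʳ i s<t (inj₂ t<a) =
  ≡.trans (descent-yes i t<a) (≡.sym (descent-yes i (<ᶜ-trans s<t t<a)))

descent-neighbourˡ : ∀ {s t a} i → s <ᶜ t → a <ᶜ s ⊎ t <ᶜ a → descent t a i ≡ descent s a i
descent-neighbourˡ i s<t (inj₁ a<s) =
  ≡.trans (descent-yes i (<ᶜ-trans a<s s<t)) (≡.sym (descent-yes i a<s))
descent-neighbourˡ i s<t (inj₂ t<a) =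
  ≡.trans (descent-no i (<ᶜ-asym t<a)) (≡.sym (descent-no i (<ᶜ-asym (<ᶜ-trans s<t t<a))))

-- The outer letters see no difference between the two orders of the block; the only change is the
-- descent inside the block, at position i + length u.
majFrom-neighbours : ∀ {s t} i u v → Neighbours s t (u ++ v) →
                     majFrom i (u ++ t ∷ s ∷ v) ≡ majFrom i (u ++ s ∷ t ∷ v) ℕ.+ (i ℕ.+ length u)
majFrom-neighbours {s} {t} i [] [] (s<t , _) =
  ≡.trans (cong (ℕ._+ 0) (descent-yes i s<t))
  (≡.sym (cong₂ ℕ._+_ (cong (ℕ._+ 0) (descent-no i (<ᶜ-asym s<t))) ≡.refl))
majFrom-neighbours {s} {t} i [] (a ∷ v) (s<t , a~ ∷ _) = begin
  descent t s i ℕ.+ (descent s a (suc i) ℕ.+ rest)  ≡⟨ cong₂ ℕ._+_ (descent-yes i s<t) (cong (ℕ._+ rest) (≡.sym (descent-neighbourˡ (suc i) s<t a~))) ⟩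
  i ℕ.+ (descent t a (suc i) ℕ.+ rest)  ≡⟨ ℕ.+-comm i _ ⟩
  descent t a (suc i) ℕ.+ rest ℕ.+ i  ≡⟨ cong₂ (λ d j → d ℕ.+ (descent t a (suc i) ℕ.+ rest) ℕ.+ j) (≡.sym (descent-no i (<ᶜ-asym s<t))) (≡.sym (ℕ.+-identityʳ i)) ⟩
  descent s t i ℕ.+ (descent t a (suc i) ℕ.+ rest) ℕ.+ (i ℕ.+ 0) ∎
  where
  open ≡.≡-Reasoning
  rest = majFrom (suc (suc i)) (a ∷ v)
majFrom-neighbours {s} {t} i (a ∷ []) v (s<t , a~ ∷ v~) = begin
  descent a t i ℕ.+ majFrom (suc i) (t ∷ s ∷ v)  ≡⟨ cong₂ ℕ._+_ (descent-neighbourʳ i s<t a~) (majFrom-neighbours (suc i) [] v (s<t , v~)) ⟩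
  descent a s i ℕ.+ (majFrom (suc i) (s ∷ t ∷ v) ℕ.+ (suc i ℕ.+ 0))  ≡⟨ ℕ.+-assoc (descent a s i) _ _ ⟨
  descent a s i ℕ.+ majFrom (suc i) (s ∷ t ∷ v) ℕ.+ (suc i ℕ.+ 0)  ≡⟨ cong (majFrom i (a ∷ s ∷ t ∷ v) ℕ.+_) (ℕ.+-suc i 0) ⟨
  descent a s i ℕ.+ majFrom (suc i) (s ∷ t ∷ v) ℕ.+ (i ℕ.+ 1) ∎
  where open ≡.≡-Reasoning
majFrom-neighbours {s} {t} i (a ∷ b ∷ u) v (s<t , _ ∷ ~) = ≡.trans
  (cong (descent a b i ℕ.+_) (majFrom-neighbours (suc i) (b ∷ u) v (s<t , ~)))
  (≡.trans (≡.sym (ℕ.+-assoc (descent a b i) _ _))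
           (cong (majFrom i (a ∷ b ∷ u ++ s ∷ t ∷ v) ℕ.+_) (≡.sym (ℕ.+-suc i (suc (length u))))))

-- The possible contributions of five adjacent pairs when the last two letters a, b of a word
-- and the neighbours s, t are arranged as a b, a b, a s, t b and b s; the other combinations
-- of values contradict transitivity of _<ᶜ_.
data Contributions (m : ℕ) : (ab ab′ as tb bs : ℕ) → Set where
  ascent-below   : Contributions m 0             0 0 (suc (suc m)) 0
  ascent-across  : Contributions m 0             0 0 0             (suc m)
  ascent-above   : Contributions m 0             0 m 0             (suc m)
  descent-below  : Contributions m (suc (suc m)) m 0 (suc (suc m)) 0
  descent-across : Contributions m (suc (suc m)) m m (suc (suc m)) 0
  descent-above  : Contributions m (suc (suc m)) m m 0             (suc m)

contributions : ∀ {s t a b} m → s <ᶜ t → a <ᶜ s ⊎ t <ᶜ a → b <ᶜ s ⊎ t <ᶜ b →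
  Contributions m (descent a b (suc (suc m))) (descent a b m) (descent a s m)
                  (descent t b (suc (suc m))) (descent b s (suc m))
contributions {a = a} {b} m s<t a~ b~ with b <ᶜ? a
contributions {a = a} {b} m s<t (inj₁ a<s) (inj₁ b<s) | no b≮a
  rewrite descent-no {a} (suc (suc m)) b≮a | descent-no {a} m b≮a | descent-no m (<ᶜ-asym a<s)
        | descent-yes (suc (suc m)) (<ᶜ-trans b<s s<t) | descent-no (suc m) (<ᶜ-asym b<s) = ascent-below
contributions {a = a} {b} m s<t (inj₁ a<s) (inj₂ t<b) | no b≮a
  rewrite descent-no {a} (suc (suc m)) b≮a | descent-no {a} m b≮a | descent-no m (<ᶜ-asym a<s)
        | descent-no (suc (suc m)) (<ᶜ-asym t<b) | descent-yes (suc m) (<ᶜ-trans s<t t<b) = ascent-across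
contributions {a = a} {b} m s<t (inj₂ t<a) (inj₁ b<s) | no b≮a =
  contradiction (<ᶜ-trans b<s (<ᶜ-trans s<t t<a)) b≮a
contributions {a = a} {b} m s<t (inj₂ t<a) (inj₂ t<b) | no b≮a
  rewrite descent-no {a} (suc (suc m)) b≮a | descent-no {a} m b≮a | descent-yes m (<ᶜ-trans s<t t<a)
        | descent-no (suc (suc m)) (<ᶜ-asym t<b) | descent-yes (suc m) (<ᶜ-trans s<t t<b) = ascent-above
contributions {a = a} {b} m s<t (inj₁ a<s) (inj₁ b<s) | yes b<a
  rewrite descent-yes {a} (suc (suc m)) b<a | descent-yes {a} m b<a | descent-no m (<ᶜ-asym a<s)
        | descent-yes (suc (suc m)) (<ᶜ-trans b<s s<t) | descent-no (suc m) (<ᶜ-asym b<s) = descent-below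
contributions {a = a} {b} m s<t (inj₁ a<s) (inj₂ t<b) | yes b<a =
  contradiction (<ᶜ-trans a<s (<ᶜ-trans s<t t<b)) (<ᶜ-asym b<a)
contributions {a = a} {b} m s<t (inj₂ t<a) (inj₁ b<s) | yes b<a
  rewrite descent-yes {a} (suc (suc m)) b<a | descent-yes {a} m b<a | descent-yes m (<ᶜ-trans s<t t<a)
        | descent-yes (suc (suc m)) (<ᶜ-trans b<s s<t) | descent-no (suc m) (<ᶜ-asym b<s) = descent-across
contributions {a = a} {b} m s<t (inj₂ t<a) (inj₂ t<b) | yes b<a
  rewrite descent-yes {a} (suc (suc m)) b<a | descent-yes {a} m b<a | descent-yes m (<ᶜ-trans s<t t<a)
        | descent-no (suc (suc m)) (<ᶜ-asym t<b) | descent-yes (suc m) (<ᶜ-trans s<t t<b) = descent-above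

majF-∷ʳ : ∀ w a b {m} → suc (length w) ≡ m → majF (w ++ a ∷ b ∷ []) ≡ majF (w ∷ʳ a) ℕ.+ descent a b m
majF-∷ʳ w a b ≡.refl = majFrom-∷ʳ 1 w a b

length-∷ʳ : ∀ {a} {Y : Set a} (w : List Y) b → length (w ∷ʳ b) ≡ suc (length w)
length-∷ʳ w b = ≡.trans (List.length-++ w) (ℕ.+-comm (length w) 1)

majF-append-ascent : ∀ w a {s t} → s <ᶜ t → majF ((w ∷ʳ a) ++ s ∷ t ∷ []) ≡ majF (w ∷ʳ a) ℕ.+ descent a s (length (w ∷ʳ a))
majF-append-ascent w a {s} {t} s<t = begin
  majF ((w ∷ʳ a) ++ s ∷ t ∷ [])  ≡⟨ majF-∷ʳ (w ∷ʳ a) s t ≡.refl ⟩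
  majF (w ∷ʳ a ∷ʳ s) ℕ.+ descent s t (suc (length (w ∷ʳ a))) ≡⟨ cong (majF (w ∷ʳ a ∷ʳ s) ℕ.+_) (descent-no _ (<ᶜ-asym s<t)) ⟩
  majF (w ∷ʳ a ∷ʳ s) ℕ.+ 0  ≡⟨ ℕ.+-identityʳ _ ⟩
  majF (w ∷ʳ a ∷ʳ s)  ≡⟨ cong majF (List.++-assoc w _ _) ⟩
  majF (w ++ a ∷ s ∷ [])  ≡⟨ majF-∷ʳ w a s (≡.sym (length-∷ʳ w a)) ⟩
  majF (w ∷ʳ a) ℕ.+ descent a s (length (w ∷ʳ a)) ∎
  where open ≡.≡-Reasoning

-- The sum over all insertions of a block

module InsertNeighbours {c ℓ} (A : CommutativeRing c ℓ) (X : CommutativeRing.Carrier A) where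
  open CommutativeRing A
  open Exp commutativeSemiring
  open IntegerCoefficients A
  open Sums A
  open SetoidReasoning setoid

  -- The combined power of X for the two orders of an inserted block: they have opposite signs, and
  -- the order `t`, `s` has one more descent, at position suc (length u).
  blockTerm : ColoredInt → ColoredInt → Word → Word → Carrier
  blockTerm s t u v = X ^ majF (u ++ s ∷ t ∷ v) * (1# - X ^ suc (length u))

  -- The induction step of the block sum as an identity in X, p = X^m, K and Q. The hypothesis is
  -- solved for H, the part where the block stands before the last letter a. If a, b is an ascent,
  -- what remains is a polynomial identity. If it is a descent, the two sides differ by a multiple
  -- of (1 - X p)(1 - X (X p)) - (1 - X X) Q, which vanishes by `P-closed`.
  append-letter : ∀ {m ab ab′ as tb bs} → Contributions m ab ab′ as tb bs → ∀ {H K} →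
    H + (K * X ^ as) * (1# - X ^ suc m) ≈ K * P (suc m) X →
    (X ^ ab * H + ((K * X ^ as) * X ^ tb) * (1# - X ^ suc m)) + ((K * X ^ ab′) * X ^ bs) * (1# - X ^ suc (suc m))
      ≈ (K * X ^ ab′) * P (suc (suc m)) X
  append-letter {m} {ab} {ab′} {as} {tb} {bs} con₀ {H} {K} hyp = begin
    (X ^ ab * H + ((K * X ^ as) * X ^ tb) * (1# - X * p)) + ((K * X ^ ab′) * X ^ bs) * (1# - X * (X * p))
      ≈⟨ +-congʳ (+-congʳ (*-congˡ H≈)) ⟩
    (X ^ ab * (K * Q - (K * X ^ as) * (1# - X * p)) + ((K * X ^ as) * X ^ tb) * (1# - X * p)) + ((K * X ^ ab′) * X ^ bs) * (1# - X * (X * p))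
      ≈⟨ cases con₀ ⟩
    (K * X ^ ab′) * (Q + (X * p) * (1# - X * (X * p)))
      ≈⟨ *-congˡ (P-suc (suc m) X) ⟨
    (K * X ^ ab′) * P (suc (suc m)) X ∎
    where
    p = X ^ m
    Q = P (suc m) X
    H≈ : H ≈ K * Q - (K * X ^ as) * (1# - X * p)
    H≈ = begin
      H  ≈⟨ solve 2 (λ g y → g := (g :+ y) :- y) refl H _ ⟩
      (H + (K * X ^ as) * (1# - X * p)) - (K * X ^ as) * (1# - X * p)  ≈⟨ +-congʳ hyp ⟩
      K * Q - (K * X ^ as) * (1# - X * p) ∎
    closed : ∀ z → z + (K * p) * ((1# - X * p) * (1# - X * (X * p)) - (1# - X * X) * Q) ≈ z
    closed z = begin
      z + (K * p) * ((1# - X * p) * (1# - X * (X * p)) - (1# - X * X) * Q)  ≈⟨ +-congˡ (*-congˡ (+-congˡ (-‿cong (P-closed (suc m) X)))) ⟩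
      z + (K * p) * ((1# - X * p) * (1# - X * (X * p)) - (1# - X * p) * (1# - X * (X * p)))
                                                                             ≈⟨ solve 3 (λ z k y → z :+ k :* (y :- y) := z) refl z _ _ ⟩
      z ∎
    cases : ∀ {ab ab′ as tb bs} → Contributions m ab ab′ as tb bs →
      (X ^ ab * (K * Q - (K * X ^ as) * (1# - X * p)) + ((K * X ^ as) * X ^ tb) * (1# - X * p)) + ((K * X ^ ab′) * X ^ bs) * (1# - X * (X * p))
        ≈ (K * X ^ ab′) * (Q + (X * p) * (1# - X * (X * p)))
    lhs : ∀ {n} (X p K Q ab ab′ as tb bs : Polynomial n) → Polynomial n
    lhs X p K Q ab ab′ as tb bs =
      (ab :* (K :* Q :- (K :* as) :* (1ᵖ :- X :* p)) :+ ((K :* as) :* tb) :* (1ᵖ :- X :* p)) :+ ((K :* ab′) :* bs) :* (1ᵖ :- X :* (X :* p))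
    rhs : ∀ {n} (X p K Q ab′ : Polynomial n) → Polynomial n
    rhs X p K Q ab′ = (K :* ab′) :* (Q :+ (X :* p) :* (1ᵖ :- X :* (X :* p)))
    excess : ∀ {n} (X p K Q : Polynomial n) → Polynomial n
    excess X p K Q = (K :* p) :* ((1ᵖ :- X :* p) :* (1ᵖ :- X :* (X :* p)) :- (1ᵖ :- X :* X) :* Q)
    cases ascent-below   = solve 4 (λ X p K Q → lhs X p K Q 1ᵖ 1ᵖ 1ᵖ (X :* (X :* p)) 1ᵖ := rhs X p K Q 1ᵖ) refl X p K Q
    cases ascent-across  = solve 4 (λ X p K Q → lhs X p K Q 1ᵖ 1ᵖ 1ᵖ 1ᵖ (X :* p) := rhs X p K Q 1ᵖ) refl X p K Q
    cases ascent-above   = solve 4 (λ X p K Q → lhs X p K Q 1ᵖ 1ᵖ p 1ᵖ (X :* p) := rhs X p K Q 1ᵖ) refl X p K Q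
    cases descent-below  = trans
      (solve 4 (λ X p K Q → lhs X p K Q (X :* (X :* p)) p 1ᵖ (X :* (X :* p)) 1ᵖ := rhs X p K Q p :+ excess X p K Q) refl X p K Q) (closed _)
    cases descent-across = trans
      (solve 4 (λ X p K Q → lhs X p K Q (X :* (X :* p)) p p (X :* (X :* p)) 1ᵖ := rhs X p K Q p :+ excess X p K Q) refl X p K Q) (closed _)
    cases descent-above  = trans
      (solve 4 (λ X p K Q → lhs X p K Q (X :* (X :* p)) p p 1ᵖ (X :* p) := rhs X p K Q p :+ excess X p K Q) refl X p K Q) (closed _)

  -- A block placed before `a` pushes the pair `a`, `b` two positions further, from m to m + 2. The
  -- places between `a` and `b` and after `b` are treated separately, because there the block itself
  -- meets `b`.
  insert-neighbours-∷ʳ : ∀ {s t} w a b → Neighbours s t (w ∷ʳ a ∷ʳ b) →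
    ∑ˢ (blockTerm s t) (w ∷ʳ a) ≈ X ^ majF (w ∷ʳ a) * P (suc (length (w ∷ʳ a))) X →
    ∑ˢ (blockTerm s t) (w ∷ʳ a ∷ʳ b) ≈ X ^ majF (w ∷ʳ a ∷ʳ b) * P (suc (length (w ∷ʳ a ∷ʳ b))) X
  insert-neighbours-∷ʳ {s} {t} w a b (s<t , ~) ih = begin
    ∑ˢ h (w ∷ʳ a ∷ʳ b)
      ≈⟨ trans (∑ˢ-∷ʳ h (w ∷ʳ a) b) (+-congʳ (∑ˢ-∷ʳ (λ u v → h u (v ∷ʳ b)) w a)) ⟩
    (∑ˢ (λ u v → h u (v ∷ʳ a ∷ʳ b)) w + h (w ∷ʳ a) (b ∷ [])) + h (w ∷ʳ a ∷ʳ b) []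
      ≈⟨ +-cong (+-cong (trans (∑ˢ-cong w body) (∑ˢ-*ˡ _ _ w)) last-but-one) last ⟩
    (X ^ descent a b (2 ℕ.+ m) * H + ((K * X ^ descent a s m) * X ^ descent t b (2 ℕ.+ m)) * (1# - X ^ suc m))
      + ((K * X ^ descent a b m) * X ^ descent b s (suc m)) * (1# - X ^ suc (suc m))
      ≈⟨ append-letter (contributions m s<t a~ b~) {H} {K} hyp ⟩
    (K * X ^ descent a b m) * P (suc (suc m)) X
      ≈⟨ *-cong (trans (^-homo-* X (majF (w ∷ʳ a)) _) refl) (reflexive (cong (λ k → P (suc k) X) (length-∷ʳ (w ∷ʳ a) b))) ⟨
    X ^ (majF (w ∷ʳ a) ℕ.+ descent a b m) * P (suc (length (w ∷ʳ a ∷ʳ b))) X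
      ≡⟨ cong (λ k → X ^ k * P (suc (length (w ∷ʳ a ∷ʳ b))) X) (≡.trans (cong majF (List.++-assoc w _ _)) (majF-∷ʳ w a b (≡.sym (length-∷ʳ w a)))) ⟨
    X ^ majF (w ∷ʳ a ∷ʳ b) * P (suc (length (w ∷ʳ a ∷ʳ b))) X ∎
    where
    h = blockTerm s t
    m = length (w ∷ʳ a)
    H = ∑ˢ (λ u v → h u (v ∷ʳ a)) w
    K = X ^ majF (w ∷ʳ a)
    a~ : a <ᶜ s ⊎ t <ᶜ a
    a~ = All.lookup ~ (∈-++⁺ˡ (∈-++⁺ʳ w (here ≡.refl)))
    b~ : b <ᶜ s ⊎ t <ᶜ b
    b~ = All.lookup ~ (∈-++⁺ʳ (w ∷ʳ a) (here ≡.refl))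
    maj₁ : majF ((w ∷ʳ a) ++ s ∷ t ∷ []) ≡ majF (w ∷ʳ a) ℕ.+ descent a s m
    maj₁ = majF-append-ascent w a s<t
    hyp : H + (K * X ^ descent a s m) * (1# - X ^ suc m) ≈ K * P (suc m) X
    hyp = begin
      H + (K * X ^ descent a s m) * (1# - X ^ suc m)  ≈⟨ +-congˡ (*-congʳ (^-homo-* X (majF (w ∷ʳ a)) _)) ⟨
      H + X ^ (majF (w ∷ʳ a) ℕ.+ descent a s m) * (1# - X ^ suc m) ≡⟨ cong (λ k → H + X ^ k * (1# - X ^ suc m)) maj₁ ⟨
      H + h (w ∷ʳ a) []  ≈⟨ ∑ˢ-∷ʳ h w a ⟨
      ∑ˢ h (w ∷ʳ a)  ≈⟨ ih ⟩
      K * P (suc m) X ∎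
    body : ∀ u v → u ++ v ≡ w → h u (v ∷ʳ a ∷ʳ b) ≈ X ^ descent a b (2 ℕ.+ m) * h u (v ∷ʳ a)
    body u v uv≡w = begin
      X ^ majF (u ++ s ∷ t ∷ (v ∷ʳ a ∷ʳ b)) * Y
        ≡⟨ cong (λ k → X ^ k * Y) (≡.trans (cong majF shape₁) (≡.trans (majF-∷ʳ (u ++ s ∷ t ∷ v) a b len) (cong (λ π → majF π ℕ.+ descent a b (2 ℕ.+ m)) shape₂))) ⟩
      X ^ (majF (u ++ s ∷ t ∷ (v ∷ʳ a)) ℕ.+ descent a b (2 ℕ.+ m)) * Y
        ≈⟨ *-congʳ (^-homo-* X (majF (u ++ s ∷ t ∷ (v ∷ʳ a))) _) ⟩
      (X ^ majF (u ++ s ∷ t ∷ (v ∷ʳ a)) * X ^ descent a b (2 ℕ.+ m)) * Y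
        ≈⟨ solve 3 (λ x y z → (x :* y) :* z := y :* (x :* z)) refl _ _ Y ⟩
      X ^ descent a b (2 ℕ.+ m) * h u (v ∷ʳ a) ∎
      where
      Y = 1# - X ^ suc (length u)
      shape₁ : u ++ s ∷ t ∷ (v ∷ʳ a ∷ʳ b) ≡ (u ++ s ∷ t ∷ v) ++ a ∷ b ∷ []
      shape₁ = ≡.trans (cong (λ z → u ++ s ∷ t ∷ z) (List.++-assoc v _ _)) (≡.sym (List.++-assoc u _ _))
      shape₂ : (u ++ s ∷ t ∷ v) ∷ʳ a ≡ u ++ s ∷ t ∷ (v ∷ʳ a)
      shape₂ = List.++-assoc u _ _
      len : suc (length (u ++ s ∷ t ∷ v)) ≡ 2 ℕ.+ m
      len = cong suc (≡.trans (List.length-++-sucʳ u s (t ∷ v)) (≡.trans (cong suc (List.length-++-sucʳ u t v))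
              (cong suc (≡.trans (cong (suc ∘ length) uv≡w) (≡.sym (length-∷ʳ w a))))))
    last-but-one : h (w ∷ʳ a) (b ∷ []) ≈ ((K * X ^ descent a s m) * X ^ descent t b (2 ℕ.+ m)) * (1# - X ^ suc m)
    last-but-one = *-congʳ (begin
      X ^ majF ((w ∷ʳ a) ++ s ∷ t ∷ b ∷ [])  ≡⟨ cong (λ π → X ^ majF π) (List.++-assoc (w ∷ʳ a) _ _) ⟨
      X ^ majF ((w ∷ʳ a ∷ʳ s) ++ t ∷ b ∷ [])  ≡⟨ cong (X ^_) (majF-∷ʳ (w ∷ʳ a ∷ʳ s) t b (cong suc (length-∷ʳ (w ∷ʳ a) s))) ⟩
      X ^ (majF (w ∷ʳ a ∷ʳ s ∷ʳ t) ℕ.+ descent t b (2 ℕ.+ m))  ≡⟨ cong (λ k → X ^ (k ℕ.+ descent t b (2 ℕ.+ m))) (≡.trans (cong majF (List.++-assoc (w ∷ʳ a) _ _)) maj₁) ⟩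
      X ^ (majF (w ∷ʳ a) ℕ.+ descent a s m ℕ.+ descent t b (2 ℕ.+ m)) ≈⟨ trans (^-homo-* X (majF (w ∷ʳ a) ℕ.+ descent a s m) (descent t b (2 ℕ.+ m))) (*-congʳ (^-homo-* X (majF (w ∷ʳ a)) (descent a s m))) ⟩
      (K * X ^ descent a s m) * X ^ descent t b (2 ℕ.+ m) ∎)
    last : h (w ∷ʳ a ∷ʳ b) [] ≈ ((K * X ^ descent a b m) * X ^ descent b s (suc m)) * (1# - X ^ suc (suc m))
    last = *-cong (begin
      X ^ majF ((w ∷ʳ a ∷ʳ b) ++ s ∷ t ∷ [])  ≡⟨ cong (X ^_) (majF-∷ʳ (w ∷ʳ a ∷ʳ b) s t ≡.refl) ⟩
      X ^ (majF (w ∷ʳ a ∷ʳ b ∷ʳ s) ℕ.+ descent s t _)  ≡⟨ cong (λ k → X ^ (majF (w ∷ʳ a ∷ʳ b ∷ʳ s) ℕ.+ k)) (descent-no _ (<ᶜ-asym s<t)) ⟩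
      X ^ (majF (w ∷ʳ a ∷ʳ b ∷ʳ s) ℕ.+ 0)  ≡⟨ cong (X ^_) (≡.trans (ℕ.+-identityʳ _) (≡.trans (cong majF (List.++-assoc (w ∷ʳ a) _ _)) (majF-∷ʳ (w ∷ʳ a) b s ≡.refl))) ⟩
      X ^ (majF (w ∷ʳ a ∷ʳ b) ℕ.+ descent b s (suc m))  ≡⟨ cong (λ k → X ^ (k ℕ.+ descent b s (suc m))) (≡.trans (cong majF (List.++-assoc w _ _)) (majF-∷ʳ w a b (≡.sym (length-∷ʳ w a)))) ⟩
      X ^ (majF (w ∷ʳ a) ℕ.+ descent a b m ℕ.+ descent b s (suc m)) ≈⟨ trans (^-homo-* X (majF (w ∷ʳ a) ℕ.+ descent a b m) (descent b s (suc m))) (*-congʳ (^-homo-* X (majF (w ∷ʳ a)) (descent a b m))) ⟩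
      (K * X ^ descent a b m) * X ^ descent b s (suc m) ∎)
      (reflexive (cong (λ k → 1# - X ^ suc k) (length-∷ʳ (w ∷ʳ a) b)))

  -- Induction from the right keeps the positions of the earlier descents. The step compares the
  -- last two letters, so that the empty word and the words of one letter are base cases.
  insert-neighbours : ∀ {s t w} → Reverse w → Neighbours s t w →
    ∑ˢ (blockTerm s t) w ≈ X ^ majF w * P (suc (length w)) X
  insert-neighbours {s} {t} [] (s<t , _)
    rewrite descent-no 1 (<ᶜ-asym s<t) = *-congˡ (trans (solve 1 (λ x → 1ᵖ :- x :* 1ᵖ := 1ᵖ :* (1ᵖ :- x :* 1ᵖ) :+ con ℤ.0ℤ) refl X) refl)
  insert-neighbours {s} {t} (_ ∶ [] ∶ʳ b) (s<t , b~ ∷ _)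
    rewrite descent-no {s} 1 (<ᶜ-asym s<t) | descent-no {s} 2 (<ᶜ-asym s<t) with b~
  ... | inj₁ b<s rewrite descent-yes 2 (<ᶜ-trans b<s s<t) | descent-no 1 (<ᶜ-asym b<s) =
        solve 1 (λ x → (x :* (x :* 1ᵖ)) :* (1ᵖ :- x :* 1ᵖ) :+ 1ᵖ :* (1ᵖ :- x :* (x :* 1ᵖ))
          := 1ᵖ :* (1ᵖ :* (1ᵖ :- x :* 1ᵖ) :+ ((x :* 1ᵖ) :* (1ᵖ :- x :* (x :* 1ᵖ)) :+ con ℤ.0ℤ))) refl X
  ... | inj₂ t<b rewrite descent-no 2 (<ᶜ-asym t<b) | descent-yes 1 (<ᶜ-trans s<t t<b) =
        solve 1 (λ x → 1ᵖ :* (1ᵖ :- x :* 1ᵖ) :+ (x :* 1ᵖ) :* (1ᵖ :- x :* (x :* 1ᵖ))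
          := 1ᵖ :* (1ᵖ :* (1ᵖ :- x :* 1ᵖ) :+ ((x :* 1ᵖ) :* (1ᵖ :- x :* (x :* 1ᵖ)) :+ con ℤ.0ℤ))) refl X
  insert-neighbours (_ ∶ rw@(w ∶ _ ∶ʳ a) ∶ʳ b) (s<t , ~) =
    insert-neighbours-∷ʳ w a b (s<t , ~) (insert-neighbours rw (s<t , All.++⁻ˡ (w ∷ʳ a) ~))

-- Insertion of two consecutive absolute values

Unique-resp-↭ : ∀ {a} {X : Set a} {xs ys : List X} → xs ↭ ys → Unique xs → Unique ys
Unique-resp-↭ {X = X} xs↭ys = ↭ˢ.Unique-resp-↭ (≡.setoid X) (↭.↭⇒↭ₛ xs↭ys)

insert²-↭ : ∀ {a} {X : Set a} (u w : List X) {v s t} → u ++ s ∷ w ++ t ∷ v ↭ s ∷ t ∷ u ++ w ++ v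
insert²-↭ u w {v} {s} {t} = begin
  u ++ s ∷ w ++ t ∷ v  ↭⟨ ↭.shift s u _ ⟩
  s ∷ u ++ w ++ t ∷ v  ≡⟨ cong (s ∷_) (List.++-assoc u w _) ⟨
  s ∷ (u ++ w) ++ t ∷ v  ↭⟨ prep s (↭.shift t (u ++ w) v) ⟩
  s ∷ t ∷ (u ++ w) ++ v  ≡⟨ cong (λ z → s ∷ t ∷ z) (List.++-assoc u w v) ⟩
  s ∷ t ∷ u ++ w ++ v ∎
  where open ↭.PermutationReasoning

record PairFree (c : ℕ) (π : Word) : Set where
  constructor pairFree
  field
    c∉  : c ∉ map ∣_∣ π
    c′∉ : suc c ∉ map ∣_∣ π
open PairFree public

pairFree-⊆ : ∀ {c π ρ} → (∀ {a} → a ∈ π → a ∈ ρ) → PairFree c ρ → PairFree c π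
pairFree-⊆ {c} {π} {ρ} π⊆ρ (pairFree c∉ c′∉) = pairFree (c∉ ∘ mono) (c′∉ ∘ mono)
  where
  mono : ∀ {a} → a ∈ map ∣_∣ π → a ∈ map ∣_∣ ρ
  mono a∈ with s , s∈ , ≡.refl ← ∈-map⁻ ∣_∣ a∈ = ∈-map⁺ ∣_∣ (π⊆ρ s∈)

map-τᶜ-id : ∀ {c π} → PairFree c π → map (τᶜ c) π ≡ π
map-τᶜ-id {c} {[]}    free = ≡.refl
map-τᶜ-id {c} {(a , z) ∷ π} free = cong₂ _∷_
  (cong (_, z) (τ-fix c (λ { ≡.refl → c∉ free (here ≡.refl) }) (λ { ≡.refl → c′∉ free (here ≡.refl) })))
  (map-τᶜ-id (pairFree-⊆ there free))

map-τᶜ-pair : ∀ {c y z} u w v → PairFree c (u ++ w ++ v) →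
  map (τᶜ c) (u ++ (c , y) ∷ w ++ (suc c , z) ∷ v) ≡ u ++ (suc c , y) ∷ w ++ (c , z) ∷ v
map-τᶜ-pair {c} {y} {z} u w v free = begin
  map (τᶜ c) (u ++ (c , y) ∷ w ++ (suc c , z) ∷ v)
    ≡⟨ ≡.trans (List.map-++ (τᶜ c) u _) (cong (λ π → map (τᶜ c) u ++ (τ c c , y) ∷ π) (List.map-++ (τᶜ c) w _)) ⟩
  map (τᶜ c) u ++ (τ c c , y) ∷ map (τᶜ c) w ++ (τ c (suc c) , z) ∷ map (τᶜ c) v
    ≡⟨ cong₂ (λ a b → map (τᶜ c) u ++ (a , y) ∷ map (τᶜ c) w ++ (b , z) ∷ map (τᶜ c) v) (τ-left c) (τ-right c) ⟩
  map (τᶜ c) u ++ (suc c , y) ∷ map (τᶜ c) w ++ (c , z) ∷ map (τᶜ c) v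
    ≡⟨ cong₂ (λ p q → p ++ (suc c , y) ∷ q) (map-τᶜ-id (pairFree-⊆ ∈-++⁺ˡ free))
        (cong₂ (λ p q → p ++ (c , z) ∷ q) (map-τᶜ-id (pairFree-⊆ (∈-++⁺ʳ u ∘ ∈-++⁺ˡ) free))
                                          (map-τᶜ-id (pairFree-⊆ (∈-++⁺ʳ u ∘ ∈-++⁺ʳ w) free))) ⟩
  u ++ (suc c , y) ∷ w ++ (c , z) ∷ v ∎
  where open ≡.≡-Reasoning

unique-insert² : ∀ {c y z} u w v → Unique (map ∣_∣ (u ++ w ++ v)) → PairFree c (u ++ w ++ v) →
                 Unique (map ∣_∣ (u ++ (c , y) ∷ w ++ (suc c , z) ∷ v))
unique-insert² {c} u w v uq free = Unique-resp-↭ (↭-sym (↭.map⁺ ∣_∣ (insert²-↭ u w)))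
  (All.¬Any⇒All¬ _ (λ { (here eq) → contradiction (≡.sym eq) ℕ.1+n≢n ; (there c∈) → c∉ free c∈ })
    ∷ (All.¬Any⇒All¬ _ (c′∉ free) ∷ uq))

separated-pair : ∀ {c y z} u t v → y ≢ z ⊎ ∃ (_∈ t) → Separated c (u ++ (c , y) ∷ t ++ (suc c , z) ∷ v)
separated-pair u t v (inj₁ y≢z)      = colors (∈-++⁺ʳ u (here ≡.refl)) (∈-++⁺ʳ u (there (∈-++⁺ʳ t (here ≡.refl)))) y≢z
separated-pair u t v (inj₂ (a , a∈)) = between (inj₁ (≡.refl , ≡.refl))
  (⊆.++⁺ˡ u (≡.refl ∷ ⊆.++⁺ (from∈ a∈) (≡.refl ∷ minimum v)))

-- Between two letters of one color with absolute values `c` and `suc c` the order leaves no room,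
-- and these absolute values do not occur in `π`.
neighbours : ∀ {c y π} → PairFree c π → Neighbours (c , y) (suc c , y) π
neighbours {c} {y} {π} free = inj₂ (≡.refl , ℕ.n<1+n c) , All.tabulate λ {a} a∈ →
  case <ᶜ-total {a} {c , y} (λ { ≡.refl → c∉ free (∈-map⁺ ∣_∣ a∈) }) of λ where
    (inj₁ a<s)              → inj₁ a<s
    (inj₂ (inj₁ z<y))       → inj₂ (inj₁ z<y)
    (inj₂ (inj₂ (eq , c<a))) → inj₂ (inj₂ (eq , ℕ.≤∧≢⇒< c<a (λ { ≡.refl → c′∉ free (∈-map⁺ ∣_∣ a∈) })))

col-↭ : ∀ {π ρ} → π ↭ ρ → col π ≡ col ρ
col-↭ π↭ρ = sum-↭ (↭.map⁺ color π↭ρ)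

module Statistic {c ℓ} (A : CommutativeRing c ℓ) (x : CommutativeRing.Carrier A) (r : ℕ) where
  open CommutativeRing A
  open Exp commutativeSemiring
  open AbelianGroupProperties +-abelianGroup using (⁻¹-involutive)
  open RingProperties ring using (-‿distribˡ-*)
  open IntegerCoefficients A
  open Sums A
  open SetoidReasoning setoid

  X : Carrier
  X = x ^ r

  open InsertNeighbours A X using (blockTerm; insert-neighbours)

  T : Word → Carrier
  T π = sgn (inv (map ∣_∣ π)) * x ^ fmaj r π

  T-factor : ∀ π → T π ≈ sgn (inv (map ∣_∣ π)) * (X ^ majF π * x ^ col π)
  T-factor π = *-congˡ (trans (^-homo-* x (r ℕ.* majF π) (col π)) (*-congʳ (sym (^-assocʳ x r (majF π)))))

  sgn-inv-τ : ∀ c {σ} → Unique σ → c ∈ σ → suc c ∈ σ → sgn (inv (map (τ c) σ)) ≈ - sgn (inv σ)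
  sgn-inv-τ c {σ} uq c∈ c′∈ with inv-τ c uq c∈ c′∈
  ... | inj₁ eq = trans (reflexive (cong sgn eq)) (sgn-suc (inv σ))
  ... | inj₂ eq = sym (trans (-‿cong (trans (reflexive (cong sgn eq)) (sgn-suc (inv (map (τ c) σ))))) (⁻¹-involutive _))

  sgn-+2k : ∀ m k → sgn (m ℕ.+ (k ℕ.+ k)) ≈ sgn m
  sgn-+2k m k = trans (^-homo-* (- 1#) m (k ℕ.+ k))
    (trans (*-congˡ (trans (^-homo-* (- 1#) k k) (sgn² k))) (*-identityʳ _))

  T-τ : ∀ c {π} → Unique (map ∣_∣ π) → Separated c π → T (map (τᶜ c) π) ≈ - T π
  T-τ c {π} uq sep with c∈ , c′∈ ← separated-∈ sep = begin
    sgn (inv (map ∣_∣ (map (τᶜ c) π))) * x ^ fmaj r (map (τᶜ c) π)  ≡⟨ cong₂ (λ σ k → sgn (inv σ) * x ^ k) (∣map-τᶜ∣ c π) (fmaj-τᶜ r c uq sep) ⟩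
    sgn (inv (map (τ c) (map ∣_∣ π))) * x ^ fmaj r π  ≈⟨ *-congʳ (sgn-inv-τ c uq c∈ c′∈) ⟩
    - sgn (inv (map ∣_∣ π)) * x ^ fmaj r π  ≈⟨ -‿distribˡ-* _ _ ⟨
    - T π ∎

  -- The letter `t` lands to the right or to the left of `s`. The second case is reindexed by
  -- `∑ˢ-assoc`, so that both range over factorizations of `w` into three factors.
  ∑ˢ-insert² : ∀ (f : Word → Carrier) s t w →
    ∑ˢ (λ u v → ∑ˢ (λ u′ v′ → f (u′ ++ t ∷ v′)) (u ++ s ∷ v)) w ≈
    ∑ˢ (λ u q → ∑ˢ (λ w v → f (u ++ s ∷ w ++ t ∷ v) + f (u ++ t ∷ w ++ s ∷ v)) q) w
  ∑ˢ-insert² f s t w = begin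
    ∑ˢ (λ u v → ∑ˢ (λ u′ v′ → f (u′ ++ t ∷ v′)) (u ++ s ∷ v)) w
      ≈⟨ ∑ˢ-cong w (λ u v _ → trans (∑ˢ-insert (λ u′ v′ → f (u′ ++ t ∷ v′)) u s v)
           (trans (+-comm _ _) (+-congʳ (∑ˢ-cong v (λ u₁ u₂ _ → reflexive (cong f (List.++-assoc u (s ∷ u₁) (t ∷ u₂)))))))) ⟩
    ∑ˢ (λ u v → ∑ˢ (λ v₁ v₂ → f (u ++ s ∷ v₁ ++ t ∷ v₂)) v + ∑ˢ (λ u₁ u₂ → f (u₁ ++ t ∷ u₂ ++ s ∷ v)) u) w
      ≈⟨ ∑ˢ-+ _ _ w ⟩
    ∑ˢ (λ u v → ∑ˢ (λ v₁ v₂ → f (u ++ s ∷ v₁ ++ t ∷ v₂)) v) w + ∑ˢ (λ u v → ∑ˢ (λ u₁ u₂ → f (u₁ ++ t ∷ u₂ ++ s ∷ v)) u) w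
      ≈⟨ +-congˡ (∑ˢ-assoc (λ u₁ u₂ v → f (u₁ ++ t ∷ u₂ ++ s ∷ v)) w) ⟩
    ∑ˢ (λ u v → ∑ˢ (λ v₁ v₂ → f (u ++ s ∷ v₁ ++ t ∷ v₂)) v) w + ∑ˢ (λ u v → ∑ˢ (λ v₁ v₂ → f (u ++ t ∷ v₁ ++ s ∷ v₂)) v) w
      ≈⟨ ∑ˢ-+ _ _ w ⟨
    ∑ˢ (λ u v → ∑ˢ (λ v₁ v₂ → f (u ++ s ∷ v₁ ++ t ∷ v₂)) v + ∑ˢ (λ v₁ v₂ → f (u ++ t ∷ v₁ ++ s ∷ v₂)) v) w
      ≈⟨ ∑ˢ-cong w (λ u v _ → ∑ˢ-+ _ _ v) ⟨
    ∑ˢ (λ u q → ∑ˢ (λ w v → f (u ++ s ∷ w ++ t ∷ v) + f (u ++ t ∷ w ++ s ∷ v)) q) w ∎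

  insertPair : ℕ → ℕ → ℕ → Word → Carrier
  insertPair c y z w = ∑ˢ (λ u v → ∑ˢ (λ u′ v′ → T (u′ ++ (suc c , z) ∷ v′)) (u ++ (c , y) ∷ v)) w

  module _ {c w} (uq : Unique (map ∣_∣ w)) (free : PairFree c w) where

    T-swap-pair : ∀ {y z} u t v → u ++ t ++ v ≡ w → y ≢ z ⊎ ∃ (_∈ t) →
      T (u ++ (c , y) ∷ t ++ (suc c , z) ∷ v) + T (u ++ (suc c , y) ∷ t ++ (c , z) ∷ v) ≈ 0#
    T-swap-pair {y} {z} u t v ≡.refl h = begin
      T π + T (u ++ (suc c , y) ∷ t ++ (c , z) ∷ v)  ≡⟨ cong (λ ρ → T π + T ρ) (map-τᶜ-pair u t v free) ⟨
      T π + T (map (τᶜ c) π)  ≈⟨ +-congˡ (T-τ c (unique-insert² u t v uq free) (separated-pair u t v h)) ⟩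
      T π - T π  ≈⟨ -‿inverseʳ _ ⟩
      0# ∎
      where
      π = u ++ (c , y) ∷ t ++ (suc c , z) ∷ v

    -- Exchange the absolute values and leave the colors in place: an insertion with colors y on `c`
    -- and z on `suc c` becomes one with z on `c` and y on `suc c`. As the colors differ, the sign
    -- changes even when the two letters are adjacent.
    insertPair-distinct : ∀ {y z} → y ≢ z → insertPair c y z w + insertPair c z y w ≈ 0#
    insertPair-distinct {y} {z} y≢z = begin
      insertPair c y z w + insertPair c z y w
        ≈⟨ +-cong (∑ˢ-insert² T _ _ w) (∑ˢ-insert² T _ _ w) ⟩
      ∑ˢ (λ u q → ∑ˢ (λ t v → f u t v) q) w + ∑ˢ (λ u q → ∑ˢ (λ t v → g u t v) q) w
        ≈⟨ ∑ˢ-+ _ _ w ⟨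
      ∑ˢ (λ u q → ∑ˢ (λ t v → f u t v) q + ∑ˢ (λ t v → g u t v) q) w
        ≈⟨ ∑ˢ-cong w (λ { u q ≡.refl → trans (sym (∑ˢ-+ _ _ q)) (trans (∑ˢ-cong q (λ { t v ≡.refl → cancel u t v ≡.refl })) (∑ˢ-0 q)) }) ⟩
      ∑ˢ (λ _ _ → 0#) w
        ≈⟨ ∑ˢ-0 w ⟩
      0# ∎
      where
      f = λ u t v → T (u ++ (c , y) ∷ t ++ (suc c , z) ∷ v) + T (u ++ (suc c , z) ∷ t ++ (c , y) ∷ v)
      g = λ u t v → T (u ++ (c , z) ∷ t ++ (suc c , y) ∷ v) + T (u ++ (suc c , y) ∷ t ++ (c , z) ∷ v)
      cancel : ∀ u t v → u ++ t ++ v ≡ w → f u t v + g u t v ≈ 0#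
      cancel u t v eq = begin
        f u t v + g u t v  ≈⟨ solve 4 (λ a b c d → (a :+ b) :+ (c :+ d) := (a :+ d) :+ (c :+ b)) refl _ _ _ _ ⟩
        _  ≈⟨ +-cong (T-swap-pair u t v eq (inj₁ y≢z)) (T-swap-pair u t v eq (inj₁ (y≢z ∘ ≡.sym))) ⟩
        0# + 0#  ≈⟨ +-identityˡ 0# ⟩
        0# ∎

    T-block : ∀ y u v → u ++ v ≡ w →
      T (u ++ (c , y) ∷ (suc c , y) ∷ v) + T (u ++ (suc c , y) ∷ (c , y) ∷ v) ≈
      (sgn (inv (map ∣_∣ w)) * (x ^ y * x ^ y * x ^ col w)) * blockTerm (c , y) (suc c , y) u v
    T-block y u v ≡.refl = begin
      T π + T ρ
        ≈⟨ +-cong (T-factor π) (T-factor ρ) ⟩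
      sgn (inv (map ∣_∣ π)) * (X ^ majF π * x ^ col π) + sgn (inv (map ∣_∣ ρ)) * (X ^ majF ρ * x ^ col ρ)
        ≈⟨ +-cong (*-cong sgn-π (*-congˡ col-π)) (*-cong sgn-ρ (*-cong maj-ρ col-ρ)) ⟩
      S * (M * C) + - S * ((M * p) * C)
        ≈⟨ solve 4 (λ S M C p → S :* (M :* C) :+ (:- S) :* ((M :* p) :* C) := (S :* C) :* (M :* (1ᵖ :- p))) refl S M C p ⟩
      (S * C) * (M * (1# - p)) ∎
      where
      π = u ++ (c , y) ∷ (suc c , y) ∷ v
      ρ = u ++ (suc c , y) ∷ (c , y) ∷ v
      S = sgn (inv (map ∣_∣ (u ++ v)))
      M = X ^ majF π
      C = x ^ y * x ^ y * x ^ col (u ++ v)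
      p = X ^ suc (length u)
      sgn-π : sgn (inv (map ∣_∣ π)) ≈ S
      sgn-π with k , eq ← inv-insert-pair c (map ∣_∣ u) (map ∣_∣ v)
                            (c∉ free ∘ subst (c ∈_) (≡.sym (List.map-++ ∣_∣ u v))) (c′∉ free ∘ subst (suc c ∈_) (≡.sym (List.map-++ ∣_∣ u v))) =
        trans (reflexive (cong sgn (≡.trans (cong inv (List.map-++ ∣_∣ u _)) (≡.trans eq (cong (λ σ → inv σ ℕ.+ (k ℕ.+ k)) (≡.sym (List.map-++ ∣_∣ u v)))))))
              (sgn-+2k (inv (map ∣_∣ (u ++ v))) k)
      sgn-ρ : sgn (inv (map ∣_∣ ρ)) ≈ - S
      sgn-ρ = begin
        sgn (inv (map ∣_∣ ρ))  ≡⟨ cong (λ σ → sgn (inv (map ∣_∣ σ))) (map-τᶜ-pair u [] v free) ⟨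
        sgn (inv (map ∣_∣ (map (τᶜ c) π)))  ≡⟨ cong (sgn ∘ inv) (∣map-τᶜ∣ c π) ⟩
        sgn (inv (map (τ c) (map ∣_∣ π)))  ≈⟨ sgn-inv-τ c (unique-insert² u [] v uq free) (∈-map⁺ ∣_∣ (∈-++⁺ʳ u (here ≡.refl))) (∈-map⁺ ∣_∣ (∈-++⁺ʳ u (there (here ≡.refl)))) ⟩
        - sgn (inv (map ∣_∣ π))  ≈⟨ -‿cong sgn-π ⟩
        - S ∎
      maj-ρ : X ^ majF ρ ≈ M * p
      maj-ρ = trans (reflexive (cong (X ^_) (majFrom-neighbours 1 u v (neighbours free)))) (^-homo-* X (majF π) _)
      col-π : x ^ col π ≈ C
      col-π = trans (reflexive (cong (x ^_) (≡.trans (col-↭ (insert²-↭ u [])) (≡.sym (ℕ.+-assoc y y _)))))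
                    (trans (^-homo-* x (y ℕ.+ y) _) (*-congʳ (^-homo-* x y y)))
      col-ρ : x ^ col ρ ≈ C
      col-ρ = trans (reflexive (cong (x ^_) (≡.trans (col-↭ (insert²-↭ u [])) (≡.sym (col-↭ (insert²-↭ u [])))))) col-π

    -- The nonadjacent insertions cancel in pairs, which leaves the insertions of a block.
    insertPair-equal : ∀ y → insertPair c y y w ≈ T w * ((x * x) ^ y * P (suc (length w)) X)
    insertPair-equal y = begin
      insertPair c y y w
        ≈⟨ ∑ˢ-insert² T _ _ w ⟩
      ∑ˢ (λ u q → ∑ˢ (λ t v → T (u ++ (c , y) ∷ t ++ (suc c , y) ∷ v) + T (u ++ (suc c , y) ∷ t ++ (c , y) ∷ v)) q) w
        ≈⟨ ∑ˢ-cong w (λ { u q ≡.refl → ∑ˢ-first _ q (λ { a t v ≡.refl → T-swap-pair u (a ∷ t) v ≡.refl (inj₂ (a , here ≡.refl)) }) }) ⟩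
      ∑ˢ (λ u q → T (u ++ (c , y) ∷ (suc c , y) ∷ q) + T (u ++ (suc c , y) ∷ (c , y) ∷ q)) w
        ≈⟨ trans (∑ˢ-cong w (T-block y)) (∑ˢ-*ˡ _ _ w) ⟩
      (S * (x ^ y * x ^ y * C)) * ∑ˢ (blockTerm (c , y) (suc c , y)) w
        ≈⟨ *-congˡ (insert-neighbours (reverseView w) (neighbours free)) ⟩
      (S * (x ^ y * x ^ y * C)) * (M * P (suc (length w)) X)
        ≈⟨ solve 5 (λ S Y C M Q → (S :* (Y :* C)) :* (M :* Q) := (S :* (M :* C)) :* (Y :* Q)) refl S _ C M _ ⟩
      (S * (M * C)) * (x ^ y * x ^ y * P (suc (length w)) X)
        ≈⟨ *-cong (T-factor w) (*-congʳ (^-distrib-* x x y)) ⟨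
      T w * ((x * x) ^ y * P (suc (length w)) X) ∎
      where
      S = sgn (inv (map ∣_∣ w))
      C = x ^ col w
      M = X ^ majF w

    -- Distinct colors cancel in pairs; the equal colors y contribute the powers (x x)^y, which sum
    -- to [r] at x^2.
    insertPair-sum : ∑< r (λ y → ∑< r (λ z → insertPair c y z w)) ≈ T w * ([ r ]⟪ x * x ⟫ * P (suc (length w)) X)
    insertPair-sum = begin
      ∑< r (λ y → ∑< r (λ z → insertPair c y z w))  ≈⟨ ∑<-antisym r _ insertPair-distinct ⟩
      ∑< r (λ y → insertPair c y y w)  ≈⟨ ∑<-cong r (λ {y} _ → insertPair-equal y) ⟩
      ∑< r (λ y → T w * ((x * x) ^ y * P (suc (length w)) X))  ≈⟨ trans (∑<-*ˡ r _ _) (*-congˡ (∑<-*ʳ r _ _)) ⟩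
      T w * (∑< r ((x * x) ^_) * P (suc (length w)) X)  ≈⟨ *-congˡ (*-congʳ (qint r (x * x))) ⟨
      T w * ([ r ]⟪ x * x ⟫ * P (suc (length w)) X) ∎

-- Intervals of integers and the pigeonhole principle

∈-range⁺ : ∀ {a b x} → a ≤ x → x ≤ b → x ∈ range a b
∈-range⁺ {a} {b} {x} a≤x x≤b = subst (_∈ range a b) (ℕ.m+[n∸m]≡n a≤x)
  (∈-applyUpTo⁺ (a ℕ.+_) (subst (x ∸ a <_) (≡.sym (ℕ.+-∸-assoc 1 (ℕ.≤-trans a≤x x≤b))) (s≤s (ℕ.∸-monoˡ-≤ a x≤b))))

range-unique : ∀ a b → Unique (range a b)
range-unique a b = Unique.applyUpTo⁺₁ (a ℕ.+_) (suc b ∸ a) (λ i<j _ eq → ℕ.<⇒≢ i<j (ℕ.+-cancelˡ-≡ a _ _ eq))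

length-range : ∀ n → length (range 1 n) ≡ n
length-range n = List.length-applyUpTo suc n

unique-⊆-length : ∀ {a} {X : Set a} {xs ys : List X} → Unique xs → (∀ {x} → x ∈ xs → x ∈ ys) → length xs ≤ length ys
unique-⊆-length {xs = []}     _         _     = z≤n
unique-⊆-length {xs = x ∷ xs} (x∉ ∷ uq) xs⊆ys with ys₁ , ys₂ , ≡.refl ← ∈-∃++ (xs⊆ys (here ≡.refl)) =
  subst (suc (length xs) ≤_) (≡.sym (List.length-++-sucʳ ys₁ x ys₂)) (s≤s (unique-⊆-length uq (λ {y} y∈ →
    case ↭.∈-resp-↭ (↭.shift x ys₁ ys₂) (xs⊆ys (there y∈)) of λ where
      (here ≡.refl) → contradiction ≡.refl (All.lookup x∉ y∈)
      (there y∈′) → y∈′)))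

-- An element missing from `σ` could be added to it, which would give n + 1 distinct elements of an
-- interval of n integers.
unique-range-full : ∀ {n σ} → Unique σ → (∀ {x} → x ∈ σ → x ∈ range 1 n) → length σ ≡ n →
                    ∀ {x} → x ∈ range 1 n → x ∈ σ
unique-range-full {n} {σ} uq σ⊆ len {x} x∈ with _∈?_ _≟_ x σ
... | yes x∈σ = x∈σ
... | no  x∉σ = contradiction
  (subst₂′ (unique-⊆-length (All.¬Any⇒All¬ σ x∉σ ∷ uq) λ { (here ≡.refl) → x∈ ; (there y∈) → σ⊆ y∈ }))
  (ℕ.<-irrefl ≡.refl)
  where
  subst₂′ : suc (length σ) ≤ length (range 1 n) → n < n
  subst₂′ = subst₂ (λ i j → suc i ≤ j) len (length-range n)

-- The colored permutation group

Letter : (r n : ℕ) → ColoredInt → Set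
Letter r n a = ∣ a ∣ ∈ range 1 n × color a < r

record ColoredPermutation (r n : ℕ) (π : Word) : Set where
  constructor coloredPermutation
  field
    letters : All (Letter r n) π
    size    : length π ≡ n
    unique  : Unique (map ∣_∣ π)
open ColoredPermutation public

∈-wordsOver⁺ : ∀ {alphabet n π} → All (_∈ alphabet) π → length π ≡ n → π ∈ wordsOver alphabet n
∈-wordsOver⁺ {n = zero}  []         ≡.refl = here ≡.refl
∈-wordsOver⁺ {n = suc n} (a∈ ∷ π∈) eq   = ∈-cartesianProductWith⁺ _∷_ a∈ (∈-wordsOver⁺ π∈ (ℕ.suc-injective eq))

∈-wordsOver⁻ : ∀ {alphabet} n {π} → π ∈ wordsOver alphabet n → All (_∈ alphabet) π × length π ≡ n
∈-wordsOver⁻ zero    (here ≡.refl) = [] , ≡.refl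
∈-wordsOver⁻ {alphabet} (suc n) π∈
  with a , ρ , a∈ , ρ∈ , ≡.refl ← ∈-cartesianProductWith⁻ _∷_ alphabet (wordsOver alphabet n) π∈
  with all , len ← ∈-wordsOver⁻ n ρ∈ = a∈ ∷ all , cong suc len

wordsOver-unique : ∀ {alphabet} n → Unique alphabet → Unique (wordsOver alphabet n)
wordsOver-unique zero    _  = [] ∷ []
wordsOver-unique (suc n) uq = Unique.cartesianProductWith⁺ _∷_ List.∷-injective uq (wordsOver-unique n uq)

G-unique : ∀ r n → Unique (G r n)
G-unique r n = Unique.filter⁺ _ (wordsOver-unique n (Unique.cartesianProduct⁺ (range-unique 1 n) (Unique.upTo⁺ r)))

∈-G⁺ : ∀ {r n π} → ColoredPermutation r n π → π ∈ G r n
∈-G⁺ (coloredPermutation ls len uq) = ∈-filter⁺ (λ π → unique? _≟_ (map ∣_∣ π))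
  (∈-wordsOver⁺ (All.map (λ { (a∈ , z<r) → ∈-cartesianProduct⁺ a∈ (∈-upTo⁺ z<r) }) ls) len) uq

∈-G⁻ : ∀ {r n π} → π ∈ G r n → ColoredPermutation r n π
∈-G⁻ {r} {n} π∈ with π∈′ , uq ← ∈-filter⁻ (λ π → unique? _≟_ (map ∣_∣ π)) {xs = wordsOver (cartesianProduct (range 1 n) (upTo r)) n} π∈
  with all , len ← ∈-wordsOver⁻ n π∈′ =
  coloredPermutation (All.map (λ a∈ → let c∈ , z∈ = ∈-cartesianProduct⁻ (range 1 n) (upTo r) a∈ in c∈ , ∈-upTo⁻ z∈) all) len uq

letters-range : ∀ {r n π} → ColoredPermutation r n π → ∀ {x} → x ∈ map ∣_∣ π → x ∈ range 1 n
letters-range perm x∈ with a , a∈ , ≡.refl ← ∈-map⁻ ∣_∣ x∈ = proj₁ (All.lookup (letters perm) a∈)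

letter-∈ : ∀ {r n π} → ColoredPermutation r n π → ∀ {x} → x ∈ range 1 n → ∃ λ z → z < r × (x , z) ∈ π
letter-∈ {π = π} perm x∈
  with (x , z) , a∈ , ≡.refl ← ∈-map⁻ ∣_∣ (unique-range-full (unique perm) (letters-range perm) (≡.trans (List.length-map ∣_∣ π) (size perm)) x∈) =
  z , proj₂ (All.lookup (letters perm) a∈) , a∈

τ-range : ∀ {n c x} → c ∈ range 1 n → suc c ∈ range 1 n → x ∈ range 1 n → τ c x ∈ range 1 n
τ-range {n} {c} {x} c∈ c′∈ x∈ with x ≟ c | x ≟ suc c
... | yes ≡.refl | _        = subst (_∈ range 1 n) (≡.sym (τ-left c)) c′∈
... | no _     | yes ≡.refl = subst (_∈ range 1 n) (≡.sym (τ-right c)) c∈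
... | no x≢c   | no x≢c′  = subst (_∈ range 1 n) (≡.sym (τ-fix c x≢c x≢c′)) x∈

map-τᶜ-involutive : ∀ c π → map (τᶜ c) (map (τᶜ c) π) ≡ π
map-τᶜ-involutive c []            = ≡.refl
map-τᶜ-involutive c ((a , z) ∷ π) = cong₂ (λ b ρ → (b , z) ∷ ρ) (τ-involutive c a) (map-τᶜ-involutive c π)

coloredPermutation-τᶜ : ∀ {r n c π} → c ∈ range 1 n → suc c ∈ range 1 n →
                        ColoredPermutation r n π → ColoredPermutation r n (map (τᶜ c) π)
coloredPermutation-τᶜ {c = c} {π} c∈ c′∈ (coloredPermutation ls len uq) = coloredPermutation
  (All.map⁺ (All.map (λ { (a∈ , z<r) → τ-range c∈ c′∈ a∈ , z<r }) ls))
  (≡.trans (List.length-map (τᶜ c) π) len)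
  (subst Unique (≡.sym (∣map-τᶜ∣ c π)) (map-τ-unique c uq))

-- An involution that preserves membership permutes a list without repetitions.
G-τᶜ-↭ : ∀ {r n c} → c ∈ range 1 n → suc c ∈ range 1 n → G r n ↭ map (map (τᶜ c)) (G r n)
G-τᶜ-↭ {r} {n} {c} c∈ c′∈ = ∼bag⇒↭ (unique∧set⇒bag (G-unique r n) (Unique.map⁺ injective (G-unique r n)) (mk⇔ to from))
  where
  injective : ∀ {π ρ} → map (τᶜ c) π ≡ map (τᶜ c) ρ → π ≡ ρ
  injective {π} {ρ} eq = ≡.trans (≡.sym (map-τᶜ-involutive c π)) (≡.trans (cong (map (τᶜ c)) eq) (map-τᶜ-involutive c ρ))
  closed : ∀ {π} → π ∈ G r n → map (τᶜ c) π ∈ G r n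
  closed π∈ = ∈-G⁺ (coloredPermutation-τᶜ c∈ c′∈ (∈-G⁻ π∈))
  to : ∀ {π} → π ∈ G r n → π ∈ map (map (τᶜ c)) (G r n)
  to {π} π∈ = subst (_∈ map (map (τᶜ c)) (G r n)) (map-τᶜ-involutive c π) (∈-map⁺ (map (τᶜ c)) (closed π∈))
  from : ∀ {π} → π ∈ map (map (τᶜ c)) (G r n) → π ∈ G r n
  from π∈ with ρ , ρ∈ , ≡.refl ← ∈-map⁻ (map (τᶜ c)) π∈ = closed ρ∈

-- Subsequences of words with distinct letters

module _ {a} {X : Set a} where

  ⊆-∷⁻ : ∀ {w x : X} {u v} → w ≢ x → w ∷ u ⊆ x ∷ v → w ∷ u ⊆ v
  ⊆-∷⁻ w≢x (_ ∷⊆ sub)   = sub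
  ⊆-∷⁻ w≢x (w≡x ∷ sub)  = contradiction w≡x w≢x

  ⊆-drop : ∀ {x : X} {u v} → x ∉ u → u ⊆ x ∷ v → u ⊆ v
  ⊆-drop {u = []}    _   _   = minimum _
  ⊆-drop {u = w ∷ u} x∉u sub = ⊆-∷⁻ (λ { ≡.refl → x∉u (here ≡.refl) }) sub

  ⊆-length-≡ : ∀ {u v : List X} → u ⊆ v → length u ≡ length v → u ≡ v
  ⊆-length-≡ sub len = Pointwise-≡⇒≡ (toPointwise len sub)

  -- Since the letters of `v` are distinct, both embeddings put the shared part at the same places
  -- and can be merged. The shared part is nonempty because of `m`; without a common letter, `x` and
  -- `y` could occur in either order.
  ⊆-overlap : ∀ {x m y : X} {u v} → Unique v → x ∷ m ∷ u ⊆ v → (m ∷ u) ++ y ∷ [] ⊆ v → x ∷ (m ∷ u) ++ y ∷ [] ⊆ v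
  ⊆-overlap (_ ∷ uq)  (z ∷⊆ p)     (.z ∷⊆ q)    = z ∷⊆ ⊆-overlap uq p q
  ⊆-overlap (z∉ ∷ _)  (z ∷⊆ p)     (≡.refl ∷ q)   = contradiction ≡.refl (All.lookup z∉ (⊆-lookup p (there (here ≡.refl))))
  ⊆-overlap _         (≡.refl ∷ p)   (_ ∷⊆ q)     = ≡.refl ∷ q
  ⊆-overlap (z∉ ∷ _)  (≡.refl ∷ p)   (≡.refl ∷ q)   = contradiction ≡.refl (All.lookup z∉ (⊆-lookup p (here ≡.refl)))

insert-↭ : ∀ {a} {X : Set a} (u : List X) {s v w} → u ++ v ≡ w → u ++ s ∷ v ↭ s ∷ w
insert-↭ u {s} {v} ≡.refl = ↭.shift s u v

pairs : List ℕ → List ℕ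
pairs []      = []
pairs (c ∷ L) = c ∷ suc c ∷ pairs L

-- Sums over the colored permutations that contain a word

module Containment {c ℓ} (A : CommutativeRing c ℓ) (x : CommutativeRing.Carrier A) (r n : ℕ) where
  open CommutativeRing A
  open Exp commutativeSemiring
  open RingProperties ring using (-‿distribʳ-*)
  open IntegerCoefficients A
  open Sums A
  open Statistic A x r
  open SetoidReasoning setoid

  S : Word → Carrier
  S w = ∑ G⟨ r , n ⟩[ w ] T

  ⟦_⟧ᵇ : Bool → Carrier
  ⟦ b ⟧ᵇ = if b then 1# else 0#

  ∑-filter : ∀ {a p} {Y : Set a} {Q : Y → Set p} (Q? : ∀ y → Dec (Q y)) ys (f : Y → Carrier) →
             ∑ (filter Q? ys) f ≈ ∑ ys (λ y → ⟦ does (Q? y) ⟧ᵇ * f y)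
  ∑-filter Q? []       f = refl
  ∑-filter Q? (y ∷ ys) f with does (Q? y)
  ... | true  = +-cong (sym (*-identityˡ _)) (∑-filter Q? ys f)
  ... | false = trans (∑-filter Q? ys f) (sym (trans (+-congʳ (zeroˡ _)) (+-identityˡ _)))

  ∑-↭ : ∀ {a} {Y : Set a} {ys zs : List Y} (f : Y → Carrier) → ys ↭ zs → ∑ ys f ≈ ∑ zs f
  ∑-↭ f ↭.refl                = refl
  ∑-↭ f (↭.prep y ys↭zs)      = +-congˡ (∑-↭ f ys↭zs)
  ∑-↭ f (↭.swap y z ys↭zs)    = trans (+-congˡ (+-congˡ (∑-↭ f ys↭zs)))
    (solve 3 (λ a b c → a :+ (b :+ c) := b :+ (a :+ c)) refl _ _ _)
  ∑-↭ f (↭.trans ys↭zs zs↭ws) = trans (∑-↭ f ys↭zs) (∑-↭ f zs↭ws)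

  ∑-single : ∀ {a} {Y : Set a} {ys : List Y} {y} (f : Y → Carrier) → Unique ys → y ∈ ys →
             (∀ {z} → z ∈ ys → z ≢ y → f z ≈ 0#) → ∑ ys f ≈ f y
  ∑-single {ys = z ∷ ys} f (z∉ ∷ _) (here ≡.refl) f≈0 = trans
    (+-congˡ (trans (∑-cong ys (λ w∈ → f≈0 (there w∈) (λ { ≡.refl → All.lookup z∉ w∈ ≡.refl }))) (∑-0 ys))) (+-identityʳ _)
  ∑-single {ys = z ∷ ys} f (z∉ ∷ uq) (there y∈) f≈0 = trans
    (+-cong (f≈0 (here ≡.refl) (All.lookup z∉ y∈)) (∑-single f uq y∈ (f≈0 ∘ there))) (+-identityˡ _)

  [_⊑_] : Word → Word → Carrier
  [ w ⊑ π ] = ⟦ does (_⊆?_ _≟ᶜ_ w π) ⟧ᵇ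

  ⊑-yes : ∀ {w π} → w ⊆ π → [ w ⊑ π ] ≈ 1#
  ⊑-yes {w} {π} w⊆π = reflexive (cong ⟦_⟧ᵇ (dec-true (_⊆?_ _≟ᶜ_ w π) w⊆π))

  ⊑-no : ∀ {w π} → ¬ w ⊆ π → [ w ⊑ π ] ≈ 0#
  ⊑-no {w} {π} w⊈π = reflexive (cong ⟦_⟧ᵇ (dec-false (_⊆?_ _≟ᶜ_ w π) w⊈π))

  ⊑-cong : ∀ {w π v ρ} → (w ⊆ π → v ⊆ ρ) → (v ⊆ ρ → w ⊆ π) → [ w ⊑ π ] ≈ [ v ⊑ ρ ]
  ⊑-cong {w} {π} {v} {ρ} to from = reflexive (cong ⟦_⟧ᵇ (does-⇔ (mk⇔ to from) (_⊆?_ _≟ᶜ_ w π) (_⊆?_ _≟ᶜ_ v ρ)))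

  ⊑-skip : ∀ {a s} u {π} → a ≢ s → [ a ∷ u ⊑ s ∷ π ] ≈ [ a ∷ u ⊑ π ]
  ⊑-skip u a≢s = ⊑-cong (⊆-∷⁻ a≢s) (_ ∷⊆_)

  ⊑-keep : ∀ s u {π} → [ s ∷ u ⊑ s ∷ π ] ≈ [ u ⊑ π ]
  ⊑-keep s u {π} = ⊑-cong {s ∷ u} {s ∷ π} {u} {π} ⊆.∷⁻ (≡.refl ∷_)

  -- In a word with distinct letters `w` has at most one embedding, and `d` then lies in exactly one
  -- of the gaps of `w`. The induction runs along `π`.
  ⊑-insert : ∀ d w {π} → Unique π → d ∈ π → d ∉ w → [ w ⊑ π ] ≈ ∑ˢ (λ u v → [ u ++ d ∷ v ⊑ π ]) w
  ⊑-insert d w {s ∷ π} (s∉ ∷ uq) d∈ d∉ = case d ≟ᶜ s of λ where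
      -- When `d` comes first in `π`, it precedes all of `w`, so only the insertion at the front
      -- fits.
      (yes ≡.refl) → begin
        [ w ⊑ d ∷ π ]  ≈⟨ ⊑-cong (⊆-drop d∉) (_ ∷⊆_) ⟩
        [ w ⊑ π ]  ≈⟨ ⊑-keep d w ⟨
        [ d ∷ w ⊑ d ∷ π ]  ≈⟨ ∑ˢ-first _ w (λ { a u v ≡.refl → ⊑-no {a ∷ u ++ d ∷ v} {d ∷ π} (λ sub → All.lookup s∉ (⊆-lookup (⊆-∷⁻ (λ { ≡.refl → d∉ (here ≡.refl) }) sub) (there (∈-++⁺ʳ u (here ≡.refl)))) ≡.refl) }) ⟨
        ∑ˢ (λ u v → [ u ++ d ∷ v ⊑ d ∷ π ]) w  ∎
      (no d≢s) → insert w d∉ d≢s (∈∷⁻ d∈ d≢s)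
    where
    insert : ∀ w → d ∉ w → d ≢ s → d ∈ π → [ w ⊑ s ∷ π ] ≈ ∑ˢ (λ u v → [ u ++ d ∷ v ⊑ s ∷ π ]) w
    insert []      _  d≢s d∈π = begin
      [ [] ⊑ s ∷ π ]  ≈⟨ ⊑-cong (λ _ → minimum π) (λ _ → minimum (s ∷ π)) ⟩
      [ [] ⊑ π ]  ≈⟨ ⊑-insert d [] uq d∈π (λ ()) ⟩
      [ d ∷ [] ⊑ π ]  ≈⟨ ⊑-skip [] d≢s ⟨
      [ d ∷ [] ⊑ s ∷ π ] ∎
    insert (a ∷ w) d∉ d≢s d∈π = case a ≟ᶜ s of λ where
      (yes ≡.refl) → begin
        [ a ∷ w ⊑ a ∷ π ]  ≈⟨ ⊑-keep a w ⟩
        [ w ⊑ π ]  ≈⟨ ⊑-insert d w uq d∈π (d∉ ∘ there) ⟩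
        ∑ˢ (λ u v → [ u ++ d ∷ v ⊑ π ]) w  ≈⟨ ∑ˢ-cong w (λ u v _ → ⊑-keep a (u ++ d ∷ v)) ⟨
        ∑ˢ (λ u v → [ a ∷ u ++ d ∷ v ⊑ a ∷ π ]) w ≈⟨ +-identityˡ _ ⟨
        0# + ∑ˢ (λ u v → [ a ∷ u ++ d ∷ v ⊑ a ∷ π ]) w
          ≈⟨ +-congʳ (⊑-no (λ sub → All.lookup s∉ (⊆-lookup (⊆-∷⁻ d≢s sub) (there (here ≡.refl))) ≡.refl)) ⟨
        ∑ˢ (λ u v → [ u ++ d ∷ v ⊑ a ∷ π ]) (a ∷ w) ∎
      (no a≢s) → begin
        [ a ∷ w ⊑ s ∷ π ]  ≈⟨ ⊑-skip w a≢s ⟩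
        [ a ∷ w ⊑ π ]  ≈⟨ ⊑-insert d (a ∷ w) uq d∈π d∉ ⟩
        ∑ˢ (λ u v → [ u ++ d ∷ v ⊑ π ]) (a ∷ w)  ≈⟨ +-cong (⊑-skip (a ∷ w) d≢s) (∑ˢ-cong w (λ u v _ → ⊑-skip (u ++ d ∷ v) a≢s)) ⟨
        ∑ˢ (λ u v → [ u ++ d ∷ v ⊑ s ∷ π ]) (a ∷ w) ∎

  S-⊑ : ∀ w → S w ≈ ∑ (G r n) (λ π → [ w ⊑ π ] * T π)
  S-⊑ w = ∑-filter (λ π → _⊆?_ _≟ᶜ_ w π) (G r n) T

  -- The absolute value `d` occurs in `π` with exactly one color; the other colors contribute zero.
  ⊑-insert-colors : ∀ {d w π} → ColoredPermutation r n π → d ∈ range 1 n → d ∉ map ∣_∣ w →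
                    [ w ⊑ π ] ≈ ∑< r (λ y → ∑ˢ (λ u v → [ u ++ (d , y) ∷ v ⊑ π ]) w)
  ⊑-insert-colors {d} {w} {π} perm d∈ d∉ with z , z<r , dz∈ ← letter-∈ perm d∈ = begin
    [ w ⊑ π ]  ≈⟨ ⊑-insert (d , z) w (Unique.map⁻ (unique perm)) dz∈ (d∉ ∘ ∈-map⁺ ∣_∣) ⟩
    ∑ˢ (λ u v → [ u ++ (d , z) ∷ v ⊑ π ]) w  ≈⟨ ∑<-single r _ z z<r (λ {y} y≢z → trans (∑ˢ-cong w (λ u v _ → ⊑-no (absent u v y≢z))) (∑ˢ-0 w)) ⟨
    ∑< r (λ y → ∑ˢ (λ u v → [ u ++ (d , y) ∷ v ⊑ π ]) w) ∎
    where
    absent : ∀ u v {y} → y ≢ z → ¬ u ++ (d , y) ∷ v ⊆ π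
    absent u v y≢z sub = y≢z (cong color (unique-∣∣ (unique perm) (⊆-lookup sub (∈-++⁺ʳ u (here ≡.refl))) dz∈ ≡.refl))

  S-insert : ∀ {d w} → d ∈ range 1 n → d ∉ map ∣_∣ w → S w ≈ ∑< r (λ y → ∑ˢ (λ u v → S (u ++ (d , y) ∷ v)) w)
  S-insert {d} {w} d∈ d∉ = begin
    S w
      ≈⟨ S-⊑ w ⟩
    ∑ (G r n) (λ π → [ w ⊑ π ] * T π)
      ≈⟨ ∑-cong (G r n) (λ {π} π∈ → begin
           [ w ⊑ π ] * T π  ≈⟨ *-congʳ (⊑-insert-colors (∈-G⁻ π∈) d∈ d∉) ⟩
           ∑< r (λ y → ∑ˢ (λ u v → [ u ++ (d , y) ∷ v ⊑ π ]) w) * T π  ≈⟨ ∑<-*ʳ r (T π) _ ⟨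
           ∑< r (λ y → ∑ˢ (λ u v → [ u ++ (d , y) ∷ v ⊑ π ]) w * T π)  ≈⟨ ∑<-cong r (λ _ → ∑ˢ-*ʳ (T π) _ w) ⟨
           ∑< r (λ y → ∑ˢ (λ u v → [ u ++ (d , y) ∷ v ⊑ π ] * T π) w) ∎) ⟩
    ∑ (G r n) (λ π → ∑< r (λ y → ∑ˢ (λ u v → [ u ++ (d , y) ∷ v ⊑ π ] * T π) w))
      ≈⟨ ∑-∑< (G r n) r _ ⟩
    ∑< r (λ y → ∑ (G r n) (λ π → ∑ˢ (λ u v → [ u ++ (d , y) ∷ v ⊑ π ] * T π) w))
      ≈⟨ ∑<-cong r (λ {y} _ → ∑-∑ˢ (G r n) (λ π u v → [ u ++ (d , y) ∷ v ⊑ π ] * T π) w) ⟩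
    ∑< r (λ y → ∑ˢ (λ u v → ∑ (G r n) (λ π → [ u ++ (d , y) ∷ v ⊑ π ] * T π)) w)
      ≈⟨ ∑<-cong r (λ {y} _ → ∑ˢ-cong w (λ u v _ → S-⊑ (u ++ (d , y) ∷ v))) ⟨
    ∑< r (λ y → ∑ˢ (λ u v → S (u ++ (d , y) ∷ v)) w) ∎

  S-full : ∀ {w} → ColoredPermutation r n w → S w ≈ T w
  S-full {w} perm = begin
    S w  ≈⟨ S-⊑ w ⟩
    ∑ (G r n) (λ π → [ w ⊑ π ] * T π)  ≈⟨ ∑-single _ (G-unique r n) (∈-G⁺ perm) other ⟩
    [ w ⊑ w ] * T w  ≈⟨ *-congʳ (⊑-yes {w} {w} ⊆-refl) ⟩
    1# * T w  ≈⟨ *-identityˡ _ ⟩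
    T w ∎
    where
    other : ∀ {π} → π ∈ G r n → π ≢ w → [ w ⊑ π ] * T π ≈ 0#
    other π∈ π≢w = trans (*-congʳ (⊑-no (λ sub → π≢w (≡.sym (⊆-length-≡ sub (≡.trans (size perm) (≡.sym (size (∈-G⁻ π∈)))))))))
                         (zeroˡ _)

  -- Relabelling by the transposition permutes the group and carries containment of `w` to
  -- containment of its image. Every `π` that contains `w` inherits its separation, so each term
  -- changes its sign.
  S-τ : ∀ d {w} → d ∈ range 1 n → suc d ∈ range 1 n → Separated d w → S (map (τᶜ d) w) ≈ - S w
  S-τ d {w} d∈ d′∈ sep = begin
    S (map (τᶜ d) w)
      ≈⟨ S-⊑ _ ⟩
    ∑ (G r n) (λ π → [ map (τᶜ d) w ⊑ π ] * T π)
      ≈⟨ ∑-↭ _ (G-τᶜ-↭ d∈ d′∈) ⟩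
    ∑ (map (map (τᶜ d)) (G r n)) (λ π → [ map (τᶜ d) w ⊑ π ] * T π)
      ≡⟨ ∑-map (map (τᶜ d)) (G r n) _ ⟩
    ∑ (G r n) (λ π → [ map (τᶜ d) w ⊑ map (τᶜ d) π ] * T (map (τᶜ d) π))
      ≈⟨ ∑-cong (G r n) (λ {π} π∈ → term π (∈-G⁻ π∈)) ⟩
    ∑ (G r n) (λ π → - ([ w ⊑ π ] * T π))
      ≈⟨ trans (∑-neg (G r n) _) (-‿cong (sym (S-⊑ w))) ⟩
    - S w ∎
    where
    ⊑-τᶜ : ∀ π → [ map (τᶜ d) w ⊑ map (τᶜ d) π ] ≈ [ w ⊑ π ]
    ⊑-τᶜ π = ⊑-cong (λ sub → subst₂ _⊆_ (map-τᶜ-involutive d w) (map-τᶜ-involutive d π) (⊆.map⁺ (τᶜ d) sub)) (⊆.map⁺ (τᶜ d))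
    term : ∀ π → ColoredPermutation r n π → [ map (τᶜ d) w ⊑ map (τᶜ d) π ] * T (map (τᶜ d) π) ≈ - ([ w ⊑ π ] * T π)
    term π perm with _⊆?_ _≟ᶜ_ w π
    ... | yes w⊆π = begin
      [ map (τᶜ d) w ⊑ map (τᶜ d) π ] * T (map (τᶜ d) π)  ≈⟨ *-cong (trans (⊑-τᶜ π) (⊑-yes w⊆π)) (T-τ d (unique perm) (separated-⊆ w⊆π sep)) ⟩
      1# * - T π  ≈⟨ -‿distribʳ-* _ _ ⟨
      - (1# * T π) ∎
    ... | no w⊈π = begin
      [ map (τᶜ d) w ⊑ map (τᶜ d) π ] * T (map (τᶜ d) π)  ≈⟨ *-congʳ (trans (⊑-τᶜ π) (⊑-no w⊈π)) ⟩
      0# * T (map (τᶜ d) π)  ≈⟨ solve 2 (λ a b → con ℤ.0ℤ :* a := :- (con ℤ.0ℤ :* b)) refl _ (T π) ⟩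
      - (0# * T π) ∎

  -- By the hypotheses, a word with distinct letters contains both `W` and `W′` exactly if it
  -- contains `V`. The permutations removed from those containing `W` are therefore the ones counted
  -- by `S V`.
  S-∖ : ∀ {W W′ V : Word} → (∀ {π} → Unique π → W ⊆ π → W′ ⊆ π → V ⊆ π) → W ⊆ V → W′ ⊆ V →
        ∑ G⟨ r , n ⟩[ W ∖ W′ ] T + S V ≈ S W
  S-∖ {W} {W′} {V} join W⊆V W′⊆V = begin
    ∑ G⟨ r , n ⟩[ W ∖ W′ ] T + S V
      ≈⟨ +-cong (trans (∑-filter (λ π → ¬? (_⊆?_ _≟ᶜ_ W′ π)) G⟨ r , n ⟩[ W ] T) (∑-filter (λ π → _⊆?_ _≟ᶜ_ W π) (G r n) _)) (S-⊑ V) ⟩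
    ∑ (G r n) (λ π → [ W ⊑ π ] * (⟦ not (does (_⊆?_ _≟ᶜ_ W′ π)) ⟧ᵇ * T π)) + ∑ (G r n) (λ π → [ V ⊑ π ] * T π)
      ≈⟨ ∑-+ (G r n) _ _ ⟨
    ∑ (G r n) (λ π → [ W ⊑ π ] * (⟦ not (does (_⊆?_ _≟ᶜ_ W′ π)) ⟧ᵇ * T π) + [ V ⊑ π ] * T π)
      ≈⟨ ∑-cong (G r n) (λ {π} π∈ → term π (Unique.map⁻ (unique (∈-G⁻ {r} {n} π∈)))) ⟩
    ∑ (G r n) (λ π → [ W ⊑ π ] * T π)
      ≈⟨ S-⊑ W ⟨
    S W ∎
    where
    term : ∀ π → Unique π → [ W ⊑ π ] * (⟦ not (does (_⊆?_ _≟ᶜ_ W′ π)) ⟧ᵇ * T π) + [ V ⊑ π ] * T π ≈ [ W ⊑ π ] * T π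
    term π uq with _⊆?_ _≟ᶜ_ W π | _⊆?_ _≟ᶜ_ W′ π
    ... | yes p | yes q = trans (+-congˡ (*-congʳ (⊑-yes (join uq p q)))) (solve 1 (λ t → 1ᵖ :* (con ℤ.0ℤ :* t) :+ 1ᵖ :* t := 1ᵖ :* t) refl _)
    ... | yes p | no ¬q = trans (+-congˡ (*-congʳ (⊑-no (λ v → ¬q (⊆-trans W′⊆V v))))) (solve 1 (λ t → 1ᵖ :* (1ᵖ :* t) :+ con ℤ.0ℤ :* t := 1ᵖ :* t) refl _)
    ... | no ¬p | _     = trans (+-congˡ (*-congʳ (⊑-no (λ v → ¬p (⊆-trans W⊆V v))))) (solve 2 (λ t b → con ℤ.0ℤ :* b :+ con ℤ.0ℤ :* t := con ℤ.0ℤ :* t) refl _ _)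

  pairFactor : ℕ → Carrier
  pairFactor m = [ r ]⟪ x * x ⟫ * P (suc m) X

  pairFactors : ℕ → ℕ → Carrier
  pairFactors zero    m = 1#
  pairFactors (suc p) m = pairFactor m * pairFactors p (suc (suc m))

  -- All insertions of the first pair have the same length, so the induction hypothesis attaches the
  -- same factor to each of them. It can be pulled out, and `insertPair-sum` evaluates what remains.
  S-pairs : ∀ L {w} → pairs L ++ map ∣_∣ w ↭ range 1 n → All (λ a → color a < r) w →
            S w ≈ T w * pairFactors (length L) (length w)
  S-pairs [] {w} w↭ colors< = trans (S-full perm) (sym (*-identityʳ _))
    where
    perm : ColoredPermutation r n w
    perm = coloredPermutation
      (All.tabulate λ a∈ → ↭.∈-resp-↭ w↭ (∈-map⁺ ∣_∣ a∈) , All.lookup colors< a∈)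
      (≡.trans (≡.sym (List.length-map ∣_∣ w)) (≡.trans (↭.↭-length w↭) (length-range n)))
      (Unique-resp-↭ (↭-sym w↭) (range-unique 1 n))
  S-pairs (d ∷ L) {w} w↭ colors< = begin
    S w
      ≈⟨ S-insert d∈ d∉ ⟩
    ∑< r (λ y → ∑ˢ (λ u v → S (u ++ (d , y) ∷ v)) w)
      ≈⟨ ∑<-cong r (λ {y} y<r → ∑ˢ-cong w (λ u v uv≡w → S-insert d′∈ (d′∉-insert u v uv≡w))) ⟩
    ∑< r (λ y → ∑ˢ (λ u v → ∑< r (λ z → ∑ˢ (λ u′ v′ → S (u′ ++ (suc d , z) ∷ v′)) (u ++ (d , y) ∷ v))) w)
      ≈⟨ ∑<-cong r (λ {y} y<r → ∑ˢ-cong w (λ u v uv≡w → ∑<-cong r (λ {z} z<r →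
           trans (∑ˢ-cong (u ++ (d , y) ∷ v) (λ u′ v′ eq → expand u v u′ v′ uv≡w eq y<r z<r)) (∑ˢ-*ʳ Π _ (u ++ (d , y) ∷ v))))) ⟩
    ∑< r (λ y → ∑ˢ (λ u v → ∑< r (λ z → ∑ˢ (λ u′ v′ → T (u′ ++ (suc d , z) ∷ v′)) (u ++ (d , y) ∷ v) * Π)) w)
      ≈⟨ ∑<-cong r (λ {y} _ → trans (∑ˢ-∑< r _ w) (trans (∑<-cong r (λ {z} _ → ∑ˢ-*ʳ Π _ w)) (∑<-*ʳ r Π _))) ⟩
    ∑< r (λ y → ∑< r (λ z → insertPair d y z w) * Π)
      ≈⟨ ∑<-*ʳ r Π _ ⟩
    ∑< r (λ y → ∑< r (λ z → insertPair d y z w)) * Π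
      ≈⟨ *-congʳ (insertPair-sum uq (pairFree d∉ d′∉)) ⟩
    (T w * pairFactor (length w)) * Π
      ≈⟨ *-assoc _ _ _ ⟩
    T w * pairFactors (suc (length L)) (length w) ∎
    where
    Π = pairFactors (length L) (suc (suc (length w)))
    all-unique : Unique (d ∷ suc d ∷ pairs L ++ map ∣_∣ w)
    all-unique = Unique-resp-↭ (↭-sym w↭) (range-unique 1 n)
    d∈ : d ∈ range 1 n
    d∈ = ↭.∈-resp-↭ w↭ (here ≡.refl)
    d′∈ : suc d ∈ range 1 n
    d′∈ = ↭.∈-resp-↭ w↭ (there (here ≡.refl))
    d∉ : d ∉ map ∣_∣ w
    d∉ d∈w = ∉-head all-unique (there (∈-++⁺ʳ (pairs L) d∈w))
    d′∉ : suc d ∉ map ∣_∣ w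
    d′∉ d′∈w = ∉-head (AllPairs.tail all-unique) (∈-++⁺ʳ (pairs L) d′∈w)
    uq : Unique (map ∣_∣ w)
    uq = ++-unique (pairs L) (AllPairs.tail (AllPairs.tail all-unique))
      where
      ++-unique : ∀ (σ : List ℕ) {ρ} → Unique (σ ++ ρ) → Unique ρ
      ++-unique []      uq       = uq
      ++-unique (_ ∷ σ) (_ ∷ uq) = ++-unique σ uq
    d′∉-insert : ∀ {y} u v → u ++ v ≡ w → suc d ∉ map ∣_∣ (u ++ (d , y) ∷ v)
    d′∉-insert u v uv≡w d′∈ with ↭.∈-resp-↭ (↭.map⁺ ∣_∣ (insert-↭ u uv≡w)) d′∈
    ... | here eq    = ℕ.1+n≢n eq
    ... | there d′∈w = d′∉ d′∈w
    expand : ∀ u v u′ v′ {y z} → u ++ v ≡ w → u′ ++ v′ ≡ u ++ (d , y) ∷ v → y < r → z < r →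
             S (u′ ++ (suc d , z) ∷ v′) ≈ T (u′ ++ (suc d , z) ∷ v′) * Π
    expand u v u′ v′ {y} {z} eq eq′ y<r z<r = trans
      (S-pairs L rearranged (↭.All-resp-↭ (↭-sym w″↭) (z<r ∷ y<r ∷ colors<)))
      (*-congˡ (reflexive (cong (pairFactors (length L)) (↭.↭-length w″↭))))
      where
      w″↭ : u′ ++ (suc d , z) ∷ v′ ↭ (suc d , z) ∷ (d , y) ∷ w
      w″↭ = ↭-trans (insert-↭ u′ eq′) (prep _ (insert-↭ u eq))
      rearranged : pairs L ++ map ∣_∣ (u′ ++ (suc d , z) ∷ v′) ↭ range 1 n
      rearranged = begin′
        pairs L ++ map ∣_∣ (u′ ++ (suc d , z) ∷ v′)  ↭⟨ ↭.++⁺ˡ (pairs L) (↭.map⁺ ∣_∣ w″↭) ⟩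
        pairs L ++ suc d ∷ d ∷ map ∣_∣ w  ↭⟨ ↭.shift (suc d) (pairs L) _ ⟩
        suc d ∷ pairs L ++ d ∷ map ∣_∣ w  ↭⟨ prep (suc d) (↭.shift d (pairs L) _) ⟩
        suc d ∷ d ∷ pairs L ++ map ∣_∣ w  ↭⟨ ↭.swap (suc d) d ↭.refl ⟩
        d ∷ suc d ∷ pairs L ++ map ∣_∣ w  ↭⟨ w↭ ⟩
        range 1 n ∎′
        where open ↭.PermutationReasoning using (step-↭-⟩) renaming (begin_ to begin′_; _∎ to _∎′)

-- Increasing words of consecutive integers

-- The words of the statement in a form that recurses on the length, which suits splitting and
-- appending; `range-ascending` translates.
ascending : ℕ → ℕ → Word
ascending a zero    = []
ascending a (suc m) = (a , 0) ∷ ascending (suc a) m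

applyUpTo-cong : ∀ {a} {X : Set a} {f g : ℕ → X} m → (∀ i → f i ≡ g i) → applyUpTo f m ≡ applyUpTo g m
applyUpTo-cong zero    f≗g = ≡.refl
applyUpTo-cong (suc m) f≗g = cong₂ _∷_ (f≗g 0) (applyUpTo-cong m (f≗g ∘ suc))

uncolored-applyUpTo : ∀ a m → uncolored (applyUpTo (a ℕ.+_) m) ≡ ascending a m
uncolored-applyUpTo a zero    = ≡.refl
uncolored-applyUpTo a (suc m) = cong₂ (λ b w → (b , 0) ∷ w) (ℕ.+-identityʳ a)
  (≡.trans (cong uncolored (applyUpTo-cong m (ℕ.+-suc a))) (uncolored-applyUpTo (suc a) m))

∣ascending∣ : ∀ a m → map ∣_∣ (ascending a m) ≡ applyUpTo (a ℕ.+_) m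
∣ascending∣ a zero    = ≡.refl
∣ascending∣ a (suc m) = cong₂ _∷_ (≡.sym (ℕ.+-identityʳ a))
  (≡.trans (∣ascending∣ (suc a) m) (applyUpTo-cong m (λ i → ≡.sym (ℕ.+-suc a i))))

length-ascending : ∀ a m → length (ascending a m) ≡ m
length-ascending a zero    = ≡.refl
length-ascending a (suc m) = cong suc (length-ascending (suc a) m)

ascending-++ : ∀ a l m → ascending a (l ℕ.+ m) ≡ ascending a l ++ ascending (a ℕ.+ l) m
ascending-++ a zero    m = cong (λ b → ascending b m) (≡.sym (ℕ.+-identityʳ a))
ascending-++ a (suc l) m = cong ((a , 0) ∷_)
  (≡.trans (ascending-++ (suc a) l m) (cong (λ b → ascending (suc a) l ++ ascending b m) (≡.sym (ℕ.+-suc a l))))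

ascending-∷ʳ : ∀ a m → ascending a (suc m) ≡ ascending a m ∷ʳ (a ℕ.+ m , 0)
ascending-∷ʳ a m = ≡.trans (cong (ascending a) (ℕ.+-comm 1 m)) (ascending-++ a m 1)

ascending-≥ : ∀ a m → All (λ s → a ≤ ∣ s ∣) (ascending a m)
ascending-≥ a zero    = []
ascending-≥ a (suc m) = ℕ.≤-refl ∷ All.map (ℕ.≤-trans (ℕ.n≤1+n a)) (ascending-≥ (suc a) m)

ascending-< : ∀ a m → All (λ s → ∣ s ∣ < a ℕ.+ m) (ascending a m)
ascending-< a zero    = []
ascending-< a (suc m) = ℕ.m<m+n a z<s ∷ subst (λ b → All (λ s → ∣ s ∣ < b) (ascending (suc a) m)) (≡.sym (ℕ.+-suc a m)) (ascending-< (suc a) m)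

ascending-color : ∀ a m → All (λ s → color s ≡ 0) (ascending a m)
ascending-color a zero    = []
ascending-color a (suc m) = ≡.refl ∷ ascending-color (suc a) m

ascending-pairs< : ∀ a m → AllPairs (λ s t → ∣ s ∣ < ∣ t ∣) (ascending a m)
ascending-pairs< a zero    = []
ascending-pairs< a (suc m) = ascending-≥ (suc a) m ∷ ascending-pairs< (suc a) m

ascending-<ᶜ : ∀ {a y} m → All ((a , y) <ᶜ_) (ascending (suc a) m)
ascending-<ᶜ {a} {y} m = All.zipWith (λ { {s} (z≡0 , a<s) → below y s z≡0 a<s }) (ascending-color (suc a) m , ascending-≥ (suc a) m)
  where
  below : ∀ y s → color s ≡ 0 → a < ∣ s ∣ → (a , y) <ᶜ s
  below zero    s ≡.refl a<s = inj₂ (≡.refl , a<s)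
  below (suc _) s ≡.refl a<s = inj₁ z<s

ascending-increasing : ∀ a m → AllPairs _<ᶜ_ (ascending a m)
ascending-increasing a zero    = []
ascending-increasing a (suc m) = ascending-<ᶜ m ∷ ascending-increasing (suc a) m

col-ascending : ∀ a m → col (ascending a m) ≡ 0
col-ascending a zero    = ≡.refl
col-ascending a (suc m) = col-ascending (suc a) m

majFrom-insert-below : ∀ {s t} i u v → All (s <ᶜ_) (u ++ v) → All (t <ᶜ_) (u ++ v) →
                       majFrom i (u ++ s ∷ v) ≡ majFrom i (u ++ t ∷ v)
majFrom-insert-below i []          []      _         _         = ≡.refl
majFrom-insert-below i []          (a ∷ v) (s<a ∷ _) (t<a ∷ _) =
  cong (ℕ._+ _) (≡.trans (descent-no i (<ᶜ-asym s<a)) (≡.sym (descent-no i (<ᶜ-asym t<a))))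
majFrom-insert-below i (a ∷ [])    v       (s<a ∷ s<) (t<a ∷ t<) =
  cong₂ ℕ._+_ (≡.trans (descent-yes i s<a) (≡.sym (descent-yes i t<a))) (majFrom-insert-below (suc i) [] v s< t<)
majFrom-insert-below i (a ∷ b ∷ u) v       (_ ∷ s<)   (_ ∷ t<)   =
  cong (descent a b i ℕ.+_) (majFrom-insert-below (suc i) (b ∷ u) v s< t<)

-- Pairing the complement of an interval

pairStarts : ℕ → ℕ → List ℕ
pairStarts c zero    = []
pairStarts c (suc g) = c ∷ pairStarts (suc (suc c)) g

pairs-pairStarts : ∀ c g → pairs (pairStarts c g) ≡ map ∣_∣ (ascending c (g ℕ.+ g))
pairs-pairStarts c zero    = ≡.refl
pairs-pairStarts c (suc g) = ≡.trans (cong (λ σ → c ∷ suc c ∷ σ) (pairs-pairStarts (suc (suc c)) g))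
  (cong (λ m → c ∷ map ∣_∣ (ascending (suc c) m)) (≡.sym (ℕ.+-suc g g)))

pairs-++ : ∀ L M → pairs (L ++ M) ≡ pairs L ++ pairs M
pairs-++ []      M = ≡.refl
pairs-++ (c ∷ L) M = cong (λ σ → c ∷ suc c ∷ σ) (pairs-++ L M)

length-pairStarts : ∀ c g → length (pairStarts c g) ≡ g
length-pairStarts c zero    = ≡.refl
length-pairStarts c (suc g) = cong suc (length-pairStarts (suc (suc c)) g)

-- Below the interval lie 2g letters and above it 2h letters, so each side splits into consecutive
-- pairs on its own and no pair has to reach across the interval.
complement-pairs : ∀ {n} g l h → n ≡ g ℕ.+ g ℕ.+ (l ℕ.+ (h ℕ.+ h)) →
  pairs (pairStarts 1 g ++ pairStarts (suc (g ℕ.+ g ℕ.+ l)) h) ++ map ∣_∣ (ascending (suc (g ℕ.+ g)) l) ↭ range 1 n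
complement-pairs {n} g l h ≡.refl = begin
  pairs (pairStarts 1 g ++ pairStarts (suc (g ℕ.+ g ℕ.+ l)) h) ++ M  ≡⟨ cong (_++ M) (pairs-++ (pairStarts 1 g) _) ⟩
  (pairs (pairStarts 1 g) ++ pairs (pairStarts (suc (g ℕ.+ g ℕ.+ l)) h)) ++ M ≡⟨ cong₂ (λ σ ρ → (σ ++ ρ) ++ M) (pairs-pairStarts 1 g) (pairs-pairStarts _ h) ⟩
  (map ∣_∣ (ascending 1 (g ℕ.+ g)) ++ H) ++ M  ≡⟨ List.++-assoc _ H M ⟩
  map ∣_∣ (ascending 1 (g ℕ.+ g)) ++ (H ++ M)  ↭⟨ ↭.++⁺ˡ (map ∣_∣ (ascending 1 (g ℕ.+ g))) (↭.++-comm H M) ⟩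
  map ∣_∣ (ascending 1 (g ℕ.+ g)) ++ (M ++ H)  ≡⟨ cong (map ∣_∣ (ascending 1 (g ℕ.+ g)) ++_) (List.map-++ ∣_∣ (ascending (suc (g ℕ.+ g)) l) _) ⟨
  map ∣_∣ (ascending 1 (g ℕ.+ g)) ++ map ∣_∣ (ascending (suc (g ℕ.+ g)) l ++ ascending (suc (g ℕ.+ g ℕ.+ l)) (h ℕ.+ h))
    ≡⟨ cong (λ w → map ∣_∣ (ascending 1 (g ℕ.+ g)) ++ map ∣_∣ w) (ascending-++ (suc (g ℕ.+ g)) l (h ℕ.+ h)) ⟨
  map ∣_∣ (ascending 1 (g ℕ.+ g)) ++ map ∣_∣ (ascending (suc (g ℕ.+ g)) (l ℕ.+ (h ℕ.+ h)))
    ≡⟨ List.map-++ ∣_∣ (ascending 1 (g ℕ.+ g)) _ ⟨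
  map ∣_∣ (ascending 1 (g ℕ.+ g) ++ ascending (suc (g ℕ.+ g)) (l ℕ.+ (h ℕ.+ h)))
    ≡⟨ cong (map ∣_∣) (ascending-++ 1 (g ℕ.+ g) (l ℕ.+ (h ℕ.+ h))) ⟨
  map ∣_∣ (ascending 1 n)
    ≡⟨ ∣ascending∣ 1 n ⟩
  range 1 n ∎
  where
  open ↭.PermutationReasoning
  M = map ∣_∣ (ascending (suc (g ℕ.+ g)) l)
  H = map ∣_∣ (ascending (suc (g ℕ.+ g ℕ.+ l)) (h ℕ.+ h))

-- Moving the inserted letter through the interval

module Exchange {c ℓ} (A : CommutativeRing c ℓ) (x : CommutativeRing.Carrier A) (r n : ℕ) where
  open CommutativeRing A
  open Exp commutativeSemiring
  open RingProperties ring using (-‿distribˡ-*)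
  open IntegerCoefficients A
  open Sums A
  open Statistic A x r
  open Containment A x r n
  open SetoidReasoning setoid

  S-swap-pair : ∀ {p y z} u t v → p ∈ range 1 n → suc p ∈ range 1 n → PairFree p (u ++ t ++ v) → y ≢ z ⊎ ∃ (_∈ t) →
    S (u ++ (p , y) ∷ t ++ (suc p , z) ∷ v) + S (u ++ (suc p , y) ∷ t ++ (p , z) ∷ v) ≈ 0#
  S-swap-pair {p} {y} {z} u t v p∈ p′∈ free h = begin
    S π + S (u ++ (suc p , y) ∷ t ++ (p , z) ∷ v)  ≡⟨ cong (λ ρ → S π + S ρ) (map-τᶜ-pair u t v free) ⟨
    S π + S (map (τᶜ p) π)  ≈⟨ +-congˡ (S-τ p p∈ p′∈ (separated-pair u t v h)) ⟩
    S π - S π  ≈⟨ -‿inverseʳ _ ⟩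
    0# ∎
    where
    π = u ++ (p , y) ∷ t ++ (suc p , z) ∷ v

  module _ {p} (p∈ : p ∈ range 1 n) (p′∈ : suc p ∈ range 1 n) (L R : Word) (free : PairFree p (L ++ R)) where

    private
      freeL : ∀ u v → u ++ v ≡ L → PairFree p (u ++ v ++ R)
      freeL u v ≡.refl = subst (PairFree p) (List.++-assoc u v R) free

      freeR : ∀ u v → u ++ v ≡ R → PairFree p (L ++ u ++ v)
      freeR u v ≡.refl = free

    -- The two exchanged letters have different colors, so every insertion, adjacent ones included,
    -- has a partner of opposite sign.
    exchange-colored : ∀ {z} → z ≢ 0 →
      ∑ˢ (λ u v → S (u ++ (suc p , z) ∷ v)) (L ++ (p , 0) ∷ R) ≈ - ∑ˢ (λ u v → S (u ++ (p , z) ∷ v)) (L ++ (suc p , 0) ∷ R)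
    exchange-colored {z} z≢0 = begin
      F  ≈⟨ solve 2 (λ f h → f := (f :+ h) :- h) refl F H ⟩
      (F + H) - H  ≈⟨ +-congʳ F+H≈0 ⟩
      0# - H  ≈⟨ +-identityˡ _ ⟩
      - H ∎
      where
      F = ∑ˢ (λ u v → S (u ++ (suc p , z) ∷ v)) (L ++ (p , 0) ∷ R)
      H = ∑ˢ (λ u v → S (u ++ (p , z) ∷ v)) (L ++ (suc p , 0) ∷ R)
      split : ∀ s t → ∑ˢ (λ u v → S (u ++ s ∷ v)) (L ++ t ∷ R) ≈
              ∑ˢ (λ u v → S (u ++ s ∷ v ++ t ∷ R)) L + ∑ˢ (λ u v → S (L ++ t ∷ u ++ s ∷ v)) R
      split s t = trans (∑ˢ-insert (λ u v → S (u ++ s ∷ v)) L t R)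
        (+-congˡ (∑ˢ-cong R (λ u v _ → reflexive (cong S (List.++-assoc L (t ∷ u) (s ∷ v))))))
      F+H≈0 : F + H ≈ 0#
      F+H≈0 = begin
        F + H
          ≈⟨ +-cong (split _ _) (split _ _) ⟩
        (∑ˢ _ L + ∑ˢ _ R) + (∑ˢ _ L + ∑ˢ _ R)
          ≈⟨ solve 4 (λ a b c d → (a :+ b) :+ (c :+ d) := (c :+ a) :+ (b :+ d)) refl _ _ _ _ ⟩
        (∑ˢ _ L + ∑ˢ _ L) + (∑ˢ _ R + ∑ˢ _ R)
          ≈⟨ +-cong (∑ˢ-+ _ _ L) (∑ˢ-+ _ _ R) ⟨
        ∑ˢ (λ u v → S (u ++ (p , z) ∷ v ++ (suc p , 0) ∷ R) + S (u ++ (suc p , z) ∷ v ++ (p , 0) ∷ R)) L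
          + ∑ˢ (λ u v → S (L ++ (p , 0) ∷ u ++ (suc p , z) ∷ v) + S (L ++ (suc p , 0) ∷ u ++ (p , z) ∷ v)) R
          ≈⟨ +-cong (trans (∑ˢ-cong L (λ u v eq → S-swap-pair u v R p∈ p′∈ (freeL u v eq) (inj₁ z≢0))) (∑ˢ-0 L))
                    (trans (∑ˢ-cong R (λ u v eq → S-swap-pair L u v p∈ p′∈ (freeR u v eq) (inj₁ (z≢0 ∘ ≡.sym)))) (∑ˢ-0 R)) ⟩
        0# + 0#
          ≈⟨ +-identityˡ 0# ⟩
        0# ∎

    -- Summed with its mirror image, each side reduces to the insertions next to the exchanged letter.
    exchange-uncolored :
      ∑ˢ (λ u v → S (u ++ (suc p , 0) ∷ v ++ R)) (L ∷ʳ (p , 0)) - ∑ˢ (λ u v → S ((L ∷ʳ (p , 0)) ++ u ++ (suc p , 0) ∷ v)) R ≈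
      - (∑ˢ (λ u v → S (u ++ (p , 0) ∷ v ++ (suc p , 0) ∷ R)) L - ∑ˢ (λ u v → S (L ++ u ++ (p , 0) ∷ v)) ((suc p , 0) ∷ R))
    exchange-uncolored = begin
      ∑ˢ (λ u v → S (u ++ e′ ∷ v ++ R)) (L ∷ʳ e) - ∑ˢ (λ u v → S ((L ∷ʳ e) ++ u ++ e′ ∷ v)) R
        ≈⟨ +-cong (trans (∑ˢ-∷ʳ _ L e) (+-cong (∑ˢ-cong L (λ u v _ → reflexive (cong (λ w → S (u ++ e′ ∷ w)) (List.++-assoc v _ R)))) (reflexive (cong S (List.++-assoc L _ (e′ ∷ R))))))
                  (-‿cong (∑ˢ-cong R (λ u v _ → reflexive (cong S (List.++-assoc L _ (u ++ e′ ∷ v)))))) ⟩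
      (l′ + S (L ++ e ∷ e′ ∷ R)) - r′
        ≈⟨ solve 5 (λ l′ l s r′ r → (l′ :+ s) :- r′ := ((l :+ l′) :- (r′ :+ r)) :- (l :- (s :+ r))) refl l′ l _ r′ r″ ⟩
      ((l + l′) - (r′ + r″)) - (l - (S (L ++ e ∷ e′ ∷ R) + r″))
        ≈⟨ +-congʳ (+-cong l+l′ (-‿cong r′+r)) ⟩
      (adjacent - adjacent) - (l - (S (L ++ e ∷ e′ ∷ R) + r″))
        ≈⟨ trans (+-congʳ (-‿inverseʳ adjacent)) (+-identityˡ _) ⟩
      - (l - (S (L ++ e ∷ e′ ∷ R) + r″))
        ≈⟨ -‿cong (+-congˡ (-‿cong (+-congˡ (∑ˢ-cong R (λ u v _ → refl))))) ⟩
      - (l - ∑ˢ (λ u v → S (L ++ u ++ e ∷ v)) (e′ ∷ R)) ∎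
      where
      e  = (p , 0)
      e′ = (suc p , 0)
      l  = ∑ˢ (λ u v → S (u ++ e ∷ v ++ e′ ∷ R)) L
      l′ = ∑ˢ (λ u v → S (u ++ e′ ∷ v ++ e ∷ R)) L
      r′ = ∑ˢ (λ u v → S (L ++ e ∷ u ++ e′ ∷ v)) R
      r″ = ∑ˢ (λ u v → S (L ++ e′ ∷ u ++ e ∷ v)) R
      adjacent = S (L ++ e ∷ e′ ∷ R) + S (L ++ e′ ∷ e ∷ R)
      l+l′ : l + l′ ≈ adjacent
      l+l′ = trans (sym (∑ˢ-+ _ _ L)) (∑ˢ-last _ L (λ u a v eq →
        S-swap-pair u (a ∷ v) R p∈ p′∈ (freeL u (a ∷ v) eq) (inj₂ (a , here ≡.refl))))
      r′+r : r′ + r″ ≈ adjacent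
      r′+r = trans (sym (∑ˢ-+ _ _ R)) (∑ˢ-first _ R (λ a u v eq →
        S-swap-pair L (a ∷ u) v p∈ p′∈ (freeR (a ∷ u) v eq) (inj₂ (a , here ≡.refl))))

  -- The arguments of `f` count the letters of the interval below and above the moving one; each
  -- exchange shifts one letter from one side to the other and costs a sign.
  alternate : ∀ {k} (f : ℕ → ℕ → Carrier) → (∀ i j → suc i ℕ.+ j ≡ k → f (suc i) j ≈ - f i (suc j)) →
              ∀ i j → i ℕ.+ j ≡ k → f i j ≈ sgn i * f 0 k
  alternate f step zero    j ≡.refl = sym (*-identityˡ _)
  alternate f step (suc i) j eq = begin
    f (suc i) j  ≈⟨ step i j eq ⟩
    - f i (suc j)  ≈⟨ -‿cong (alternate f step i (suc j) (≡.trans (ℕ.+-suc i j) eq)) ⟩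
    - (sgn i * f 0 _)  ≈⟨ -‿distribˡ-* _ _ ⟩
    - sgn i * f 0 _  ≈⟨ *-congʳ (sgn-suc i) ⟨
    sgn (suc i) * f 0 _  ∎

-- Evaluation of the insertions into the two words

module Evaluate {c ℓ} (A : CommutativeRing c ℓ) (x : CommutativeRing.Carrier A) (r n : ℕ) where
  open CommutativeRing A
  open Exp commutativeSemiring
  open IntegerCoefficients A
  open Sums A
  open Statistic A x r
  open Containment A x r n
  open Exchange A x r n
  open SetoidReasoning setoid

  ∑ˢ-length : ∀ {a} {Y : Set a} (f : ℕ → Carrier) (w : List Y) → ∑ˢ (λ u _ → f (length u)) w ≈ ∑< (suc (length w)) f
  ∑ˢ-length f []      = sym (+-identityʳ _)
  ∑ˢ-length f (_ ∷ w) = +-congˡ (∑ˢ-length (f ∘ suc) w)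

  S-interval : ∀ g h {m w} → n ≡ g ℕ.+ g ℕ.+ (m ℕ.+ (h ℕ.+ h)) → map ∣_∣ w ↭ map ∣_∣ (ascending (suc (g ℕ.+ g)) m) →
               All (λ a → color a < r) w → S w ≈ T w * pairFactors (g ℕ.+ h) m
  S-interval g h {m} {w} n≡ w↭ colors< = trans
    (S-pairs L (↭-trans (↭.++⁺ˡ (pairs L) w↭) (complement-pairs g m h n≡)) colors<)
    (*-congˡ (reflexive (cong₂ pairFactors length-L length-w)))
    where
    L = pairStarts 1 g ++ pairStarts (suc (g ℕ.+ g ℕ.+ m)) h
    length-L : length L ≡ g ℕ.+ h
    length-L = ≡.trans (List.length-++ (pairStarts 1 g)) (cong₂ ℕ._+_ (length-pairStarts 1 g) (length-pairStarts _ h))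
    length-w : length w ≡ m
    length-w = ≡.trans (≡.sym (List.length-map ∣_∣ w)) (≡.trans (↭.↭-length w↭)
      (≡.trans (List.length-map ∣_∣ (ascending (suc (g ℕ.+ g)) m)) (length-ascending _ m)))

  module Sides (a k : ℕ) where
    U V : Word
    U = ascending a k
    V = ascending (suc a) k

    -- Both sums concern words on the whole interval a, ..., a + k in which only the inserted letter
    -- may have a color other than 0. For `U` it is the largest letter, for `V` the smallest.
    Uᶻ Vᶻ : ℕ → Carrier
    Uᶻ z = ∑ˢ (λ u v → S (u ++ (a ℕ.+ k , z) ∷ v)) U
    Vᶻ z = ∑ˢ (λ u v → S (u ++ (a , z) ∷ v)) V

  module _ (a k : ℕ) (1≤a : 1 ≤ a) (a+k≤n : a ℕ.+ k ≤ n) where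
    open Sides a k

    private
      p∈ : ∀ i j → suc i ℕ.+ j ≡ k → a ℕ.+ i ∈ range 1 n
      p∈ i j eq = ∈-range⁺ (ℕ.≤-trans 1≤a (ℕ.m≤m+n a i))
        (ℕ.≤-trans (ℕ.+-monoʳ-≤ a (ℕ.≤-trans (ℕ.n≤1+n i) (subst (suc i ≤_) eq (ℕ.m≤m+n (suc i) j)))) a+k≤n)

      p′∈ : ∀ i j → suc i ℕ.+ j ≡ k → suc (a ℕ.+ i) ∈ range 1 n
      p′∈ i j eq = ∈-range⁺ (s≤s z≤n)
        (ℕ.≤-trans (subst (_≤ a ℕ.+ k) (ℕ.+-suc a i) (ℕ.+-monoʳ-≤ a (subst (suc i ≤_) eq (ℕ.m≤m+n (suc i) j)))) a+k≤n)

      free : ∀ i j → PairFree (a ℕ.+ i) (ascending a i ++ ascending (suc (suc (a ℕ.+ i))) j)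
      free i j = pairFree (absent (a ℕ.+ i) ℕ.≤-refl (ℕ.n≤1+n _)) (absent (suc (a ℕ.+ i)) (ℕ.n≤1+n _) ℕ.≤-refl)
        where
        absent : ∀ q → a ℕ.+ i ≤ q → q ≤ suc (a ℕ.+ i) → q ∉ map ∣_∣ (ascending a i ++ ascending (suc (suc (a ℕ.+ i))) j)
        absent q lo hi q∈ with s , s∈ , ≡.refl ← ∈-map⁻ ∣_∣ q∈ with ∈-++⁻ (ascending a i) s∈
        ... | inj₁ s∈L = ℕ.<⇒≱ (All.lookup (ascending-< a i) s∈L) lo
        ... | inj₂ s∈R = ℕ.<⇒≱ (All.lookup (ascending-≥ (suc (suc (a ℕ.+ i))) j) s∈R) hi

      snoc : ∀ i j → ascending a (suc i) ++ ascending (suc (suc (a ℕ.+ i))) j ≡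
                     ascending a i ++ (a ℕ.+ i , 0) ∷ ascending (suc (suc (a ℕ.+ i))) j
      snoc i j = ≡.trans (cong (_++ ascending (suc (suc (a ℕ.+ i))) j) (ascending-∷ʳ a i)) (List.++-assoc (ascending a i) _ _)

    Uᶻ-colored : ∀ {z} → z ≢ 0 → Uᶻ z ≈ sgn k * Vᶻ z
    Uᶻ-colored {z} z≢0 = begin
      Uᶻ z  ≡⟨ cong (∑ˢ (λ u v → S (u ++ (a ℕ.+ k , z) ∷ v))) (List.++-identityʳ U) ⟨
      f k 0  ≈⟨ alternate f step k 0 (ℕ.+-identityʳ k) ⟩
      sgn k * f 0 k  ≡⟨ cong (λ b → sgn k * ∑ˢ (λ u v → S (u ++ (b , z) ∷ v)) (ascending (suc b) k)) (ℕ.+-identityʳ a) ⟩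
      sgn k * Vᶻ z ∎
      where
      -- Here a + i is inserted into the rest of the interval, which interpolates between `Vᶻ z` at
      -- i = 0 and `Uᶻ z` at i = k.
      f : ℕ → ℕ → Carrier
      f i j = ∑ˢ (λ u v → S (u ++ (a ℕ.+ i , z) ∷ v)) (ascending a i ++ ascending (suc (a ℕ.+ i)) j)
      step : ∀ i j → suc i ℕ.+ j ≡ k → f (suc i) j ≈ - f i (suc j)
      step i j eq = begin
        f (suc i) j
          ≡⟨ cong (λ q → ∑ˢ (λ u v → S (u ++ (q , z) ∷ v)) (ascending a (suc i) ++ ascending (suc q) j)) (ℕ.+-suc a i) ⟩
        ∑ˢ (λ u v → S (u ++ (suc (a ℕ.+ i) , z) ∷ v)) (ascending a (suc i) ++ ascending (suc (suc (a ℕ.+ i))) j)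
          ≡⟨ cong (∑ˢ (λ u v → S (u ++ (suc (a ℕ.+ i) , z) ∷ v))) (snoc i j) ⟩
        ∑ˢ (λ u v → S (u ++ (suc (a ℕ.+ i) , z) ∷ v)) (ascending a i ++ (a ℕ.+ i , 0) ∷ ascending (suc (suc (a ℕ.+ i))) j)
          ≈⟨ exchange-colored (p∈ i j eq) (p′∈ i j eq) (ascending a i) (ascending (suc (suc (a ℕ.+ i))) j) (free i j) z≢0 ⟩
        - f i (suc j) ∎

    -- Adjacent letters of equal color are not separated, so the full sum of insertions does not
    -- simply change sign. The difference between the insertions to the left and to the right of the
    -- proper place of the letter does, since the adjacent terms occur in both parts. The increasing
    -- word belongs to both parts as well, and at either end of the interval one part consists of it
    -- alone; this is the term `S (ascending a (suc k))`.
    Uᶻ-uncolored : Uᶻ 0 - S (ascending a (suc k)) ≈ sgn k * (S (ascending a (suc k)) - Vᶻ 0)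
    Uᶻ-uncolored = begin
      Uᶻ 0 - S (ascending a (suc k))
        ≈⟨ +-cong (∑ˢ-cong U (λ u v _ → reflexive (cong (λ w → S (u ++ (a ℕ.+ k , 0) ∷ w)) (≡.sym (List.++-identityʳ v)))))
                  (-‿cong (reflexive (cong S (ascending-∷ʳ a k)))) ⟩
      f k 0
        ≈⟨ alternate f step k 0 (ℕ.+-identityʳ k) ⟩
      sgn k * f 0 k
        ≡⟨ cong (λ b → sgn k * (S ((b , 0) ∷ ascending (suc b) k) - ∑ˢ (λ u v → S (u ++ (b , 0) ∷ v)) (ascending (suc b) k))) (ℕ.+-identityʳ a) ⟩
      sgn k * (S (ascending a (suc k)) - Vᶻ 0) ∎
      where
      left right f : ℕ → ℕ → Carrier
      left  i j = ∑ˢ (λ u v → S (u ++ (a ℕ.+ i , 0) ∷ v ++ ascending (suc (a ℕ.+ i)) j)) (ascending a i)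
      right i j = ∑ˢ (λ u v → S (ascending a i ++ u ++ (a ℕ.+ i , 0) ∷ v)) (ascending (suc (a ℕ.+ i)) j)
      f     i j = left i j - right i j
      step : ∀ i j → suc i ℕ.+ j ≡ k → f (suc i) j ≈ - f i (suc j)
      step i j eq = begin
        f (suc i) j
          ≡⟨ cong₂ (λ q L → ∑ˢ (λ u v → S (u ++ (q , 0) ∷ v ++ ascending (suc q) j)) L - ∑ˢ (λ u v → S (L ++ u ++ (q , 0) ∷ v)) (ascending (suc q) j))
               (ℕ.+-suc a i) (ascending-∷ʳ a i) ⟩
        _ ≈⟨ exchange-uncolored (p∈ i j eq) (p′∈ i j eq) (ascending a i) (ascending (suc (suc (a ℕ.+ i))) j) (free i j) ⟩
        - f i (suc j) ∎

    a∈ : a ∈ range 1 n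
    a∈ = ∈-range⁺ 1≤a (ℕ.≤-trans (ℕ.m≤m+n a k) a+k≤n)

    S-U : S U ≈ ∑< r Uᶻ
    S-U = S-insert (∈-range⁺ (ℕ.≤-trans 1≤a (ℕ.m≤m+n a k)) a+k≤n) b∉
      where
      b∉ : a ℕ.+ k ∉ map ∣_∣ U
      b∉ b∈ with s , s∈ , eq ← ∈-map⁻ ∣_∣ b∈ = ℕ.<-irrefl (≡.sym eq) (All.lookup (ascending-< a k) s∈)

    S-V : S V ≈ ∑< r Vᶻ
    S-V = S-insert a∈ a∉
      where
      a∉ : a ∉ map ∣_∣ V
      a∉ a∈V with s , s∈ , eq ← ∈-map⁻ ∣_∣ a∈V = ℕ.<-irrefl eq (All.lookup (ascending-≥ (suc a) k) s∈)

  module _ (a k : ℕ) where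
    open Sides a k

    -- Whatever its color, the letter of absolute value `a` lies below all of `V`. It adds length u
    -- inversions, and the only descent is at position length u.
    T-insert-V : ∀ {z} u v → u ++ v ≡ V → T (u ++ (a , z) ∷ v) ≈ (- X) ^ length u * x ^ z
    T-insert-V {z} u v uv≡V = begin
      T w
        ≈⟨ T-factor w ⟩
      sgn (inv (map ∣_∣ w)) * (X ^ majF w * x ^ col w)
        ≡⟨ cong₂ (λ i m → sgn i * (X ^ m * x ^ col w)) inv≡ maj≡ ⟩
      sgn (length u) * (X ^ length u * x ^ col w)
        ≡⟨ cong (λ m → sgn (length u) * (X ^ length u * x ^ m)) col≡ ⟩
      sgn (length u) * (X ^ length u * x ^ z)
        ≈⟨ *-assoc _ _ _ ⟨
      (sgn (length u) * X ^ length u) * x ^ z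
        ≈⟨ *-congʳ (trans (sym (^-distrib-* (- 1#) X (length u))) (^-congˡ (length u) (solve 1 (λ X → (:- 1ᵖ) :* X := :- X) refl X))) ⟩
      (- X) ^ length u * x ^ z ∎
      where
      w = u ++ (a , z) ∷ v
      ∣uv∣ : map ∣_∣ u ++ map ∣_∣ v ≡ map ∣_∣ V
      ∣uv∣ = ≡.trans (≡.sym (List.map-++ ∣_∣ u v)) (cong (map ∣_∣) uv≡V)
      inv≡ : inv (map ∣_∣ w) ≡ length u
      inv≡ = ≡.trans (cong inv (List.map-++ ∣_∣ u _)) (≡.trans
        (inv-insert-min (map ∣_∣ u) (map ∣_∣ v) (subst (All (a <_)) (≡.sym ∣uv∣) (All.map⁺ (ascending-≥ (suc a) k))))
        (≡.trans (cong₂ ℕ._+_ (List.length-map ∣_∣ u) (≡.trans (cong inv ∣uv∣) (inv-increasing (AllPairs.map⁺ (ascending-pairs< (suc a) k)))))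
                 (ℕ.+-identityʳ _)))
      maj≡ : majF w ≡ length u
      maj≡ = majF-insert-min u (subst (All ((a , z) <ᶜ_)) (≡.sym uv≡V) (ascending-<ᶜ k))
                               (subst (AllPairs _<ᶜ_) (≡.sym uv≡V) (ascending-increasing (suc a) k))
      col≡ : col w ≡ z
      col≡ = ≡.trans (col-↭ (insert-↭ u uv≡V)) (≡.trans (cong (z ℕ.+_) (col-ascending (suc a) k)) (ℕ.+-identityʳ z))

    T-V : T V ≈ 1#
    T-V = begin
      T V  ≈⟨ T-factor V ⟩
      sgn (inv (map ∣_∣ V)) * (X ^ majF V * x ^ col V)  ≡⟨ cong₂ (λ i m → sgn i * (X ^ m * x ^ col V)) (inv-increasing (AllPairs.map⁺ (ascending-pairs< (suc a) k))) (majFrom-increasing 1 (ascending-increasing (suc a) k)) ⟩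
      1# * (1# * x ^ col V)  ≡⟨ cong (λ m → 1# * (1# * x ^ m)) (col-ascending (suc a) k) ⟩
      1# * (1# * 1#)  ≈⟨ trans (*-identityˡ _) (*-identityˡ _) ⟩
      1# ∎

    -- With `a` odd, an even number of letters is missing on either side of the interval, so every
    -- insertion is evaluated with the same factor. The sum over the positions is then the geometric
    -- sum in - X.
    Vᶻ-even : ∀ g h → a ≡ suc (g ℕ.+ g) → n ≡ g ℕ.+ g ℕ.+ (suc k ℕ.+ (h ℕ.+ h)) → ∀ {z} → z < r →
              Vᶻ z ≈ ([ suc k ]⟪ - X ⟫ * x ^ z) * pairFactors (g ℕ.+ h) (suc k)
    Vᶻ-even g h a≡ n≡ {z} z<r = begin
      Vᶻ z
        ≈⟨ ∑ˢ-cong V (λ u v uv≡V → trans (expand u v uv≡V) (*-congʳ (T-insert-V u v uv≡V))) ⟩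
      ∑ˢ (λ u v → ((- X) ^ length u * x ^ z) * Π) V
        ≈⟨ trans (∑ˢ-*ʳ Π _ V) (*-congʳ (∑ˢ-*ʳ (x ^ z) _ V)) ⟩
      (∑ˢ (λ u v → (- X) ^ length u) V * x ^ z) * Π
        ≈⟨ *-congʳ (*-congʳ (trans (∑ˢ-length ((- X) ^_) V) (trans (reflexive (cong (λ m → ∑< (suc m) ((- X) ^_)) (length-ascending (suc a) k))) (sym (qint (suc k) (- X)))))) ⟩
      ([ suc k ]⟪ - X ⟫ * x ^ z) * Π ∎
      where
      Π = pairFactors (g ℕ.+ h) (suc k)
      expand : ∀ u v → u ++ v ≡ V → S (u ++ (a , z) ∷ v) ≈ T (u ++ (a , z) ∷ v) * Π
      expand u v uv≡V = S-interval g h n≡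
        (subst (λ b → map ∣_∣ (u ++ (a , z) ∷ v) ↭ map ∣_∣ (ascending b (suc k))) a≡ (↭.map⁺ ∣_∣ (insert-↭ u uv≡V)))
        (↭.All-resp-↭ (↭-sym (insert-↭ u uv≡V)) (z<r ∷ All.map (λ { ≡.refl → ℕ.≤-<-trans z≤n z<r }) (ascending-color (suc a) k)))

  -- A letter that lies below all others before and after recoloring gives the same descents, so
  -- only the sum of the colors changes.
  T-recolor-min : ∀ {p y} u v → All ((p , y) <ᶜ_) (u ++ v) → All ((p , 0) <ᶜ_) (u ++ v) →
                  T (u ++ (p , y) ∷ v) ≈ x ^ y * T (u ++ (p , 0) ∷ v)
  T-recolor-min {p} {y} u v y< 0< = begin
    T w  ≈⟨ T-factor w ⟩
    sgn (inv (map ∣_∣ w)) * (X ^ majF w * x ^ col w)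
      ≡⟨ cong₂ (λ σ m → sgn (inv σ) * (X ^ m * x ^ col w)) (≡.trans (List.map-++ ∣_∣ u _) (≡.sym (List.map-++ ∣_∣ u _))) (majFrom-insert-below 1 u v y< 0<) ⟩
    sgn (inv (map ∣_∣ w₀)) * (X ^ majF w₀ * x ^ col w)  ≡⟨ cong (λ m → sgn (inv (map ∣_∣ w₀)) * (X ^ majF w₀ * x ^ m)) col≡ ⟩
    sgn (inv (map ∣_∣ w₀)) * (X ^ majF w₀ * x ^ (y ℕ.+ col w₀))  ≈⟨ *-congˡ (*-congˡ (^-homo-* x y (col w₀))) ⟩
    sgn (inv (map ∣_∣ w₀)) * (X ^ majF w₀ * (x ^ y * x ^ col w₀))
      ≈⟨ solve 4 (λ s m y c → s :* (m :* (y :* c)) := y :* (s :* (m :* c))) refl _ _ _ _ ⟩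
    x ^ y * (sgn (inv (map ∣_∣ w₀)) * (X ^ majF w₀ * x ^ col w₀))  ≈⟨ *-congˡ (T-factor w₀) ⟨
    x ^ y * T w₀ ∎
    where
    w  = u ++ (p , y) ∷ v
    w₀ = u ++ (p , 0) ∷ v
    col≡ : col w ≡ y ℕ.+ col w₀
    col≡ = ≡.trans (col-↭ (↭.shift (p , y) u v)) (cong (y ℕ.+_) (≡.sym (col-↭ (↭.shift (p , 0) u v))))

  ∑ˢ-insert²-comm : ∀ (f : Word → Carrier) s t w →
    ∑ˢ (λ u v → ∑ˢ (λ u′ v′ → f (u′ ++ t ∷ v′)) (u ++ s ∷ v)) w ≈
    ∑ˢ (λ u v → ∑ˢ (λ u′ v′ → f (u′ ++ s ∷ v′)) (u ++ t ∷ v)) w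
  ∑ˢ-insert²-comm f s t w = trans (∑ˢ-insert² f s t w)
    (trans (∑ˢ-cong w (λ u q _ → ∑ˢ-cong q (λ _ _ _ → +-comm _ _))) (sym (∑ˢ-insert² f t s w)))

  module _ (p k : ℕ) where
    open Sides (suc p) k

    V-unique : Unique (map ∣_∣ V)
    V-unique = subst Unique (≡.sym (∣ascending∣ (suc (suc p)) k))
      (Unique.applyUpTo⁺₁ _ k (λ i<j _ eq → ℕ.<⇒≢ i<j (ℕ.+-cancelˡ-≡ (suc (suc p)) _ _ eq)))

    V-free : PairFree p V
    V-free = pairFree (absent (ℕ.n≤1+n p)) (absent ℕ.≤-refl)
      where
      absent : ∀ {q} → q ≤ suc p → q ∉ map ∣_∣ V
      absent q≤ q∈ with s , s∈ , ≡.refl ← ∈-map⁻ ∣_∣ q∈ = ℕ.<⇒≱ (All.lookup (ascending-≥ (suc (suc p)) k) s∈) q≤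

    -- Inserting `p` last makes `T-recolor-min` applicable to each term, because all other letters
    -- are uncolored and larger. What remains is a pair with both colors 0.
    insertPair-uncolored : ∀ y → insertPair p y 0 V ≈ x ^ y * P (suc k) X
    insertPair-uncolored y = begin
      insertPair p y 0 V
        ≈⟨ ∑ˢ-insert²-comm T _ _ V ⟩
      ∑ˢ (λ u v → ∑ˢ (λ u′ v′ → T (u′ ++ (p , y) ∷ v′)) (u ++ (suc p , 0) ∷ v)) V
        ≈⟨ ∑ˢ-cong V (λ u v uv≡V → trans (∑ˢ-cong (u ++ (suc p , 0) ∷ v) (λ u′ v′ eq →
             T-recolor-min u′ v′ (below y u v u′ v′ uv≡V eq) (below 0 u v u′ v′ uv≡V eq))) (∑ˢ-*ˡ (x ^ y) _ (u ++ (suc p , 0) ∷ v))) ⟩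
      ∑ˢ (λ u v → x ^ y * ∑ˢ (λ u′ v′ → T (u′ ++ (p , 0) ∷ v′)) (u ++ (suc p , 0) ∷ v)) V
        ≈⟨ trans (∑ˢ-*ˡ (x ^ y) _ V) (*-congˡ (∑ˢ-insert²-comm T _ _ V)) ⟩
      x ^ y * insertPair p 0 0 V
        ≈⟨ *-congˡ (insertPair-equal V-unique V-free 0) ⟩
      x ^ y * (T V * (1# * P (suc (length V)) X))
        ≈⟨ *-congˡ (trans (*-cong (T-V (suc p) k) (*-identityˡ _)) (trans (*-identityˡ _) (reflexive (cong (λ m → P (suc m) X) (length-ascending (suc (suc p)) k))))) ⟩
      x ^ y * P (suc k) X ∎
      where
      below : ∀ y u v u′ v′ → u ++ v ≡ V → u′ ++ v′ ≡ u ++ (suc p , 0) ∷ v → All ((p , y) <ᶜ_) (u′ ++ v′)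
      below y u v u′ v′ uv≡V eq = subst (All ((p , y) <ᶜ_)) (≡.sym eq) (↭.All-resp-↭ (↭-sym (insert-↭ u uv≡V)) (ascending-<ᶜ (suc k)))

    insertPair-equal-V : ∀ z → insertPair p z z V ≈ (x * x) ^ z * P (suc k) X
    insertPair-equal-V z = trans (insertPair-equal V-unique V-free z)
      (trans (*-congʳ (T-V (suc p) k)) (trans (*-identityˡ _) (*-congˡ (reflexive (cong (λ m → P (suc m) X) (length-ascending (suc (suc p)) k))))))

    -- An odd number of letters lies below the interval; absorbing the largest of them, `p`, leaves
    -- 2g letters, which form pairs.
    Vᶻ-odd : ∀ g h → p ≡ suc (g ℕ.+ g) → n ≡ g ℕ.+ g ℕ.+ (suc (suc k) ℕ.+ (h ℕ.+ h)) → ∀ {z} → z < r →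
             Vᶻ z ≈ ∑< r (λ y → insertPair p y z V) * pairFactors (g ℕ.+ h) (suc (suc k))
    Vᶻ-odd g h p≡ n≡ {z} z<r = begin
      Vᶻ z
        ≈⟨ ∑ˢ-cong V (λ u v uv≡V → S-insert p∈ (p∉ u v uv≡V)) ⟩
      ∑ˢ (λ u v → ∑< r (λ y → ∑ˢ (λ u′ v′ → S (u′ ++ (p , y) ∷ v′)) (u ++ (suc p , z) ∷ v))) V
        ≈⟨ ∑ˢ-cong V (λ u v uv≡V → ∑<-cong r (λ {y} y<r → trans
             (∑ˢ-cong (u ++ (suc p , z) ∷ v) (λ u′ v′ eq → expand u v u′ v′ uv≡V eq y<r)) (∑ˢ-*ʳ Π _ (u ++ (suc p , z) ∷ v)))) ⟩
      ∑ˢ (λ u v → ∑< r (λ y → ∑ˢ (λ u′ v′ → T (u′ ++ (p , y) ∷ v′)) (u ++ (suc p , z) ∷ v) * Π)) V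
        ≈⟨ trans (∑ˢ-∑< r _ V) (∑<-cong r (λ _ → ∑ˢ-*ʳ Π _ V)) ⟩
      ∑< r (λ y → ∑ˢ (λ u v → ∑ˢ (λ u′ v′ → T (u′ ++ (p , y) ∷ v′)) (u ++ (suc p , z) ∷ v)) V * Π)
        -- So far `p` is inserted after `suc p`; `insertPair` prescribes the opposite order, which
        -- gives the same sum.
        ≈⟨ trans (∑<-*ʳ r Π _) (*-congʳ (∑<-cong r (λ {y} _ → ∑ˢ-insert²-comm T _ _ V))) ⟩
      ∑< r (λ y → insertPair p y z V) * Π ∎
      where
      Π = pairFactors (g ℕ.+ h) (suc (suc k))
      p∈ : p ∈ range 1 n
      p∈ = ∈-range⁺ (subst (1 ≤_) (≡.sym p≡) (s≤s z≤n)) (subst₂ _≤_ (≡.sym p≡) (≡.sym n≡)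
        (ℕ.≤-trans (ℕ.m≤m+n (suc (g ℕ.+ g)) _) (ℕ.≤-reflexive (≡.sym (ℕ.+-suc (g ℕ.+ g) _)))))
      p∉ : ∀ u v → u ++ v ≡ V → p ∉ map ∣_∣ (u ++ (suc p , z) ∷ v)
      p∉ u v uv≡V p∈w with ↭.∈-resp-↭ (↭.map⁺ ∣_∣ (insert-↭ u uv≡V)) p∈w
      ... | here eq    = ℕ.1+n≢n (≡.sym eq)
      ... | there p∈V  = c∉ V-free p∈V
      expand : ∀ u v u′ v′ {y} → u ++ v ≡ V → u′ ++ v′ ≡ u ++ (suc p , z) ∷ v → y < r →
               S (u′ ++ (p , y) ∷ v′) ≈ T (u′ ++ (p , y) ∷ v′) * Π
      expand u v u′ v′ {y} uv≡V eq y<r = S-interval g h n≡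
        (subst (λ b → map ∣_∣ (u′ ++ (p , y) ∷ v′) ↭ map ∣_∣ (ascending b (suc (suc k)))) p≡ (↭.map⁺ ∣_∣ w↭))
        (↭.All-resp-↭ (↭-sym w↭) (y<r ∷ z<r ∷ All.map (λ { ≡.refl → ℕ.≤-<-trans z≤n z<r }) (ascending-color (suc (suc p)) k)))
        where
        w↭ : u′ ++ (p , y) ∷ v′ ↭ (p , y) ∷ (suc p , z) ∷ V
        w↭ = ↭-trans (insert-↭ u′ eq) (prep _ (insert-↭ u uv≡V))

-- The commutative ring of polynomials

module Polynomials {c ℓ} (R : CommutativeRing c ℓ) where
  open CommutativeRing R
  open GeneratingFunctions R
  open IntegerCoefficients R
  open SetoidReasoning setoid

  coeff-+ : ∀ p s i → coeff (p +ₚ s) i ≈ coeff p i + coeff s i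
  coeff-+ []      s       i       = sym (+-identityˡ _)
  coeff-+ (a ∷ p) []      i       = sym (+-identityʳ _)
  coeff-+ (a ∷ p) (b ∷ s) zero    = refl
  coeff-+ (a ∷ p) (b ∷ s) (suc i) = coeff-+ p s i

  coeff-scale : ∀ a p i → coeff (map (a *_) p) i ≈ a * coeff p i
  coeff-scale a []      i       = sym (zeroʳ a)
  coeff-scale a (b ∷ p) zero    = refl
  coeff-scale a (b ∷ p) (suc i) = coeff-scale a p i

  coeff-neg : ∀ p i → coeff (-ₚ p) i ≈ - coeff p i
  coeff-neg []      i       = solve 0 (con ℤ.0ℤ := :- con ℤ.0ℤ) refl
  coeff-neg (b ∷ p) zero    = refl
  coeff-neg (b ∷ p) (suc i) = coeff-neg p i

  shift : Poly → Poly
  shift p = 0# ∷ p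

  coeff-∷* : ∀ a p s i → coeff ((a ∷ p) *ₚ s) i ≈ a * coeff s i + coeff (shift (p *ₚ s)) i
  coeff-∷* a p s i = trans (coeff-+ (map (a *_) s) (shift (p *ₚ s)) i) (+-congʳ (coeff-scale a s i))

  shift-cong : ∀ p s → p ≈ₚ s → shift p ≈ₚ shift s
  shift-cong p s p≈s zero    = refl
  shift-cong p s p≈s (suc i) = p≈s i

  coeff-shift-+ : ∀ p s i → coeff (shift (p +ₚ s)) i ≈ coeff (shift p) i + coeff (shift s) i
  coeff-shift-+ p s zero    = sym (+-identityˡ 0#)
  coeff-shift-+ p s (suc i) = coeff-+ p s i

  coeff-shift-scale : ∀ a p i → coeff (shift (map (a *_) p)) i ≈ a * coeff (shift p) i
  coeff-shift-scale a p zero    = sym (zeroʳ a)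
  coeff-shift-scale a p (suc i) = coeff-scale a p i

  +ₚ-cong : ∀ p p′ s s′ → p ≈ₚ p′ → s ≈ₚ s′ → p +ₚ s ≈ₚ p′ +ₚ s′
  +ₚ-cong p p′ s s′ p≈ s≈ i = trans (coeff-+ p s i) (trans (+-cong (p≈ i) (s≈ i)) (sym (coeff-+ p′ s′ i)))

  *ₚ-congʳ : ∀ p s t → s ≈ₚ t → p *ₚ s ≈ₚ p *ₚ t
  *ₚ-congʳ []      s t s≈t i = refl
  *ₚ-congʳ (a ∷ p) s t s≈t i = begin
    coeff ((a ∷ p) *ₚ s) i  ≈⟨ coeff-∷* a p s i ⟩
    a * coeff s i + coeff (shift (p *ₚ s)) i  ≈⟨ +-cong (*-congˡ (s≈t i)) (shift-cong (p *ₚ s) (p *ₚ t) (*ₚ-congʳ p s t s≈t) i) ⟩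
    a * coeff t i + coeff (shift (p *ₚ t)) i  ≈⟨ coeff-∷* a p t i ⟨
    coeff ((a ∷ p) *ₚ t) i ∎

  -- A nonempty list of zeros also represents the zero polynomial; the congruence of the product
  -- meets this case when the two lists differ in length.
  *ₚ-zeroˡ : ∀ p s → p ≈ₚ [] → p *ₚ s ≈ₚ []
  *ₚ-zeroˡ []      s p≈0 i = refl
  *ₚ-zeroˡ (a ∷ p) s p≈0 i = begin
    coeff ((a ∷ p) *ₚ s) i  ≈⟨ coeff-∷* a p s i ⟩
    a * coeff s i + coeff (shift (p *ₚ s)) i  ≈⟨ +-cong (trans (*-congʳ (p≈0 0)) (zeroˡ _)) (shift-zero i) ⟩
    0# + 0#  ≈⟨ +-identityˡ 0# ⟩
    0# ∎
    where
    shift-zero : ∀ i → coeff (shift (p *ₚ s)) i ≈ 0#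
    shift-zero zero    = refl
    shift-zero (suc i) = *ₚ-zeroˡ p s (p≈0 ∘ suc) i

  *ₚ-congˡ : ∀ p p′ s → p ≈ₚ p′ → p *ₚ s ≈ₚ p′ *ₚ s
  *ₚ-congˡ []      p′       s p≈p′ i = sym (*ₚ-zeroˡ p′ s (sym ∘ p≈p′) i)
  *ₚ-congˡ (a ∷ p) []       s p≈p′ i = *ₚ-zeroˡ (a ∷ p) s p≈p′ i
  *ₚ-congˡ (a ∷ p) (b ∷ p′) s p≈p′ i = begin
    coeff ((a ∷ p) *ₚ s) i  ≈⟨ coeff-∷* a p s i ⟩
    a * coeff s i + coeff (shift (p *ₚ s)) i  ≈⟨ +-cong (*-congʳ (p≈p′ 0)) (shift-cong (p *ₚ s) (p′ *ₚ s) (*ₚ-congˡ p p′ s (p≈p′ ∘ suc)) i) ⟩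
    b * coeff s i + coeff (shift (p′ *ₚ s)) i  ≈⟨ coeff-∷* b p′ s i ⟨
    coeff ((b ∷ p′) *ₚ s) i ∎

  *ₚ-distribʳ : ∀ s p p′ → (p +ₚ p′) *ₚ s ≈ₚ p *ₚ s +ₚ p′ *ₚ s
  *ₚ-distribʳ s []      p′       i = refl
  *ₚ-distribʳ s (a ∷ p) []       i = sym (trans (coeff-+ ((a ∷ p) *ₚ s) [] i) (+-identityʳ _))
  *ₚ-distribʳ s (a ∷ p) (b ∷ p′) i = begin
    coeff ((a + b ∷ p +ₚ p′) *ₚ s) i
      ≈⟨ coeff-∷* (a + b) (p +ₚ p′) s i ⟩
    (a + b) * coeff s i + coeff (shift ((p +ₚ p′) *ₚ s)) i
      ≈⟨ +-congˡ (trans (shift-cong ((p +ₚ p′) *ₚ s) (p *ₚ s +ₚ p′ *ₚ s) (*ₚ-distribʳ s p p′) i) (coeff-shift-+ (p *ₚ s) (p′ *ₚ s) i)) ⟩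
    (a + b) * coeff s i + (coeff (shift (p *ₚ s)) i + coeff (shift (p′ *ₚ s)) i)
      ≈⟨ solve 5 (λ a b s u v → (a :+ b) :* s :+ (u :+ v) := (a :* s :+ u) :+ (b :* s :+ v)) refl a b _ _ _ ⟩
    (a * coeff s i + coeff (shift (p *ₚ s)) i) + (b * coeff s i + coeff (shift (p′ *ₚ s)) i)
      ≈⟨ +-cong (coeff-∷* a p s i) (coeff-∷* b p′ s i) ⟨
    coeff ((a ∷ p) *ₚ s) i + coeff ((b ∷ p′) *ₚ s) i
      ≈⟨ coeff-+ ((a ∷ p) *ₚ s) ((b ∷ p′) *ₚ s) i ⟨
    coeff ((a ∷ p) *ₚ s +ₚ (b ∷ p′) *ₚ s) i ∎

  -- The product recurses on its first argument. This is the mirror image of `coeff-∷*` in the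
  -- second argument, from which commutativity follows.
  *ₚ-∷ʳ : ∀ p b s i → coeff (p *ₚ (b ∷ s)) i ≈ b * coeff p i + coeff (shift (p *ₚ s)) i
  *ₚ-∷ʳ []      b s zero    = sym (trans (+-identityʳ _) (zeroʳ b))
  *ₚ-∷ʳ []      b s (suc i) = sym (trans (+-identityʳ _) (zeroʳ b))
  *ₚ-∷ʳ (a ∷ p) b s zero    = +-congʳ (*-comm a b)
  *ₚ-∷ʳ (a ∷ p) b s (suc i) = begin
    coeff (map (a *_) s +ₚ p *ₚ (b ∷ s)) i
      ≈⟨ trans (coeff-+ (map (a *_) s) (p *ₚ (b ∷ s)) i) (+-cong (coeff-scale a s i) (*ₚ-∷ʳ p b s i)) ⟩
    a * coeff s i + (b * coeff p i + coeff (shift (p *ₚ s)) i)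
      ≈⟨ solve 3 (λ u v w → u :+ (v :+ w) := v :+ (u :+ w)) refl _ _ _ ⟩
    b * coeff p i + (a * coeff s i + coeff (shift (p *ₚ s)) i)
      ≈⟨ +-congˡ (coeff-∷* a p s i) ⟨
    b * coeff p i + coeff ((a ∷ p) *ₚ s) i ∎

  *ₚ-zeroʳ : ∀ p → p *ₚ [] ≈ₚ []
  *ₚ-zeroʳ []      i       = refl
  *ₚ-zeroʳ (a ∷ p) zero    = refl
  *ₚ-zeroʳ (a ∷ p) (suc i) = *ₚ-zeroʳ p i

  *ₚ-comm : ∀ p s → p *ₚ s ≈ₚ s *ₚ p
  *ₚ-comm []      s i = sym (*ₚ-zeroʳ s i)
  *ₚ-comm (a ∷ p) s i = begin
    coeff ((a ∷ p) *ₚ s) i  ≈⟨ coeff-∷* a p s i ⟩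
    a * coeff s i + coeff (shift (p *ₚ s)) i  ≈⟨ +-congˡ (shift-cong (p *ₚ s) (s *ₚ p) (*ₚ-comm p s) i) ⟩
    a * coeff s i + coeff (shift (s *ₚ p)) i  ≈⟨ *ₚ-∷ʳ s a p i ⟨
    coeff (s *ₚ (a ∷ p)) i ∎

  scale-*ₚ : ∀ a p s i → coeff (map (a *_) p *ₚ s) i ≈ a * coeff (p *ₚ s) i
  scale-*ₚ a []      s i = sym (zeroʳ a)
  scale-*ₚ a (b ∷ p) s i = begin
    coeff ((a * b ∷ map (a *_) p) *ₚ s) i
      ≈⟨ coeff-∷* (a * b) (map (a *_) p) s i ⟩
    a * b * coeff s i + coeff (shift (map (a *_) p *ₚ s)) i
      ≈⟨ +-cong (*-assoc _ _ _) (trans (shift-cong (map (a *_) p *ₚ s) (map (a *_) (p *ₚ s))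
           (λ j → trans (scale-*ₚ a p s j) (sym (coeff-scale a (p *ₚ s) j))) i) (coeff-shift-scale a (p *ₚ s) i)) ⟩
    a * (b * coeff s i) + a * coeff (shift (p *ₚ s)) i
      ≈⟨ distribˡ _ _ _ ⟨
    a * (b * coeff s i + coeff (shift (p *ₚ s)) i)
      ≈⟨ *-congˡ (coeff-∷* b p s i) ⟨
    a * coeff ((b ∷ p) *ₚ s) i ∎

  shift-*ₚ : ∀ p s → shift p *ₚ s ≈ₚ shift (p *ₚ s)
  shift-*ₚ p s i = trans (coeff-∷* 0# p s i) (trans (+-congʳ (zeroˡ _)) (+-identityˡ _))

  *ₚ-assoc : ∀ p s t → (p *ₚ s) *ₚ t ≈ₚ p *ₚ (s *ₚ t)
  *ₚ-assoc []      s t i = refl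
  *ₚ-assoc (a ∷ p) s t i = begin
    coeff ((map (a *_) s +ₚ shift (p *ₚ s)) *ₚ t) i
      ≈⟨ *ₚ-distribʳ t (map (a *_) s) (shift (p *ₚ s)) i ⟩
    coeff (map (a *_) s *ₚ t +ₚ shift (p *ₚ s) *ₚ t) i
      ≈⟨ coeff-+ (map (a *_) s *ₚ t) (shift (p *ₚ s) *ₚ t) i ⟩
    coeff (map (a *_) s *ₚ t) i + coeff (shift (p *ₚ s) *ₚ t) i
      ≈⟨ +-cong (scale-*ₚ a s t i) (shift-*ₚ (p *ₚ s) t i) ⟩
    a * coeff (s *ₚ t) i + coeff (shift ((p *ₚ s) *ₚ t)) i
      ≈⟨ +-congˡ (shift-cong ((p *ₚ s) *ₚ t) (p *ₚ (s *ₚ t)) (*ₚ-assoc p s t) i) ⟩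
    a * coeff (s *ₚ t) i + coeff (shift (p *ₚ (s *ₚ t))) i
      ≈⟨ coeff-∷* a p (s *ₚ t) i ⟨
    coeff ((a ∷ p) *ₚ (s *ₚ t)) i ∎

  *ₚ-identityˡ : ∀ p → 1ₚ *ₚ p ≈ₚ p
  *ₚ-identityˡ p i = begin
    coeff (1ₚ *ₚ p) i  ≈⟨ coeff-∷* 1# [] p i ⟩
    1# * coeff p i + coeff (shift []) i ≈⟨ +-cong (*-identityˡ _) (shift-[] i) ⟩
    coeff p i + 0#  ≈⟨ +-identityʳ _ ⟩
    coeff p i ∎
    where
    shift-[] : ∀ i → coeff (shift []) i ≈ 0#
    shift-[] zero    = refl
    shift-[] (suc i) = refl

  const-*ₚ : ∀ a b → const (a * b) ≈ₚ const a *ₚ const b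
  const-*ₚ a b zero    = sym (+-identityʳ _)
  const-*ₚ a b (suc i) = refl

  -- The operations are those of the statement, so that identities proved over a general commutative
  -- ring specialize to it by unfolding.
  polynomialRing : CommutativeRing c ℓ
  polynomialRing = record
    { Carrier = Poly
    ; _≈_     = _≈ₚ_
    ; _+_     = _+ₚ_
    ; _*_     = _*ₚ_
    ; -_      = -ₚ_
    ; 0#      = 0ₚ
    ; 1#      = 1ₚ
    ; isCommutativeRing = record
      { isRing = record
        { +-isAbelianGroup = record
          { isGroup = record
            { isMonoid = record
              { isSemigroup = record
                { isMagma = record
                  { isEquivalence = record
                    { refl  = λ i → refl
                    ; sym   = λ p≈s i → sym (p≈s i)
                    ; trans = λ p≈s s≈t i → trans (p≈s i) (s≈t i)
                    }
                  ; ∙-cong = λ {p} {p′} {s} {s′} → +ₚ-cong p p′ s s′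
                  }
                ; assoc = λ p s t i → begin
                    coeff ((p +ₚ s) +ₚ t) i  ≈⟨ trans (coeff-+ (p +ₚ s) t i) (+-congʳ (coeff-+ p s i)) ⟩
                    (coeff p i + coeff s i) + coeff t i  ≈⟨ +-assoc _ _ _ ⟩
                    coeff p i + (coeff s i + coeff t i)  ≈⟨ trans (coeff-+ p (s +ₚ t) i) (+-congˡ (coeff-+ s t i)) ⟨
                    coeff (p +ₚ (s +ₚ t)) i ∎
                }
              ; identity = (λ p i → refl) , (λ p i → trans (coeff-+ p [] i) (+-identityʳ _))
              }
            ; inverse = (λ p i → trans (coeff-+ (-ₚ p) p i) (trans (+-congʳ (coeff-neg p i)) (-‿inverseˡ _)))
                      , (λ p i → trans (coeff-+ p (-ₚ p) i) (trans (+-congˡ (coeff-neg p i)) (-‿inverseʳ _)))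
            ; ⁻¹-cong = λ {p} {s} p≈s i → trans (coeff-neg p i) (trans (-‿cong (p≈s i)) (sym (coeff-neg s i)))
            }
          ; comm = λ p s i → trans (coeff-+ p s i) (trans (+-comm _ _) (sym (coeff-+ s p i)))
          }
        ; *-cong     = λ {p} {p′} {s} {s′} p≈ s≈ i → trans (*ₚ-congˡ p p′ s p≈ i) (*ₚ-congʳ p′ s s′ s≈ i)
        ; *-assoc    = *ₚ-assoc
        ; *-identity = *ₚ-identityˡ , (λ p i → trans (*ₚ-comm p 1ₚ i) (*ₚ-identityˡ p i))
        ; distrib    = (λ p s t i → trans (*ₚ-comm p (s +ₚ t) i) (trans (*ₚ-distribʳ p s t i)
                         (+ₚ-cong (s *ₚ p) (p *ₚ s) (t *ₚ p) (p *ₚ t) (*ₚ-comm s p) (*ₚ-comm t p) i)))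
                     , *ₚ-distribʳ
        }
      ; *-comm = *ₚ-comm
      }
    }

-- Parity and the translation of ranges

double-parity : ∀ m → (parity m ≡ 0ℙ × ∃ λ g → m ≡ g ℕ.+ g) ⊎ (parity m ≡ 1ℙ × ∃ λ g → m ≡ suc (g ℕ.+ g))
double-parity zero          = inj₁ (≡.refl , 0 , ≡.refl)
double-parity (suc zero)    = inj₂ (≡.refl , 0 , ≡.refl)
double-parity (suc (suc m)) = Sum.map
  (λ (p , g , eq) → p , suc g , cong suc (≡.trans (cong suc eq) (≡.sym (ℕ.+-suc g g))))
  (λ (p , g , eq) → p , suc g , cong suc (cong suc (≡.trans eq (≡.sym (ℕ.+-suc g g)))))
  (double-parity m)

even⇒double : ∀ {m} → parity m ≡ 0ℙ → ∃ λ g → m ≡ g ℕ.+ g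
even⇒double {m} p with double-parity m
... | inj₁ (_ , d) = d
... | inj₂ (p′ , _) = contradiction (≡.trans (≡.sym p) p′) λ ()

odd⇒double : ∀ {m} → parity m ≡ 1ℙ → ∃ λ g → m ≡ suc (g ℕ.+ g)
odd⇒double {m} p with double-parity m
... | inj₂ (_ , d) = d
... | inj₁ (p′ , _) = contradiction (≡.trans (≡.sym p) p′) λ ()

parity-cancelʳ : ∀ m k {p} → parity (m ℕ.+ k) ≡ p → parity m ≡ p ℙ.+ parity k
parity-cancelʳ m k eq = cancel (parity m) (parity k) (≡.trans (≡.sym (ℙ.+-homo-+ m k)) eq)
  where
  cancel : ∀ p s {t} → p ℙ.+ s ≡ t → p ≡ t ℙ.+ s
  cancel 0ℙ 0ℙ ≡.refl = ≡.refl
  cancel 0ℙ 1ℙ ≡.refl = ≡.refl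
  cancel 1ℙ 0ℙ ≡.refl = ≡.refl
  cancel 1ℙ 1ℙ ≡.refl = ≡.refl

even-gap : ∀ {b n} → b ≤ n → parity b ≡ parity n → ∃ λ h → n ≡ b ℕ.+ (h ℕ.+ h)
even-gap {b} {n} b≤n eq with h , eq′ ← even⇒double {n ∸ b} (≡.trans (parity-cancelʳ (n ∸ b) b (cong parity (ℕ.m∸n+n≡m b≤n)))
                                           (≡.trans (cong (parity n ℙ.+_) eq) (ℙ.p+p≡0ℙ (parity n)))) =
  h , ≡.trans (≡.sym (ℕ.m+[n∸m]≡n b≤n)) (cong (b ℕ.+_) eq′)

range-ascending : ∀ {a m c d} → c ≡ a → suc d ∸ c ≡ m → uncolored (range c d) ≡ ascending a m
range-ascending {a} {m} ≡.refl eq = ≡.trans (cong (λ l → uncolored (applyUpTo (a ℕ.+_) l)) eq) (uncolored-applyUpTo a m)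

-- The two totals as products of q-integers

module Totals {c ℓ} (A : CommutativeRing c ℓ) (x : CommutativeRing.Carrier A) (r′ n : ℕ) where
  open CommutativeRing A
  open Exp commutativeSemiring
  open AbelianGroupProperties +-abelianGroup using (⁻¹-involutive)
  open IntegerCoefficients A
  open Sums A

  private
    r = suc r′

  open Statistic A x r
  open Containment A x r n
  open Evaluate A x r n
  open SetoidReasoning setoid

  ∏ : List ℕ → (ℕ → Carrier) → Carrier
  ∏ xs f = foldr _*_ 1# (map f xs)

  factor : ℕ → Carrier
  factor i = [ i ℕ.* r ]⟪ sgn (i ∸ 1) * x ⟫

  -- `qint-pair` attaches sgn (m + 2) to the first factor where `factor` has sgn m; the two sign
  -- changes cancel.
  pairFactor-∏ : ∀ m → pairFactor m ≈ factor (suc m) * factor (suc (suc m))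
  pairFactor-∏ m = trans (qint-pair r (suc m) x) (*-congʳ (qint-cong (suc m ℕ.* r) (*-congʳ
    (trans (sgn-suc (suc m)) (trans (-‿cong (sgn-suc m)) (⁻¹-involutive _))))))

  pairFactors-∏ : ∀ t m → pairFactors t m ≈ ∏ (applyUpTo (suc m ℕ.+_) (t ℕ.+ t)) factor
  pairFactors-∏ zero    m = refl
  pairFactors-∏ (suc t) m = begin
    pairFactor m * pairFactors t (suc (suc m))
      ≈⟨ *-cong (pairFactor-∏ m) (pairFactors-∏ t (suc (suc m))) ⟩
    (factor (suc m) * factor (suc (suc m))) * ∏ (applyUpTo (suc (suc (suc m)) ℕ.+_) (t ℕ.+ t)) factor
      ≈⟨ *-assoc _ _ _ ⟩
    ∏ (suc m ∷ suc (suc m) ∷ applyUpTo (suc (suc (suc m)) ℕ.+_) (t ℕ.+ t)) factor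
      ≡⟨ cong (λ l → ∏ l factor) (≡.trans
           (cong₂ (λ i j → i ∷ j ∷ applyUpTo (suc (suc (suc m)) ℕ.+_) (t ℕ.+ t)) (≡.sym (ℕ.+-identityʳ (suc m))) (≡.sym (ℕ.+-comm (suc m) 1)))
           (cong (λ l → suc m ℕ.+ 0 ∷ suc m ℕ.+ 1 ∷ l) (applyUpTo-cong (t ℕ.+ t) (λ i → ≡.sym (≡.trans (ℕ.+-suc (suc m) (suc i)) (cong suc (ℕ.+-suc (suc m) i))))))) ⟩
    ∏ (applyUpTo (suc m ℕ.+_) (suc (suc (t ℕ.+ t)))) factor
      ≡⟨ cong (λ l → ∏ (applyUpTo (suc m ℕ.+_) (suc l)) factor) (ℕ.+-suc t t) ⟨
    ∏ (applyUpTo (suc m ℕ.+_) (suc t ℕ.+ suc t)) factor ∎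

  pairFactors-range : ∀ t m {c} → c ≡ suc m → n ≡ m ℕ.+ (t ℕ.+ t) → pairFactors t m ≈ ∏ (range c n) factor
  pairFactors-range t m ≡.refl n≡ = trans (pairFactors-∏ t m)
    (reflexive (cong (λ l → ∏ (applyUpTo (suc m ℕ.+_) l) factor) (≡.sym (≡.trans (cong (_∸ m) n≡) (ℕ.m+n∸m≡n m (t ℕ.+ t))))))

  -- The case r = 1 of `qint-pair`. At y = X it accounts for the q-integers of k + 1 and k + 2, and
  -- at y = x with m = r - 1 for the two q-integers in f.
  P-factor : ∀ m y → P m y ≈ [ m ]⟪ sgn (suc m) * y ⟫ * [ suc m ]⟪ sgn m * y ⟫
  P-factor m y = begin
    P m y  ≈⟨ *-identityˡ _ ⟨
    1# * P m y  ≈⟨ *-cong (+-identityʳ 1#) (P-cong m (*-identityʳ y)) ⟨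
    [ 1 ]⟪ y * y ⟫ * P m (y ^ 1)  ≈⟨ qint-pair 1 m y ⟩
    [ m ℕ.* 1 ]⟪ sgn (suc m) * y ⟫ * [ suc m ℕ.* 1 ]⟪ sgn m * y ⟫  ≡⟨ cong₂ (λ i j → [ i ]⟪ sgn (suc m) * y ⟫ * [ j ]⟪ sgn m * y ⟫) (ℕ.*-identityʳ m) (ℕ.*-identityʳ (suc m)) ⟩
    [ m ]⟪ sgn (suc m) * y ⟫ * [ suc m ]⟪ sgn m * y ⟫ ∎

  sgn-even : ∀ {k} → parity k ≡ 0ℙ → sgn k ≈ 1#
  sgn-even {k} p with g , ≡.refl ← even⇒double {k} p = trans (^-homo-* (- 1#) g g) (sgn² g)

  sgn-odd : ∀ {k} → parity k ≡ 1ℙ → sgn k ≈ - 1#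
  sgn-odd {k} p with g , ≡.refl ← odd⇒double {k} p = trans (sgn-suc (g ℕ.+ g)) (-‿cong (trans (^-homo-* (- 1#) g g) (sgn² g)))

  P-odd : ∀ {k} y → sgn k ≈ - 1# → P (suc k) y ≈ [ suc k ]⟪ - y ⟫ * [ suc (suc k) ]⟪ y ⟫
  P-odd {k} y s = trans (P-factor (suc k) y) (*-cong
    (qint-cong (suc k) (trans (*-congʳ (trans (sgn-suc (suc k)) (trans (-‿cong (sgn-suc k)) (trans (⁻¹-involutive _) s)))) (solve 1 (λ y → (:- 1ᵖ) :* y := :- y) refl y)))
    (qint-cong (suc (suc k)) (trans (*-congʳ (trans (sgn-suc k) (-‿cong s))) (solve 1 (λ y → (:- (:- 1ᵖ)) :* y := y) refl y))))

  P-even : ∀ {k} y → sgn k ≈ 1# → P (suc k) y ≈ [ suc k ]⟪ y ⟫ * [ suc (suc k) ]⟪ - y ⟫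
  P-even {k} y s = trans (P-factor (suc k) y) (*-cong
    (qint-cong (suc k) (trans (*-congʳ (trans (sgn-suc (suc k)) (trans (-‿cong (sgn-suc k)) (trans (⁻¹-involutive _) s)))) (*-identityˡ y)))
    (qint-cong (suc (suc k)) (trans (*-congʳ (trans (sgn-suc k) (-‿cong s))) (solve 1 (λ y → (:- 1ᵖ) :* y := :- y) refl y))))

  module _ (a k : ℕ) (1≤a : 1 ≤ a) (a+k≤n : a ℕ.+ k ≤ n) where
    open Sides a k

    private
      I = ascending a (suc k)

    -- For odd k, `Uᶻ-uncolored` says that `Uᶻ 0` and `Vᶻ 0` agree, as the increasing word drops
    -- out, whereas the sums with nonzero color are opposite.
    total-odd : sgn k ≈ - 1# → S U + S V ≈ (1# + 1#) * Vᶻ 0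
    total-odd s = begin
      S U + S V
        ≈⟨ +-cong (S-U a k 1≤a a+k≤n) (S-V a k 1≤a a+k≤n) ⟩
      (Uᶻ 0 + ∑< r′ (Uᶻ ∘ suc)) + (Vᶻ 0 + ∑< r′ (Vᶻ ∘ suc))
        ≈⟨ +-congʳ (+-cong U₀≈V₀ (trans (∑<-cong r′ (λ _ → trans (Uᶻ-colored a k 1≤a a+k≤n (λ ())) (*-congʳ s))) (∑<-*ˡ r′ _ _))) ⟩
      (Vᶻ 0 + - 1# * ∑< r′ (Vᶻ ∘ suc)) + (Vᶻ 0 + ∑< r′ (Vᶻ ∘ suc))
        ≈⟨ solve 2 (λ v w → (v :+ (:- 1ᵖ) :* w) :+ (v :+ w) := (1ᵖ :+ 1ᵖ) :* v) refl _ _ ⟩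
      (1# + 1#) * Vᶻ 0 ∎
      where
      U₀≈V₀ : Uᶻ 0 ≈ Vᶻ 0
      U₀≈V₀ = begin
        Uᶻ 0  ≈⟨ solve 2 (λ u i → u := (u :- i) :+ i) refl _ (S I) ⟩
        (Uᶻ 0 - S I) + S I  ≈⟨ +-congʳ (trans (Uᶻ-uncolored a k 1≤a a+k≤n) (*-congʳ s)) ⟩
        - 1# * (S I - Vᶻ 0) + S I  ≈⟨ solve 2 (λ v i → (:- 1ᵖ) :* (i :- v) :+ i := v) refl _ (S I) ⟩
        Vᶻ 0 ∎

    -- `D` and `D′` stand for the sums over the set differences. Taking `S I` away from both sides
    -- leaves `Uᶻ 0 - S I` and `Vᶻ 0 - S I`, which are opposite for even k, whereas the sums with
    -- nonzero color agree.
    total-even : sgn k ≈ 1# → ∀ {D D′} → D + S I ≈ S U → D′ + S I ≈ S V → D + D′ ≈ (1# + 1#) * ∑< r′ (Vᶻ ∘ suc)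
    total-even s {D} {D′} D≈ D′≈ = begin
      D + D′
        ≈⟨ solve 3 (λ d d′ i → d :+ d′ := (d :+ i) :+ (d′ :+ i) :- (i :+ i)) refl D D′ (S I) ⟩
      (D + S I) + (D′ + S I) - (S I + S I)
        ≈⟨ +-congʳ (+-cong (trans D≈ (S-U a k 1≤a a+k≤n)) (trans D′≈ (S-V a k 1≤a a+k≤n))) ⟩
      (Uᶻ 0 + ∑< r′ (Uᶻ ∘ suc)) + (Vᶻ 0 + ∑< r′ (Vᶻ ∘ suc)) - (S I + S I)
        ≈⟨ +-congʳ (+-congʳ (+-congˡ (∑<-cong r′ (λ _ → trans (Uᶻ-colored a k 1≤a a+k≤n (λ ())) (trans (*-congʳ s) (*-identityˡ _)))))) ⟩
      (Uᶻ 0 + w) + (Vᶻ 0 + w) - (S I + S I)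
        ≈⟨ solve 4 (λ u v w i → (u :+ w) :+ (v :+ w) :- (i :+ i) := (u :- i) :+ (v :- i) :+ (w :+ w)) refl _ _ w (S I) ⟩
      (Uᶻ 0 - S I) + (Vᶻ 0 - S I) + (w + w)
        ≈⟨ +-congʳ (+-congʳ (trans (Uᶻ-uncolored a k 1≤a a+k≤n) (*-congʳ s))) ⟩
      1# * (S I - Vᶻ 0) + (Vᶻ 0 - S I) + (w + w)
        ≈⟨ solve 3 (λ v w i → 1ᵖ :* (i :- v) :+ (v :- i) :+ (w :+ w) := (1ᵖ :+ 1ᵖ) :* w) refl _ w (S I) ⟩
      (1# + 1#) * w ∎
      where
      w = ∑< r′ (Vᶻ ∘ suc)

  module _ (k g h : ℕ) (n≡ : n ≡ g ℕ.+ g ℕ.+ (suc k ℕ.+ (h ℕ.+ h))) where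
    private
      a = suc (g ℕ.+ g)
      Π = pairFactors (g ℕ.+ h) (suc k)
    open Sides a k

    V₀-even : Vᶻ 0 ≈ [ suc k ]⟪ - X ⟫ * Π
    V₀-even = trans (Vᶻ-even a k g h ≡.refl n≡ z<s) (*-congʳ (*-identityʳ _))

    -- Leaving out color 0 removes the constant term of [r] at x.
    V₊-even : ∑< r′ (Vᶻ ∘ suc) ≈ [ suc k ]⟪ - X ⟫ * ([ r ]⟪ x ⟫ + - 1#) * Π
    V₊-even = begin
      ∑< r′ (Vᶻ ∘ suc)  ≈⟨ ∑<-cong r′ (λ {z} z<r′ → Vᶻ-even a k g h ≡.refl n≡ (s<s z<r′)) ⟩
      ∑< r′ (λ z → ([ suc k ]⟪ - X ⟫ * x ^ suc z) * Π)  ≈⟨ trans (∑<-*ʳ r′ Π _) (*-congʳ (∑<-*ˡ r′ _ _)) ⟩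
      [ suc k ]⟪ - X ⟫ * ∑< r′ (λ z → x ^ suc z) * Π  ≈⟨ *-congʳ (*-congˡ (solve 1 (λ s → s := (1ᵖ :+ s) :- 1ᵖ) refl _)) ⟩
      [ suc k ]⟪ - X ⟫ * (∑< r (x ^_) - 1#) * Π  ≈⟨ *-congʳ (*-congˡ (+-congʳ (qint r x))) ⟨
      [ suc k ]⟪ - X ⟫ * ([ r ]⟪ x ⟫ + - 1#) * Π ∎

  module _ (k g h : ℕ) (n≡ : n ≡ g ℕ.+ g ℕ.+ (suc (suc k) ℕ.+ (h ℕ.+ h))) where
    private
      p = suc (g ℕ.+ g)
      Π = pairFactors (g ℕ.+ h) (suc (suc k))
    open Sides (suc p) k

    V₀-odd : Vᶻ 0 ≈ P (suc k) X * [ r ]⟪ x ⟫ * Π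
    V₀-odd = begin
      Vᶻ 0  ≈⟨ Vᶻ-odd p k g h ≡.refl n≡ z<s ⟩
      ∑< r (λ y → insertPair p y 0 V) * Π  ≈⟨ *-congʳ (∑<-cong r (λ {y} _ → insertPair-uncolored p k y)) ⟩
      ∑< r (λ y → x ^ y * P (suc k) X) * Π  ≈⟨ *-congʳ (trans (∑<-*ʳ r (P (suc k) X) (x ^_)) (trans (*-comm _ _) (*-congˡ (sym (qint r x))))) ⟩
      P (suc k) X * [ r ]⟪ x ⟫ * Π ∎

    -- Exchanging the colors y and z changes the sign, so that only y = z and y = 0 contribute.
    V₊-odd : ∑< r′ (Vᶻ ∘ suc) ≈ (- x * P r′ x) * P (suc k) X * Π
    V₊-odd = begin
      ∑< r′ (Vᶻ ∘ suc)
        ≈⟨ ∑<-cong r′ (λ {z} z<r′ → Vᶻ-odd p k g h ≡.refl n≡ (s<s z<r′)) ⟩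
      ∑< r′ (λ z → ∑< r (λ y → B y (suc z)) * Π)
        ≈⟨ trans (∑<-*ʳ r′ Π _) (*-congʳ (∑<-+ r′ _ _)) ⟩
      (∑< r′ (λ z → B 0 (suc z)) + ∑< r′ (λ z → ∑< r′ (λ y → B (suc y) (suc z)))) * Π
        ≈⟨ *-congʳ (+-cong (∑<-cong r′ (λ {z} _ → B₀ z)) (trans (∑<-antisym r′ (λ z y → B (suc y) (suc z))
             (λ i≢j → insertPair-distinct (V-unique p k) (V-free p k) (i≢j ∘ ≡.sym ∘ ℕ.suc-injective)))
             (∑<-cong r′ (λ {z} _ → insertPair-equal-V p k (suc z))))) ⟩
      (∑< r′ (λ z → - (x ^ suc z) * Q) + ∑< r′ (λ z → (x * x) ^ suc z * Q)) * Π
        ≈⟨ *-congʳ (trans (sym (∑<-+ r′ _ _)) (∑<-cong r′ (λ {z} _ → combine z))) ⟩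
      ∑< r′ (λ z → (- x) * (x ^ z * (1# - x ^ suc z)) * Q) * Π
        ≈⟨ *-congʳ (trans (∑<-*ʳ r′ Q _) (*-congʳ (∑<-*ˡ r′ (- x) _))) ⟩
      (- x * P r′ x) * Q * Π ∎
      where
      Q = P (suc k) X
      B = λ y z → insertPair p y z V
      -- `insertPair-uncolored` requires color 0 on `suc p`, but here `p` has it; exchanging the
      -- colors costs a sign.
      B₀ : ∀ z → B 0 (suc z) ≈ - (x ^ suc z) * Q
      B₀ z = begin
        B 0 (suc z)  ≈⟨ solve 2 (λ b b′ → b := (b :+ b′) :- b′) refl _ (B (suc z) 0) ⟩
        (B 0 (suc z) + B (suc z) 0) - B (suc z) 0  ≈⟨ +-cong (insertPair-distinct (V-unique p k) (V-free p k) (λ ())) (-‿cong (insertPair-uncolored p k (suc z))) ⟩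
        0# - x ^ suc z * Q  ≈⟨ solve 2 (λ y q → con ℤ.0ℤ :- y :* q := (:- y) :* q) refl _ Q ⟩
        - (x ^ suc z) * Q ∎
      -- Extracting - x leaves the summand of `P r′ x`, which `P-factor` later turns into the
      -- q-integers of f.
      combine : ∀ z → - (x ^ suc z) * Q + (x * x) ^ suc z * Q ≈ (- x) * (x ^ z * (1# - x ^ suc z)) * Q
      combine z = trans (+-congˡ (*-congʳ (^-distrib-* x x (suc z))))
        (solve 3 (λ x y q → (:- (x :* y)) :* q :+ (x :* y) :* (x :* y) :* q := (:- x) :* (y :* (1ᵖ :- x :* y)) :* q) refl x (x ^ z) Q)

  module _ (a k : ℕ) where
    private
      -- The length is at least two, so that the two words share a letter, as `⊆-overlap` demands.
      U = ascending a (suc (suc k))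
      V = ascending (suc a) (suc (suc k))
      I = ascending a (suc (suc (suc k)))
      U⊆I : U ⊆ I
      U⊆I = subst (U ⊆_) (≡.sym (ascending-∷ʳ a (suc (suc k)))) (⊆.++⁺ʳ _ ⊆-refl)
      V⊆I : V ⊆ I
      V⊆I = _ ∷⊆ ⊆-refl
      join : ∀ {π} → Unique π → U ⊆ π → V ⊆ π → I ⊆ π
      join {π} uq U⊆ V⊆ = subst (λ w → (a , 0) ∷ w ⊆ π) (≡.sym V≡) (⊆-overlap uq U⊆ (subst (_⊆ π) V≡ V⊆))
        where
        V≡ : V ≡ ((suc a , 0) ∷ ascending (suc (suc a)) k) ++ (suc a ℕ.+ suc k , 0) ∷ []
        V≡ = ascending-∷ʳ (suc a) (suc k)

    S-U∖V : ∑ G⟨ r , n ⟩[ U ∖ V ] T + S I ≈ S U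
    S-U∖V = S-∖ join U⊆I V⊆I

    S-V∖U : ∑ G⟨ r , n ⟩[ V ∖ U ] T + S I ≈ S V
    S-V∖U = S-∖ (λ uq V⊆ U⊆ → join uq U⊆ V⊆) V⊆I U⊆I

-- The four identities over a commutative ring

open CommutativeSemigroupProperties ℕ.+-commutativeSemigroup using ()
  renaming (interchange to ℕ-interchange; x∙yz≈y∙xz to ℕ-exchange)

carry-suc : ∀ a b c → suc a ℕ.+ b ℕ.+ c ≡ a ℕ.+ (suc b ℕ.+ c)
carry-suc a b c = ≡.trans (cong suc (ℕ.+-assoc a b c)) (≡.sym (ℕ.+-suc a (b ℕ.+ c)))

-- Here w stands for the constant ζ^h.
module Identities {c ℓ} (A : CommutativeRing c ℓ) (w q : CommutativeRing.Carrier A) (r′ n : ℕ)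
                  (w^r≈1 : CommutativeRing._≈_ A (Exp._^_ (CommutativeRing.commutativeSemiring A) w (suc r′)) (CommutativeRing.1# A)) where
  open CommutativeRing A
  open Exp commutativeSemiring
  open IntegerCoefficients A
  open Sums A

  private
    r = suc r′
    x = w * q

  open Statistic A x r
  open Containment A x r n
  open Evaluate A x r n
  open Totals A x r′ n
  open SetoidReasoning setoid

  X≈q^r : X ≈ q ^ r
  X≈q^r = trans (^-distrib-* w q r) (trans (*-congʳ w^r≈1) (*-identityˡ _))

  monomial≈T : ∀ π {a} → a ≈ sgn (inv (map ∣_∣ π)) * w ^ col π → a * q ^ fmaj r π ≈ T π
  monomial≈T π {a} a≈ = begin
    a * q ^ fmaj r π  ≈⟨ *-cong a≈ (trans (^-homo-* q (r ℕ.* majF π) (col π)) (*-congʳ (sym (^-assocʳ q r (majF π))))) ⟩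
    (s * w ^ col π) * ((q ^ r) ^ majF π * q ^ col π)
      ≈⟨ solve 4 (λ s w m c → (s :* w) :* (m :* c) := s :* (m :* (w :* c))) refl s _ _ _ ⟩
    s * ((q ^ r) ^ majF π * (w ^ col π * q ^ col π))
      ≈⟨ *-congˡ (*-cong (^-congˡ (majF π) X≈q^r) (^-distrib-* w q (col π))) ⟨
    s * (X ^ majF π * x ^ col π)  ≈⟨ T-factor π ⟨
    T π ∎
    where
    s = sgn (inv (map ∣_∣ π))

  -- With `term` as a parameter the sums can keep the summands of the statement and are compared
  -- with `T` term by term.
  module Sums± (term : Word → Carrier) (term≈T : ∀ π → term π ≈ T π)
           (k b : ℕ) (1≤k : 1 ≤ k) (k+1≤b : k ℕ.+ 1 ≤ b) (b≤n : b ≤ n) (b~n : parity b ≡ parity n) where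

    private
      a = b ∸ k
      U = uncolored (range (b ∸ k) (b ∸ 1))
      V = uncolored (range (b ∸ k ℕ.+ 1) b)
      2# = 1# + 1#

      U+V     = ∑ G⟨ r , n ⟩[ U ] term + ∑ G⟨ r , n ⟩[ V ] term
      U∖V+V∖U = ∑ G⟨ r , n ⟩[ U ∖ V ] term + ∑ G⟨ r , n ⟩[ V ∖ U ] term

      k<b : k < b
      k<b = subst (_≤ b) (ℕ.+-comm k 1) k+1≤b

      k≤b : k ≤ b
      k≤b = ℕ.<⇒≤ k<b

      1≤a : 1 ≤ a
      1≤a = ℕ.m<n⇒0<n∸m k<b

      a+k≡b : a ℕ.+ k ≡ b
      a+k≡b = ℕ.m∸n+n≡m k≤b

      a+k≤n : a ℕ.+ k ≤ n
      a+k≤n = subst (_≤ n) (≡.sym a+k≡b) b≤n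

      U≡ : U ≡ ascending a k
      U≡ = range-ascending ≡.refl (≡.trans (cong (_∸ a) (ℕ.m+[n∸m]≡n (ℕ.≤-trans 1≤k k≤b))) (ℕ.m∸[m∸n]≡n k≤b))

      V≡ : V ≡ ascending (suc a) k
      V≡ = range-ascending (ℕ.+-comm a 1) (≡.trans (cong (suc b ∸_) (ℕ.+-comm a 1)) (ℕ.m∸[m∸n]≡n k≤b))

      ∑-term : ∀ πs → ∑ πs term ≈ ∑ πs T
      ∑-term πs = ∑-cong πs (λ {π} _ → term≈T π)

      ∑-U : ∑ G⟨ r , n ⟩[ U ] term ≈ S (ascending a k)
      ∑-U = trans (∑-term G⟨ r , n ⟩[ U ]) (reflexive (cong S U≡))

      ∑-V : ∑ G⟨ r , n ⟩[ V ] term ≈ S (ascending (suc a) k)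
      ∑-V = trans (∑-term G⟨ r , n ⟩[ V ]) (reflexive (cong S V≡))

      parity-a : parity a ≡ parity n ℙ.+ parity k
      parity-a = ≡.trans (parity-cancelʳ a k (cong parity a+k≡b)) (cong (ℙ._+ parity k) b~n)

      gap = even-gap b≤n b~n
      h = proj₁ gap

      n≡a+k+2h : n ≡ a ℕ.+ k ℕ.+ (h ℕ.+ h)
      n≡a+k+2h = ≡.trans (proj₂ gap) (cong (ℕ._+ (h ℕ.+ h)) (≡.sym a+k≡b))

      n-odd-a : ∀ {g} → a ≡ suc (g ℕ.+ g) → n ≡ g ℕ.+ g ℕ.+ (suc k ℕ.+ (h ℕ.+ h))
      n-odd-a {g} eq = ≡.trans n≡a+k+2h (≡.trans (cong (λ a → a ℕ.+ k ℕ.+ (h ℕ.+ h)) eq) (carry-suc (g ℕ.+ g) k (h ℕ.+ h)))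

      n-even-a : ∀ {g} → a ≡ suc (suc (g ℕ.+ g)) → n ≡ g ℕ.+ g ℕ.+ (suc (suc k) ℕ.+ (h ℕ.+ h))
      n-even-a {g} eq = ≡.trans n≡a+k+2h (≡.trans (cong (λ a → a ℕ.+ k ℕ.+ (h ℕ.+ h)) eq)
        (≡.trans (cong suc (carry-suc (g ℕ.+ g) k (h ℕ.+ h))) (≡.sym (ℕ.+-suc (g ℕ.+ g) _))))

      n-factors : ∀ g m → n ≡ g ℕ.+ g ℕ.+ (m ℕ.+ (h ℕ.+ h)) → n ≡ m ℕ.+ ((g ℕ.+ h) ℕ.+ (g ℕ.+ h))
      n-factors g m eq = ≡.trans eq (≡.trans (ℕ-exchange (g ℕ.+ g) m (h ℕ.+ h)) (cong (m ℕ.+_) (ℕ-interchange g g h h)))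

      even-a : parity a ≡ 0ℙ → ∃ λ g → a ≡ suc (suc (g ℕ.+ g))
      even-a p with even⇒double {a} p
      ... | zero  , eq = contradiction (subst (1 ≤_) eq 1≤a) λ ()
      ... | suc g , eq = g , ≡.trans eq (cong suc (ℕ.+-suc g g))

      qint-k+1 : ∀ {y y′} → y ≈ y′ → [ suc k ]⟪ y ⟫ ≈ [ k ℕ.+ 1 ]⟪ y′ ⟫
      qint-k+1 {y′ = y′} y≈y′ = trans (qint-cong (suc k) y≈y′) (reflexive (cong [_]⟪ y′ ⟫ (ℕ.+-comm 1 k)))

      qint-k+2 : ∀ {y y′} → y ≈ y′ → [ suc (suc k) ]⟪ y ⟫ ≈ [ k ℕ.+ 2 ]⟪ y′ ⟫
      qint-k+2 {y′ = y′} y≈y′ = trans (qint-cong (suc (suc k)) y≈y′) (reflexive (cong [_]⟪ y′ ⟫ (ℕ.+-comm 2 k)))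

      -X≈ : - X ≈ - (q ^ r)
      -X≈ = -‿cong X≈q^r

    odd-even : parity k ≡ 1ℙ → parity n ≡ 0ℙ →
      U+V ≈
      2# * [ k ℕ.+ 1 ]⟪ - (q ^ r) ⟫ * ∏ (range (k ℕ.+ 2) n) factor
    odd-even k-odd n-even
      with g , a≡ ← odd⇒double {a} (≡.trans parity-a (cong₂ ℙ._+_ n-even k-odd))
      with n≡ ← n-odd-a {g} a≡ = begin
      U+V
        ≈⟨ +-cong ∑-U ∑-V ⟩
      S (ascending a k) + S (ascending (suc a) k)
        ≈⟨ total-odd a k 1≤a a+k≤n (sgn-odd {k} k-odd) ⟩
      2# * Sides.Vᶻ a k 0
        ≡⟨ cong (λ a → 2# * Sides.Vᶻ a k 0) a≡ ⟩
      2# * Sides.Vᶻ (suc (g ℕ.+ g)) k 0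
        ≈⟨ *-congˡ (V₀-even k g h n≡) ⟩
      2# * ([ suc k ]⟪ - X ⟫ * pairFactors (g ℕ.+ h) (suc k))
        ≈⟨ *-congˡ (*-cong (qint-k+1 -X≈) (pairFactors-range (g ℕ.+ h) (suc k) (ℕ.+-comm k 2) (n-factors g (suc k) n≡))) ⟩
      2# * ([ k ℕ.+ 1 ]⟪ - (q ^ r) ⟫ * ∏ (range (k ℕ.+ 2) n) factor)
        ≈⟨ *-assoc _ _ _ ⟨
      2# * [ k ℕ.+ 1 ]⟪ - (q ^ r) ⟫ * ∏ (range (k ℕ.+ 2) n) factor ∎

    odd-odd : parity k ≡ 1ℙ → parity n ≡ 1ℙ →
      U+V ≈
      2# * [ k ℕ.+ 1 ]⟪ - (q ^ r) ⟫ * [ k ℕ.+ 2 ]⟪ q ^ r ⟫ * [ r ]⟪ x ⟫ * ∏ (range (k ℕ.+ 3) n) factor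
    odd-odd k-odd n-odd
      with g , a≡ ← even-a (≡.trans parity-a (cong₂ ℙ._+_ n-odd k-odd))
      with n≡ ← n-even-a {g} a≡ = begin
      U+V
        ≈⟨ +-cong ∑-U ∑-V ⟩
      S (ascending a k) + S (ascending (suc a) k)
        ≈⟨ total-odd a k 1≤a a+k≤n (sgn-odd {k} k-odd) ⟩
      2# * Sides.Vᶻ a k 0
        ≡⟨ cong (λ a → 2# * Sides.Vᶻ a k 0) a≡ ⟩
      2# * Sides.Vᶻ (suc (suc (g ℕ.+ g))) k 0
        ≈⟨ *-congˡ (V₀-odd k g h n≡) ⟩
      2# * (P (suc k) X * [ r ]⟪ x ⟫ * pairFactors (g ℕ.+ h) (suc (suc k)))
        ≈⟨ *-congˡ (*-cong (*-congʳ (trans (P-odd {k} X (sgn-odd {k} k-odd)) (*-cong (qint-k+1 -X≈) (qint-k+2 X≈q^r))))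
             (pairFactors-range (g ℕ.+ h) (suc (suc k)) (ℕ.+-comm k 3) (n-factors g (suc (suc k)) n≡))) ⟩
      2# * ([ k ℕ.+ 1 ]⟪ - (q ^ r) ⟫ * [ k ℕ.+ 2 ]⟪ q ^ r ⟫ * [ r ]⟪ x ⟫ * ∏ (range (k ℕ.+ 3) n) factor)
        ≈⟨ solve 5 (λ t a b c d → t :* (a :* b :* c :* d) := t :* a :* b :* c :* d) refl 2# _ _ _ _ ⟩
      2# * [ k ℕ.+ 1 ]⟪ - (q ^ r) ⟫ * [ k ℕ.+ 2 ]⟪ q ^ r ⟫ * [ r ]⟪ x ⟫ * ∏ (range (k ℕ.+ 3) n) factor ∎

    module _ (k-even : parity k ≡ 0ℙ) where
      private
        even-total : U∖V+V∖U ≈ 2# * ∑< r′ (λ z → Sides.Vᶻ a k (suc z))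
        -- As k is even and positive, it has the form g + g + 2, which provides the shared letter
        -- for the set differences.
        even-total with even⇒double {k} k-even
        ... | zero , ≡.refl = contradiction 1≤k λ ()
        ... | suc g , k≡ with ≡.refl ← ≡.trans k≡ (cong suc (ℕ.+-suc g g)) = trans
          (+-cong (trans (∑-term G⟨ r , n ⟩[ U ∖ V ]) (reflexive (cong₂ (λ U V → ∑ G⟨ r , n ⟩[ U ∖ V ] T) U≡ V≡)))
                  (trans (∑-term G⟨ r , n ⟩[ V ∖ U ]) (reflexive (cong₂ (λ U V → ∑ G⟨ r , n ⟩[ V ∖ U ] T) U≡ V≡))))
          (Totals.total-even A x r′ n a k 1≤a a+k≤n (sgn-even {k} k-even) (S-U∖V a (g ℕ.+ g)) (S-V∖U a (g ℕ.+ g)))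

      even-odd : parity n ≡ 1ℙ →
        U∖V+V∖U ≈
        2# * [ k ℕ.+ 1 ]⟪ - (q ^ r) ⟫ * ([ r ]⟪ x ⟫ + - 1#) * ∏ (range (k ℕ.+ 2) n) factor
      even-odd n-odd
        with g , a≡ ← odd⇒double {a} (≡.trans parity-a (cong₂ ℙ._+_ n-odd k-even))
        with n≡ ← n-odd-a {g} a≡ = begin
        U∖V+V∖U
          ≈⟨ even-total ⟩
        2# * ∑< r′ (λ z → Sides.Vᶻ a k (suc z))
          ≡⟨ cong (λ a → 2# * ∑< r′ (λ z → Sides.Vᶻ a k (suc z))) a≡ ⟩
        2# * ∑< r′ (λ z → Sides.Vᶻ (suc (g ℕ.+ g)) k (suc z))
          ≈⟨ *-congˡ (V₊-even k g h n≡) ⟩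
        2# * ([ suc k ]⟪ - X ⟫ * ([ r ]⟪ x ⟫ + - 1#) * pairFactors (g ℕ.+ h) (suc k))
          ≈⟨ *-congˡ (*-cong (*-congʳ (qint-k+1 -X≈)) (pairFactors-range (g ℕ.+ h) (suc k) (ℕ.+-comm k 2) (n-factors g (suc k) n≡))) ⟩
        2# * ([ k ℕ.+ 1 ]⟪ - (q ^ r) ⟫ * ([ r ]⟪ x ⟫ + - 1#) * ∏ (range (k ℕ.+ 2) n) factor)
          ≈⟨ solve 4 (λ t a b c → t :* (a :* b :* c) := t :* a :* b :* c) refl 2# _ _ _ ⟩
        2# * [ k ℕ.+ 1 ]⟪ - (q ^ r) ⟫ * ([ r ]⟪ x ⟫ + - 1#) * ∏ (range (k ℕ.+ 2) n) factor ∎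

      even-even : parity n ≡ 0ℙ →
        U∖V+V∖U ≈
        2# * (- x * [ r′ ]⟪ sgn r * x ⟫ * [ r ]⟪ sgn r′ * x ⟫) * [ k ℕ.+ 1 ]⟪ q ^ r ⟫ * [ k ℕ.+ 2 ]⟪ - (q ^ r) ⟫
          * ∏ (range (k ℕ.+ 3) n) factor
      even-even n-even
        with g , a≡ ← even-a (≡.trans parity-a (cong₂ ℙ._+_ n-even k-even))
        with n≡ ← n-even-a {g} a≡ = begin
        U∖V+V∖U
          ≈⟨ even-total ⟩
        2# * ∑< r′ (λ z → Sides.Vᶻ a k (suc z))
          ≡⟨ cong (λ a → 2# * ∑< r′ (λ z → Sides.Vᶻ a k (suc z))) a≡ ⟩
        2# * ∑< r′ (λ z → Sides.Vᶻ (suc (suc (g ℕ.+ g))) k (suc z))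
          ≈⟨ *-congˡ (V₊-odd k g h n≡) ⟩
        2# * ((- x * P r′ x) * P (suc k) X * pairFactors (g ℕ.+ h) (suc (suc k)))
          ≈⟨ *-congˡ (*-cong (*-cong (*-congˡ (P-factor r′ x)) (trans (P-even {k} X (sgn-even {k} k-even)) (*-cong (qint-k+1 X≈q^r) (qint-k+2 -X≈))))
               (pairFactors-range (g ℕ.+ h) (suc (suc k)) (ℕ.+-comm k 3) (n-factors g (suc (suc k)) n≡))) ⟩
        2# * ((- x * ([ r′ ]⟪ sgn r * x ⟫ * [ r ]⟪ sgn r′ * x ⟫)) * ([ k ℕ.+ 1 ]⟪ q ^ r ⟫ * [ k ℕ.+ 2 ]⟪ - (q ^ r) ⟫) * ∏ (range (k ℕ.+ 3) n) factor)
          ≈⟨ solve 7 (λ t y a b c d e → t :* ((y :* (a :* b)) :* (c :* d) :* e) := t :* (y :* a :* b) :* c :* d :* e) refl 2# (- x) _ _ _ _ _ ⟩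
        2# * (- x * [ r′ ]⟪ sgn r * x ⟫ * [ r ]⟪ sgn r′ * x ⟫) * [ k ℕ.+ 1 ]⟪ q ^ r ⟫ * [ k ℕ.+ 2 ]⟪ - (q ^ r) ⟫
          * ∏ (range (k ℕ.+ 3) n) factor ∎

-- Constants, characters and specialization to polynomials in q

module PolynomialIdentities {c ℓ} (R : CommutativeRing c ℓ) where
  open CommutativeRing R
  open GeneratingFunctions R
  open Polynomials R
  open Exp commutativeSemiring using (^-assocʳ; ^-congˡ)

  const-cong : ∀ {a b} → a ≈ b → const a ≈ₚ const b
  const-cong a≈b zero    = a≈b
  const-cong a≈b (suc i) = refl

  const-^ : ∀ a m → const (a ^ m) ≈ₚ const a ^ₚ m
  const-^ a zero    i = refl
  const-^ a (suc m) i = trans (const-*ₚ a (a ^ m) i) (*ₚ-congʳ (const a) (const (a ^ m)) (const a ^ₚ m) (const-^ a m) i)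

  const-χ : ∀ ζ h π → const (χ (- 1#) ζ h π) ≈ₚ (-ₚ 1ₚ) ^ₚ inv (map ∣_∣ π) *ₚ const (ζ ^ h) ^ₚ col π
  const-χ ζ h π i = trans (const-*ₚ s (ζ ^ (h ℕ.* col π)) i)
    (trans (*ₚ-congˡ (const s) s′ (const (ζ ^ (h ℕ.* col π))) (const-^ (- 1#) (inv (map ∣_∣ π))) i)
           (*ₚ-congʳ s′ (const (ζ ^ (h ℕ.* col π))) (const (ζ ^ h) ^ₚ col π)
             (λ j → trans (const-cong (sym (^-assocʳ ζ h (col π))) j) (const-^ (ζ ^ h) (col π) j)) i))
    where
    s  = (- 1#) ^ inv (map ∣_∣ π)
    s′ = (-ₚ 1ₚ) ^ₚ inv (map ∣_∣ π)

  const-root : ∀ {r ζ} → ζ ^ r ≈ 1# → ∀ h → const (ζ ^ h) ^ₚ r ≈ₚ 1ₚ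
  const-root {r} {ζ} ζ^r≈1 h i = trans (sym (const-^ (ζ ^ h) r i)) (const-cong (begin
    (ζ ^ h) ^ r  ≈⟨ ^-assocʳ ζ h r ⟩
    ζ ^ (h ℕ.* r)  ≡⟨ cong (ζ ^_) (ℕ.*-comm h r) ⟩
    ζ ^ (r ℕ.* h)  ≈⟨ ^-assocʳ ζ r h ⟨
    (ζ ^ r) ^ h  ≈⟨ ^-congˡ h ζ^r≈1 ⟩
    1# ^ h  ≈⟨ one-^ h ⟩
    1# ∎) i)
    where
    open SetoidReasoning setoid
    one-^ : ∀ h → 1# ^ h ≈ 1#
    one-^ zero    = refl
    one-^ (suc h) = trans (*-identityˡ _) (one-^ h)

open import Data.Nat.Base using (_+_; _*_)

theorem2p3 :
  ∀ {c ℓ} (R : CommutativeRing c ℓ) →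
  let open CommutativeRing R using (Carrier)
      open CommutativeRing R using (1#)
      open CommutativeRing R using (-_)
      open GeneratingFunctions R
  in
  (r n : ℕ) .{{_ : NonZero r}} .{{_ : NonZero n}} →
  (ζ : Carrier) → IsPrimitiveRoot r ζ →
  (h : ℕ) → h < r →
  (k b : ℕ) → 1 ≤ k → k ≤ n ∸ 1 → k + 1 ≤ b → b ≤ n → parity b ≡ parity n →
  let U = uncolored (range (b ∸ k) (b ∸ 1))
      V = uncolored (range (b ∸ k + 1) b)
      term = λ π → const (χ (- 1#) ζ h π) *ₚ q ^ₚ fmaj r π
      ζʰq = const (ζ ^ h) *ₚ q
      ± = λ m → (-ₚ 1ₚ) ^ₚ m
      f = -ₚ ζʰq *ₚ [ r ∸ 1 ]⟨ ± r *ₚ ζʰq ⟩ *ₚ [ r ]⟨ ± (r ∸ 1) *ₚ ζʰq ⟩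
  in
  (parity k ≡ 1ℙ →
    let lhs = (∑[ π ∈ G⟨ r , n ⟩[ U ] ] term π) +ₚ (∑[ π ∈ G⟨ r , n ⟩[ V ] ] term π)
    in
    (parity n ≡ 0ℙ →
      lhs ≈ₚ 2ₚ *ₚ [ k + 1 ]⟨ -ₚ (q ^ₚ r) ⟩
                *ₚ (∏[ i ∈ range (k + 2) n ] [ i * r ]⟨ ± (i ∸ 1) *ₚ ζʰq ⟩))
    ×
    (parity n ≡ 1ℙ →
      lhs ≈ₚ 2ₚ *ₚ [ k + 1 ]⟨ -ₚ (q ^ₚ r) ⟩ *ₚ [ k + 2 ]⟨ q ^ₚ r ⟩ *ₚ [ r ]⟨ ζʰq ⟩
                *ₚ (∏[ i ∈ range (k + 3) n ] [ i * r ]⟨ ± (i ∸ 1) *ₚ ζʰq ⟩)))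
  ×
  (parity k ≡ 0ℙ →
    let lhs = (∑[ π ∈ G⟨ r , n ⟩[ U ∖ V ] ] term π) +ₚ (∑[ π ∈ G⟨ r , n ⟩[ V ∖ U ] ] term π)
    in
    (parity n ≡ 1ℙ →
      lhs ≈ₚ 2ₚ *ₚ [ k + 1 ]⟨ -ₚ (q ^ₚ r) ⟩ *ₚ ([ r ]⟨ ζʰq ⟩ +ₚ -ₚ 1ₚ)
                *ₚ (∏[ i ∈ range (k + 2) n ] [ i * r ]⟨ ± (i ∸ 1) *ₚ ζʰq ⟩))
    ×
    (parity n ≡ 0ℙ →
      lhs ≈ₚ 2ₚ *ₚ f *ₚ [ k + 1 ]⟨ q ^ₚ r ⟩ *ₚ [ k + 2 ]⟨ -ₚ (q ^ₚ r) ⟩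
                *ₚ (∏[ i ∈ range (k + 3) n ] [ i * r ]⟨ ± (i ∸ 1) *ₚ ζʰq ⟩)))
theorem2p3 R zero     n ζ prim h ()
theorem2p3 R (suc r′) n ζ prim h _ k b 1≤k k≤n-1 k+1≤b b≤n b~n =
  (λ k-odd → odd-even k-odd , odd-odd k-odd) ,
  (λ k-even → even-odd k-even , even-even k-even)
  where
  open CommutativeRing R using (1#; -_)
  open GeneratingFunctions R
  open Polynomials R
  open PolynomialIdentities R
  w^r≈1 : const (ζ ^ h) ^ₚ suc r′ ≈ₚ 1ₚ
  w^r≈1 = const-root {suc r′} (IsPrimitiveRoot.ζ^r≈1 prim) h
  term : Word → Poly
  term π = const (χ (- 1#) ζ h π) *ₚ q ^ₚ fmaj (suc r′) π
  open Identities polynomialRing (const (ζ ^ h)) q r′ n w^r≈1 using (monomial≈T)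
  term≈T : ∀ π → term π ≈ₚ Statistic.T polynomialRing (const (ζ ^ h) *ₚ q) (suc r′) π
  term≈T π = monomial≈T π {const (χ (- 1#) ζ h π)} (const-χ ζ h π)
  open Identities.Sums± polynomialRing (const (ζ ^ h)) q r′ n w^r≈1 term term≈T k b 1≤k k+1≤b b≤n b~n
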